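{- Let $s,t\ge0$ and fix a cover of $\Pi^*_{s,t}$. For each $c\ge1$ let $x_c$ be the number of simplices of class $c$ in the cover. Then for every $t'$ with $0\le t'\le t$ and every $s'$ with $0\le s'\le s+t-t'$, $$\sum_{c=1}^{V(s,t)}\frac{c\cdot x_c}{(s'+2t')!}\,F(s,t,c,s',t',c)\ \ge\ \frac{Q(s,t,s',t')}{2^{t'}}.$$
   Context: $\Delta^d$ is the convex hull of the standard unit vectors of $\mathbb{R}^{d+1}$. $\Pi^*_{s,t}$ is the product of $s$ copies of $\Delta^1$ followed by $t$ copies of $\Delta^2$, of dimension $N=s+2t$, written in standard coordinates (one block $\mathbf x^i\in\Delta^{c_i}$ per factor); its vertices are the $0/1$ points. For a vertex $\mathbf v$, reduced coordinates with respect to $\mathbf v$ are obtained by deleting in each factor the coordinate at which $\mathbf v$ equals $1$. The class of an $N$-simplex with vertices among the vertices of $\Pi^*_{s,t}$ is $|\det[\mathbf 1\mid M_{\mathbf v}]|$, where the rows of $M_{\mathbf v}$ are the reduced coordinates of its vertices (this is $N!$ times its volume in reduced coordinates); a $k$-simplex whose vertices are vertices of a $k$-dimensional face $G$ of the simplotope has class computed in the same way inside the simplotope $G$. A cover of a polytope $P$ is a collection of full-dimensional simplices, each with vertices among the vertices of $P$, whose union is $P$. An exterior $j$-face of such a simplex $\alpha$ is a $j$-dimensional face of $\alpha$ whose $j+1$ vertices lie in a common $j$-dimensional face of the simplotope. A $\Pi_{s',t'}$ face of $\Pi^*_{s,t}$ is a face that is a product of exactly $s'$ segments and $t'$ triangles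 (other factors being points); $Q(s,t,s',t')$ is the number of such faces. $F(s,t,c,s',t',c')$ is the maximum, over all $N$-simplices $\alpha$ of class $c$ with vertices among the vertices of $\Pi^*_{s,t}$, of the number of exterior $(s'+2t')$-faces of $\alpha$ that lie in a $\Pi_{s',t'}$ face of $\Pi^*_{s,t}$ and have class $c'$. $V(s,t)$ is the largest possible class of a simplex in a cover of $\Pi^*_{s,t}$. -}

module Defs where

open import Data.Bool using (Bool; true; false; if_then_else_; _∧_; _∨_)
open import Data.Nat as ℕ using (ℕ; zero; suc; _+_; _*_; _≤_; _⊔_)
open import Data.Integer as ℤ using (ℤ; +_; ∣_∣)
open import Data.Rational as ℚ using (ℚ; 0ℚ; 1ℚ)
open import Data.Fin as Fin using (Fin)
open import Data.Vec as Vec using (Vec; []; _∷_)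
open import Data.List as List using (List; []; _∷_; map; concatMap; length; filter; foldr; allFin; zipWith; replicate; _++_)
open import Data.List.Relation.Unary.All using (All)
open import Data.List.Relation.Unary.Any using (Any)
open import Data.List.Relation.Unary.AllPairs using (AllPairs)
open import Data.List.Relation.Unary.Unique.Propositional using (Unique)
open import Data.List.Relation.Binary.Permutation.Propositional using (_↭_)
open import Data.Product using (_×_; _,_; Σ; ∃)
open import Data.Sum using (_⊎_; inj₁; inj₂)
import Data.Bool.ListAction
open import Data.Unit using (⊤; tt)
open import Data.Empty using (⊥)
open import Relation.Nullary using (¬_)
open import Relation.Nullary.Decidable using (⌊_⌋)
open import Relation.Binary.PropositionalEquality using (_≡_; _≢_)

-- Simplotopes given by a list of factor dimensions ds = (c_1,…,c_m):
-- the product Δ^{c_1} × ⋯ × Δ^{c_m}, in standard coordinates.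

-- Π*_{s,t}: s copies of Δ^1 followed by t copies of Δ^2.
dims : ℕ → ℕ → List ℕ
dims s t = replicate s 1 ++ replicate t 2

dimOf : List ℕ → ℕ
dimOf = foldr _+_ 0

-- A vertex (0/1 point): in each factor Δ^c, the position of the single 1.
Vertex : List ℕ → Set
Vertex []       = ⊤
Vertex (c ∷ cs) = Fin (suc c) × Vertex cs

allVertices : (ds : List ℕ) → List (Vertex ds)
allVertices []       = tt ∷ []
allVertices (c ∷ cs) =
  concatMap (λ i → map (λ w → (i , w)) (allVertices cs)) (allFin (suc c))

Coord : List ℕ → Set
Coord []       = ⊥
Coord (c ∷ cs) = Fin (suc c) ⊎ Coord cs

Point : List ℕ → Set
Point ds = Coord ds → ℚ

sumℚ : List ℚ → ℚ
sumℚ = foldr ℚ._+_ 0ℚ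

vcoord : {ds : List ℕ} → Vertex ds → Point ds
vcoord {c ∷ cs} (i , w) (inj₁ j) = if ⌊ i Fin.≟ j ⌋ then 1ℚ else 0ℚ
vcoord {c ∷ cs} (i , w) (inj₂ x) = vcoord w x

InP : {ds : List ℕ} → Point ds → Set
InP {[]}     p = ⊤
InP {c ∷ cs} p =
  (∀ j → 0ℚ ℚ.≤ p (inj₁ j)) ×
  sumℚ (map (λ j → p (inj₁ j)) (allFin (suc c))) ≡ 1ℚ ×
  InP {cs} (λ x → p (inj₂ x))

InHull : {ds : List ℕ} → List (Vertex ds) → Point ds → Set
InHull {ds} σ p =
  Σ (List ℚ) λ λs →
    length λs ≡ length σ ×
    All (λ a → 0ℚ ℚ.≤ a) λs ×
    sumℚ λs ≡ 1ℚ ×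
    (∀ (x : Coord ds) → p x ≡ sumℚ (zipWith (λ a w → a ℚ.* vcoord w x) λs σ))

-- Faces of the simplotope: in each factor a nonempty subset S_i of the
-- c_i+1 standard positions (a face is the product of the faces conv(S_i)).

Sub : ℕ → Set
Sub n = Vec Bool n

allSubs : (n : ℕ) → List (Sub n)
allSubs zero    = [] ∷ []
allSubs (suc n) = map (true ∷_) (allSubs n) ++ map (false ∷_) (allSubs n)

elems : {n : ℕ} → Sub n → List (Fin n)
elems {n} S = filter (λ j → Data.Bool.T? (Vec.lookup S j)) (allFin n)
  where import Data.Bool

size : {n : ℕ} → Sub n → ℕ
size S = length (elems S)

Face : List ℕ → Set
Face []       = ⊤
Face (c ∷ cs) = Sub (suc c) × Face cs

allFaces : (ds : List ℕ) → List (Face ds)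
allFaces []       = tt ∷ []
allFaces (c ∷ cs) =
  concatMap (λ S → map (λ G → (S , G)) (allFaces cs))
            (filter (λ S → 1 ℕ.≤? size S) (allSubs (suc c)))

fullFace : (ds : List ℕ) → Face ds
fullFace []       = tt
fullFace (c ∷ cs) = Vec.replicate (suc c) true , fullFace cs

inFace : {ds : List ℕ} → Face ds → Vertex ds → Bool
inFace {[]}     tt      tt      = true
inFace {c ∷ cs} (S , G) (i , w) = Vec.lookup S i ∧ inFace G w

nSeg : {ds : List ℕ} → Face ds → ℕ
nSeg {[]}     tt      = 0
nSeg {c ∷ cs} (S , G) = (if ⌊ size S ℕ.≟ 2 ⌋ then 1 else 0) + nSeg G

nTri : {ds : List ℕ} → Face ds → ℕ
nTri {[]}     tt      = 0
nTri {c ∷ cs} (S , G) = (if ⌊ size S ℕ.≟ 3 ⌋ then 1 else 0) + nTri G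

isType : {ds : List ℕ} → ℕ → ℕ → Face ds → Bool
isType s' t' G = ⌊ nSeg G ℕ.≟ s' ⌋ ∧ ⌊ nTri G ℕ.≟ t' ⌋

-- Class of a simplex inside a face G (viewed as a simplotope in its own
-- standard coordinates, i.e. the coordinates indexed by the S_i).
-- Reduced coordinates w.r.t. the vertex of G having, in each factor, the
-- least element of S_i: in each factor delete that coordinate.

tail' : {A : Set} → List A → List A
tail' []       = []
tail' (_ ∷ xs) = xs

reduced : {ds : List ℕ} → Face ds → Vertex ds → List ℤ
reduced {[]}     tt      tt      = []
reduced {c ∷ cs} (S , G) (i , w) =
  map (λ e → if ⌊ i Fin.≟ e ⌋ then + 1 else + 0) (tail' (elems S))
  ++ reduced G w

deleteAt : {A : Set} → ℕ → List A → List A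
deleteAt _       []       = []
deleteAt zero    (_ ∷ xs) = xs
deleteAt (suc j) (x ∷ xs) = x ∷ deleteAt j xs

detN : ℕ → List (List ℤ) → ℤ
detN zero    _          = + 1
detN (suc n) []         = + 1
detN (suc n) (r ∷ rows) = go 0 true r
  where
  go : ℕ → Bool → List ℤ → ℤ
  go j pos [] = + 0
  go j pos (a ∷ as) =
    (if pos then a else ℤ.- a) ℤ.* detN n (map (deleteAt j) rows)
    ℤ.+ go (suc j) (Data.Bool.not pos) as
    where import Data.Bool

det : List (List ℤ) → ℤ
det m = detN (length m) m

classIn : {ds : List ℕ} → Face ds → List (Vertex ds) → ℕ
classIn G σ = ∣ det (map (λ w → + 1 ∷ reduced G w) σ) ∣

classOf : {ds : List ℕ} → List (Vertex ds) → ℕ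
classOf {ds} σ = classIn (fullFace ds) σ

choose : {A : Set} → ℕ → List A → List (List A)
choose zero    _        = [] ∷ []
choose (suc k) []       = []
choose (suc k) (x ∷ xs) = map (x ∷_) (choose k xs) ++ choose (suc k) xs

count : {A : Set} → (A → Bool) → List A → ℕ
count p xs = length (List.filter (λ a → Data.Bool.T? (p a)) xs)
  where import Data.Bool

maximum : List ℕ → ℕ
maximum = foldr _⊔_ 0

-- an N-simplex with vertices among vertices of the simplotope:
-- N+1 distinct, affinely independent vertices (class ≠ 0)
IsFullSimplex : {ds : List ℕ} → List (Vertex ds) → Set
IsFullSimplex {ds} σ =
  length σ ≡ suc (dimOf ds) × Unique σ × classOf σ ≢ 0

IsCover : {ds : List ℕ} → List (List (Vertex ds)) → Set
IsCover {ds} cov =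
  All IsFullSimplex cov ×
  AllPairs (λ σ τ → ¬ (σ ↭ τ)) cov ×
  (∀ (p : Point ds) → InP p → Any (λ σ → InHull σ p) cov)

Q : ℕ → ℕ → ℕ → ℕ → ℕ
Q s t s' t' = count (isType s' t') (allFaces (dims s t))

-- number of exterior (s'+2t')-faces of α lying in a Π_{s',t'} face and
-- having class c'
extCount : (s t s' t' c' : ℕ) → List (Vertex (dims s t)) → ℕ
extCount s t s' t' c' α =
  count (λ W → Data.Bool.ListAction.any (λ G → isType s' t' G
                              ∧ Data.Bool.ListAction.all (inFace G) W
                              ∧ ⌊ classIn G W ℕ.≟ c' ⌋)
                        (allFaces (dims s t)))
        (choose (suc (s' + 2 * t')) α)

-- F(s,t,c,s',t',c'): maximum over N-simplices α of class c
-- (0 if there is none)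
F : (s t c s' t' c' : ℕ) → ℕ
F s t c s' t' c' =
  maximum (map (extCount s t s' t' c')
               (filter (λ α → classOf α ℕ.≟ c)
                       (choose (suc (dimOf (dims s t))) (allVertices (dims s t)))))

xcount : {ds : List ℕ} → List (List (Vertex ds)) → ℕ → ℕ
xcount cov c = length (filter (λ σ → classOf σ ℕ.≟ c) cov)

IsV : ℕ → ℕ → ℕ → Set
IsV s t v =
  (∃ λ (cov : List (List (Vertex (dims s t)))) →
      IsCover cov × Any (λ σ → classOf σ ≡ v) cov) ×
  (∀ (cov : List (List (Vertex (dims s t)))) →
      IsCover cov → All (λ σ → classOf σ ≤ v) cov)

{-# OPTIONS --safe #-}

-- Fix a face G of type (s′,t′), of dimension k, and count lattice points of n P: the points y whose
-- coordinates outside G are fixed powers of two and whose coordinates in G are large form a family of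
-- size at least (n − const)ᵏ / 2^t′.  If y lies in n σ, where σ has class D, then Cramer's rule gives
-- barycentric coordinates in (1/D)ℤ, and their residues mod D take exactly D values.  Since every power
-- of two exceeds the sum of the smaller ones, σ has at least N − k vertices off G.  If it has more, only
-- O(nᵏ⁻¹) of the points y lie in n σ.  Otherwise the coefficients off G are determined unitriangularly,
-- the exterior face W = σ ∩ G has the same class D as σ, and at most D (n + k)ᵏ / k! points lie in n σ;
-- moreover W meets every coordinate of G, so it determines G.  Let n tend to infinity.
module Submission where

open import Defs
open import Data.Nat using (ℕ; suc; _+_; _*_; _∸_; _^_; _≤_; _!)
open import Data.Nat.Properties using (_!≢0; m^n≢0)
open import Data.Integer using (+_)
open import Data.Rational using (ℚ; _/_)
open import Data.Rational using () renaming (_≤_ to _≤ℚ_)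
open import Data.List using (List; map; upTo)

import Data.Bool.ListAction as BoolList
import Data.Bool.Properties as 𝔹
open import Data.Bool using (Bool; true; false; not; if_then_else_; _∧_; T; T?)
open import Data.Empty using (⊥; ⊥-elim)
open import Data.Fin as Fin using (Fin)
import Data.Fin.Properties as Fin
import Data.Integer as ℤ
import Data.Integer.DivMod as ℤ
import Data.Integer.Properties as ℤ
open import Data.Integer using (ℤ; ∣_∣)
open import Data.Integer.Divisibility.Signed as ℤ∣ using (divides) renaming (_∣_ to _∣ℤ_)
open import Data.Integer.Tactic.RingSolver using (solve-∀)
open import Data.List using ([]; _∷_; _++_; length; replicate; tabulate; zipWith; filter; concatMap; allFin; cartesianProduct)
import Data.List.Properties as List
open import Data.Nat.ListAction using (sum)
open import Data.List.Membership.Propositional using (_∈_; _∉_)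
import Data.List.Membership.Propositional.Properties as ∈
open import Data.List.Relation.Unary.All as All using (All; []; _∷_)
import Data.List.Relation.Unary.All.Properties as All
open import Data.List.Relation.Unary.AllPairs using ([]; _∷_)
import Data.List.Relation.Unary.Any.Properties as Any
open import Data.List.Relation.Unary.Any as Any using (here; there)
open import Data.List.Relation.Unary.Unique.Propositional using (Unique)
import Data.List.Relation.Unary.Unique.Propositional.Properties as Unique
import Data.Nat as ℕ
open import Data.Nat using (zero; z≤n; s≤s; _<_; NonZero)
import Data.Nat.DivMod as ℕ
import Data.Nat.Divisibility as ℕ∣
import Data.Nat.Properties as ℕ
import Data.Nat.Tactic.RingSolver as ℕ-Ring
open import Data.Product using (_×_; _,_; ∃; ∃₂; proj₁; proj₂)
import Data.Rational as ℚ
import Data.Rational.Properties as ℚ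
import Data.Rational.Unnormalised as ℚᵘ
import Data.Rational.Unnormalised.Properties as ℚᵘ
open import Data.Sum as Sum using (_⊎_; inj₁; inj₂)
open import Data.Unit using (⊤; tt)
import Data.Vec.Properties as Vec
open import Data.Vec as Vec using (Vec; []; _∷_)
open import Function using (_∘_; id)
open import Relation.Binary.PropositionalEquality
open import Relation.Nullary using (¬_; yes; no; contradiction)
open import Relation.Nullary.Decidable using (⌊_⌋; Dec)

-- Determinants under column operations

-- Points of G itself would not do: if G is a vertex, it may belong to a simplex of class 2,
-- although the exterior face there has class 1. Moving off G by powers of two discards such
-- simplices, and this is why only `F` with equal classes enters the inequality. Lattice points
-- replace volume because a cover is given pointwise and its simplices may overlap. The count of
-- residues and the equality of classes rest on one fact: a square integral matrix of determinant ±D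
-- has exactly D left solutions modulo any positive multiple of D. For the classes, solutions for W
-- are extended by zero to solutions for σ and the two sets are counted; this replaces block
-- determinants, and also the invariance of the determinant, up to sign, under reordering of rows. A
-- simplex then accounts, for each exterior face, for at most D residue vectors times C(n+k, k)
-- vectors of quotients, while a triangle holds C(m+2, 2) lattice points: hence the constants k! and
-- 2 per triangle.

signed : Bool → ℤ → ℤ
signed pos a = if pos then a else ℤ.- a

laplace : ℕ → List (List ℤ) → ℕ → Bool → List ℤ → ℤ
laplace n rows j pos []       = + 0
laplace n rows j pos (a ∷ as) =
  signed pos a ℤ.* detN n (map (deleteAt j) rows) ℤ.+ laplace n rows (suc j) (not pos) as

-- The recursion inside detN is local to its where block; abstracting over its starting values lets
-- Agda solve the underscore by that local function.
mutual
  detN-go : ∀ n rows (r : List ℤ) j pos as → _ ≡ laplace n rows j pos as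
  detN-go n rows r j pos []       = refl
  detN-go n rows r j pos (a ∷ as) =
    cong (ℤ._+_ (signed pos a ℤ.* detN n (map (deleteAt j) rows))) (detN-go n rows r (suc j) (not pos) as)

  detN-laplace : ∀ n r rows → detN (suc n) (r ∷ rows) ≡ laplace n rows 0 true r
  detN-laplace n []       rows = refl
  detN-laplace n (a ∷ as) rows with a ∷ as | 1 | false
  ... | r | j | pos = cong (ℤ._+_ (a ℤ.* detN n (map (deleteAt 0) rows))) (detN-go n rows r j pos as)

Shape : ℕ → ℕ → List (List ℤ) → Set
Shape m n rows = length rows ≡ m × All (λ r → length r ≡ n) rows

length-deleteAt : ∀ {A : Set} j (r : List A) {n} → j ≤ n → length r ≡ suc n → length (deleteAt j r) ≡ n
length-deleteAt zero    (x ∷ r) _ eq = ℕ.suc-injective eq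
length-deleteAt (suc j) (x ∷ r) {suc n} (s≤s j≤n) eq = cong suc (length-deleteAt j r j≤n (ℕ.suc-injective eq))

Shape-deleteAt : ∀ {m n rows} j → j ≤ n → Shape m (suc n) rows → Shape m n (map (deleteAt j) rows)
Shape-deleteAt {rows = rows} j j≤n (l , all) =
  trans (List.length-map (deleteAt j) rows) l , All.map⁺ (All.map (λ {r} → length-deleteAt j r j≤n) all)

deleteAt-deleteAt : ∀ {A : Set} {i j} (r : List A) → j ≤ i →
  deleteAt j (deleteAt (suc i) r) ≡ deleteAt i (deleteAt j r)
deleteAt-deleteAt {i = i} [] z≤n    = sym (deleteAt-[] i)
  where
  deleteAt-[] : ∀ {A : Set} j → deleteAt {A} j [] ≡ []
  deleteAt-[] zero    = refl
  deleteAt-[] (suc j) = refl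
deleteAt-deleteAt []      (s≤s p) = refl
deleteAt-deleteAt (x ∷ r) z≤n     = refl
deleteAt-deleteAt (x ∷ r) (s≤s p) = cong (x ∷_) (deleteAt-deleteAt r p)

-- What is left of the pair of columns mixed by `colop` below when one of the two is deleted.
merge : ℕ → ℤ → ℤ → List ℤ → List ℤ
merge i       γ δ []          = []
merge zero    γ δ (x ∷ [])    = x ∷ []
merge zero    γ δ (x ∷ y ∷ r) = γ ℤ.* x ℤ.+ δ ℤ.* y ∷ r
merge (suc i) γ δ (x ∷ r)     = x ∷ merge i γ δ r

module _ (γ δ : ℤ) where

  deleteAt-merge-< : ∀ {i j} r → j ≤ i → deleteAt j (merge (suc i) γ δ r) ≡ merge i γ δ (deleteAt j r)
  deleteAt-merge-< {i} {zero}  []      _       = refl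
  deleteAt-merge-< {i} {suc j} []      _       = refl
  deleteAt-merge-< (x ∷ r) z≤n     = refl
  deleteAt-merge-< (x ∷ r) (s≤s p) = cong (x ∷_) (deleteAt-merge-< r p)

  deleteAt-merge-> : ∀ {i j} r → i ≤ j → deleteAt (suc j) (merge i γ δ r) ≡ merge i γ δ (deleteAt (suc (suc j)) r)
  deleteAt-merge-> []          z≤n     = refl
  deleteAt-merge-> []          (s≤s p) = refl
  deleteAt-merge-> (x ∷ [])    z≤n     = refl
  deleteAt-merge-> (x ∷ y ∷ r) z≤n     = refl
  deleteAt-merge-> (x ∷ r)     (s≤s p) = cong (x ∷_) (deleteAt-merge-> r p)

  deleteAt-merge : ∀ i r → deleteAt i (merge i γ δ r) ≡ deleteAt i (deleteAt i r)
  deleteAt-merge zero    []          = refl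
  deleteAt-merge zero    (x ∷ [])    = refl
  deleteAt-merge zero    (x ∷ y ∷ r) = refl
  deleteAt-merge (suc i) []          = refl
  deleteAt-merge (suc i) (x ∷ r)     = cong (x ∷_) (deleteAt-merge i r)

map-map-cong : ∀ {A B C D : Set} {f : B → C} {g : A → B} {h : D → C} {k : A → D} →
  (∀ x → f (g x) ≡ h (k x)) → ∀ xs → map f (map g xs) ≡ map h (map k xs)
map-map-cong eq xs = trans (sym (List.map-∘ xs)) (trans (List.map-cong eq xs) (List.map-∘ xs))

signed-linear : ∀ pos γ δ x y → signed pos (γ ℤ.* x ℤ.+ δ ℤ.* y) ≡ γ ℤ.* signed pos x ℤ.+ δ ℤ.* signed pos y
signed-linear true  γ δ x y = refl
signed-linear false γ δ x y = go γ δ x y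
  where
  go : ∀ γ δ x y → ℤ.- (γ ℤ.* x ℤ.+ δ ℤ.* y) ≡ γ ℤ.* (ℤ.- x) ℤ.+ δ ℤ.* (ℤ.- y)
  go = solve-∀

-- Linearity in one column, with both values presented as deletions from a single wider matrix. At
-- the merged column the entry splits and the minors agree; at every other column the minor splits
-- by induction.
detN-merge : ∀ n i γ δ rows → Shape n (suc n) rows → i < n →
  detN n (map (merge i γ δ) rows) ≡
  γ ℤ.* detN n (map (deleteAt (suc i)) rows) ℤ.+ δ ℤ.* detN n (map (deleteAt i) rows)
detN-merge (suc n) i γ δ (r ∷ rows) (l , rlen ∷ all) (s≤s i≤n) =
  trans (detN-laplace n (merge i γ δ r) (map (merge i γ δ) rows))
  (trans (at≤ 0 i true r refl (trans (ℕ.+-identityʳ _) rlen))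
   (sym (cong₂ (λ u v → γ ℤ.* u ℤ.+ δ ℤ.* v)
     (detN-laplace n (deleteAt (suc i) r) (map (deleteAt (suc i)) rows))
     (detN-laplace n (deleteAt i r) (map (deleteAt i) rows)))))
  where
  sh : Shape n (suc (suc n)) rows
  sh = ℕ.suc-injective l , all
  M X Y : List (List ℤ)
  M = map (merge i γ δ) rows
  X = map (deleteAt (suc i)) rows
  Y = map (deleteAt i) rows

  ring₁ : ∀ γ δ s x y u v → s ℤ.* (γ ℤ.* x ℤ.+ δ ℤ.* y) ℤ.+ (γ ℤ.* u ℤ.+ δ ℤ.* v) ≡
    γ ℤ.* (s ℤ.* x ℤ.+ u) ℤ.+ δ ℤ.* (s ℤ.* y ℤ.+ v)
  ring₁ = solve-∀
  ring₂ : ∀ γ δ x y m u v → (γ ℤ.* x ℤ.+ δ ℤ.* y) ℤ.* m ℤ.+ (γ ℤ.* u ℤ.+ δ ℤ.* v) ≡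
    γ ℤ.* (x ℤ.* m ℤ.+ u) ℤ.+ δ ℤ.* (y ℤ.* m ℤ.+ v)
  ring₂ = solve-∀

  minor> : ∀ j → i ≤ j → suc j ≤ n → detN n (map (deleteAt (suc j)) M) ≡
    γ ℤ.* detN n (map (deleteAt (suc j)) X) ℤ.+ δ ℤ.* detN n (map (deleteAt (suc j)) Y)
  minor> j i≤j j<n =
    trans (cong (detN n) (map-map-cong (λ r → deleteAt-merge-> γ δ r i≤j) rows))
    (trans (detN-merge n i γ δ (map (deleteAt (suc (suc j))) rows) (Shape-deleteAt (suc (suc j)) (s≤s j<n) sh) (ℕ.≤-<-trans i≤j j<n))
     (cong₂ (λ u v → γ ℤ.* detN n u ℤ.+ δ ℤ.* detN n v)
       (map-map-cong (λ r → deleteAt-deleteAt r (s≤s i≤j)) rows)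
       (map-map-cong (λ r → deleteAt-deleteAt r (ℕ.m≤n⇒m≤1+n i≤j)) rows)))

  minor< : ∀ j i′ → i ≡ suc i′ → j ≤ i′ → detN n (map (deleteAt j) M) ≡
    γ ℤ.* detN n (map (deleteAt j) X) ℤ.+ δ ℤ.* detN n (map (deleteAt j) Y)
  minor< j i′ refl j≤i′ =
    trans (cong (detN n) (map-map-cong (λ r → deleteAt-merge-< γ δ r j≤i′) rows))
    (trans (detN-merge n i′ γ δ (map (deleteAt j) rows) (Shape-deleteAt j (ℕ.≤-trans j≤i′ (ℕ.≤-trans (ℕ.n≤1+n i′) (ℕ.≤-trans i≤n (ℕ.n≤1+n n)))) sh) i≤n)
     (cong₂ (λ u v → γ ℤ.* detN n u ℤ.+ δ ℤ.* detN n v)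
       (map-map-cong (λ r → sym (deleteAt-deleteAt r (ℕ.m≤n⇒m≤1+n j≤i′))) rows)
       (map-map-cong (λ r → sym (deleteAt-deleteAt r j≤i′)) rows)))

  at> : ∀ j pos as → i ≤ j → suc j + length as ≡ suc n →
    laplace n M (suc j) pos as ≡ γ ℤ.* laplace n X (suc j) pos as ℤ.+ δ ℤ.* laplace n Y (suc j) pos as
  at> j pos []       _   _  = sym (cong₂ ℤ._+_ (ℤ.*-zeroʳ γ) (ℤ.*-zeroʳ δ))
  at> j pos (a ∷ as) i≤j eq =
    trans (cong₂ (λ u v → signed pos a ℤ.* u ℤ.+ v)
            (minor> j i≤j (ℕ.≤-trans (s≤s (ℕ.m≤m+n j (length as))) (ℕ.≤-reflexive (trans (sym (ℕ.+-suc j _)) (ℕ.suc-injective eq)))))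
            (at> (suc j) (not pos) as (ℕ.m≤n⇒m≤1+n i≤j) (trans (cong suc (sym (ℕ.+-suc j _))) eq)))
          (ring₁ γ δ (signed pos a) _ _ _ _)

  -- Here `as` is the part of the unmerged row from column j on, and p is the distance to the merged
  -- column.
  at≤ : ∀ j p pos as → j + p ≡ i → length as + j ≡ suc (suc n) →
    laplace n M j pos (merge p γ δ as) ≡
    γ ℤ.* laplace n X j pos (deleteAt (suc p) as) ℤ.+ δ ℤ.* laplace n Y j pos (deleteAt p as)
  at≤ j p pos [] refl eq =
    ⊥-elim (ℕ.<-irrefl eq (ℕ.≤-trans (s≤s (ℕ.m≤m+n j p)) (ℕ.≤-trans (s≤s i≤n) (ℕ.n≤1+n _))))
  at≤ j zero pos (x ∷ []) refl eq =
    ⊥-elim (ℕ.<-irrefl (ℕ.suc-injective eq) (ℕ.≤-trans (s≤s (ℕ.m≤m+n j 0)) (s≤s i≤n)))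
  at≤ j zero pos (x ∷ y ∷ as) refl eq =
    trans (cong₂ (λ u v → u ℤ.* detN n (map (deleteAt j) M) ℤ.+ v) (signed-linear pos γ δ x y)
            (at> j (not pos) as (ℕ.≤-reflexive (ℕ.+-identityʳ j)) (trans (cong suc (ℕ.+-comm j _)) (ℕ.suc-injective eq))))
    (trans (ring₂ γ δ (signed pos x) (signed pos y) _ _ _)
     (cong₂ (λ u v → γ ℤ.* (signed pos x ℤ.* detN n u ℤ.+ laplace n X (suc j) (not pos) as) ℤ.+
                     δ ℤ.* (signed pos y ℤ.* detN n v ℤ.+ laplace n Y (suc j) (not pos) as))
       (map-map-cong same′ rows)
       (map-map-cong same rows)))
    where
    same : ∀ r → deleteAt j (merge (j + 0) γ δ r) ≡ deleteAt j (deleteAt (j + 0) r)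
    same r rewrite ℕ.+-identityʳ j = deleteAt-merge γ δ j r
    same′ : ∀ r → deleteAt j (merge (j + 0) γ δ r) ≡ deleteAt j (deleteAt (suc (j + 0)) r)
    same′ r rewrite ℕ.+-identityʳ j = trans (deleteAt-merge γ δ j r) (sym (deleteAt-deleteAt r ℕ.≤-refl))
  at≤ j (suc p) pos (x ∷ as) refl eq =
    trans (cong₂ (λ u v → signed pos x ℤ.* u ℤ.+ v)
            (minor< j (j + p) (ℕ.+-suc j p) (ℕ.m≤m+n j p))
            (at≤ (suc j) p (not pos) as (sym (ℕ.+-suc j p)) (trans (ℕ.+-suc _ j) eq)))
          (ring₁ γ δ (signed pos x) _ _ _ _)

module _ (α β γ δ : ℤ) where

  -- Only adjacent columns are mixed: deleting any other column keeps them adjacent, so induction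
  -- over minors applies.
  colop : ℕ → List ℤ → List ℤ
  colop i       []          = []
  colop zero    (x ∷ [])    = x ∷ []
  colop zero    (x ∷ y ∷ r) = α ℤ.* x ℤ.+ β ℤ.* y ∷ γ ℤ.* x ℤ.+ δ ℤ.* y ∷ r
  colop (suc i) (x ∷ r)     = x ∷ colop i r

  length-colop : ∀ i r → length (colop i r) ≡ length r
  length-colop i       []          = refl
  length-colop zero    (x ∷ [])    = refl
  length-colop zero    (x ∷ y ∷ r) = refl
  length-colop (suc i) (x ∷ r)     = cong suc (length-colop i r)

  Shape-colop : ∀ {m n rows} i → Shape m n rows → Shape m n (map (colop i) rows)
  Shape-colop {rows = rows} i (l , all) =
    trans (List.length-map (colop i) rows) l , All.map⁺ (All.map (λ {r} → trans (length-colop i r)) all)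

  deleteAt-colop-< : ∀ {i j} r → j ≤ i → deleteAt j (colop (suc i) r) ≡ colop i (deleteAt j r)
  deleteAt-colop-< {j = zero}  [] p   = refl
  deleteAt-colop-< {j = suc j} [] p   = refl
  deleteAt-colop-< (x ∷ r)    z≤n     = refl
  deleteAt-colop-< (x ∷ r)    (s≤s p) = cong (x ∷_) (deleteAt-colop-< r p)

  deleteAt-colop-> : ∀ {i j} r → i ≤ j → deleteAt (suc (suc j)) (colop i r) ≡ colop i (deleteAt (suc (suc j)) r)
  deleteAt-colop-> []          p       = refl
  deleteAt-colop-> (x ∷ [])    z≤n     = refl
  deleteAt-colop-> (x ∷ y ∷ r) z≤n     = refl
  deleteAt-colop-> (x ∷ r)     (s≤s p) = cong (x ∷_) (deleteAt-colop-> r p)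

  deleteAt-colop : ∀ i r → suc i < length r → deleteAt i (colop i r) ≡ merge i γ δ r
  deleteAt-colop zero    (x ∷ [])    (s≤s ())
  deleteAt-colop zero    (x ∷ y ∷ r) _       = refl
  deleteAt-colop (suc i) (x ∷ r)     (s≤s p) = cong (x ∷_) (deleteAt-colop i r p)

  deleteAt-suc-colop : ∀ i r → suc i < length r → deleteAt (suc i) (colop i r) ≡ merge i α β r
  deleteAt-suc-colop zero    (x ∷ [])    (s≤s ())
  deleteAt-suc-colop zero    (x ∷ y ∷ r) _       = refl
  deleteAt-suc-colop (suc i) (x ∷ r)     (s≤s p) = cong (x ∷_) (deleteAt-suc-colop i r p)

  -- The terms of columns i and i+1 have opposite signs, and by `detN-merge` their minors are
  -- combinations of the same two minors. The products that do not carry `α δ − β γ` cancel.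
  detN-colop : ∀ n i rows → Shape n n rows → suc i < n →
    detN n (map (colop i) rows) ≡ (α ℤ.* δ ℤ.- β ℤ.* γ) ℤ.* detN n rows
  detN-colop (suc n) i (r ∷ rows) (l , rlen ∷ all) (s≤s i<n) =
    trans (detN-laplace n (colop i r) (map (colop i) rows))
    (trans (at≤ 0 i true r refl (trans (ℕ.+-identityʳ _) rlen))
     (cong (Δ ℤ.*_) (sym (detN-laplace n r rows))))
    where
    sh : Shape n (suc n) rows
    sh = ℕ.suc-injective l , all
    Δ = α ℤ.* δ ℤ.- β ℤ.* γ
    M : List (List ℤ)
    M = map (colop i) rows

    ring₁ : ∀ Δ s u v → s ℤ.* (Δ ℤ.* u) ℤ.+ Δ ℤ.* v ≡ Δ ℤ.* (s ℤ.* u ℤ.+ v)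
    ring₁ = solve-∀
    ring₂ : ∀ α β γ δ x y u v w →
      (α ℤ.* x ℤ.+ β ℤ.* y) ℤ.* (γ ℤ.* u ℤ.+ δ ℤ.* v) ℤ.+
      ((ℤ.- (γ ℤ.* x ℤ.+ δ ℤ.* y)) ℤ.* (α ℤ.* u ℤ.+ β ℤ.* v) ℤ.+ (α ℤ.* δ ℤ.- β ℤ.* γ) ℤ.* w) ≡
      (α ℤ.* δ ℤ.- β ℤ.* γ) ℤ.* (x ℤ.* v ℤ.+ ((ℤ.- y) ℤ.* u ℤ.+ w))
    ring₂ = solve-∀
    ring₃ : ∀ α β γ δ x y u v w →
      (ℤ.- (α ℤ.* x ℤ.+ β ℤ.* y)) ℤ.* (γ ℤ.* u ℤ.+ δ ℤ.* v) ℤ.+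
      ((γ ℤ.* x ℤ.+ δ ℤ.* y) ℤ.* (α ℤ.* u ℤ.+ β ℤ.* v) ℤ.+ (α ℤ.* δ ℤ.- β ℤ.* γ) ℤ.* w) ≡
      (α ℤ.* δ ℤ.- β ℤ.* γ) ℤ.* ((ℤ.- x) ℤ.* v ℤ.+ (y ℤ.* u ℤ.+ w))
    ring₃ = solve-∀
    ring : ∀ pos x y u v w →
      signed pos (α ℤ.* x ℤ.+ β ℤ.* y) ℤ.* (γ ℤ.* u ℤ.+ δ ℤ.* v) ℤ.+
      (signed (not pos) (γ ℤ.* x ℤ.+ δ ℤ.* y) ℤ.* (α ℤ.* u ℤ.+ β ℤ.* v) ℤ.+ Δ ℤ.* w) ≡
      Δ ℤ.* (signed pos x ℤ.* v ℤ.+ (signed (not pos) y ℤ.* u ℤ.+ w))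
    ring true  = ring₂ α β γ δ
    ring false = ring₃ α β γ δ

    at> : ∀ j pos as → i ≤ j → suc (suc j) + length as ≡ suc n →
      laplace n M (suc (suc j)) pos as ≡ Δ ℤ.* laplace n rows (suc (suc j)) pos as
    at> j pos []       _   _  = sym (ℤ.*-zeroʳ Δ)
    at> j pos (a ∷ as) i≤j eq =
      trans (cong₂ (λ u v → signed pos a ℤ.* u ℤ.+ v)
              (trans (cong (detN n) (map-map-cong (λ r → deleteAt-colop-> r i≤j) rows))
                     (detN-colop n i _ (Shape-deleteAt (suc (suc j)) j+2≤n sh) (ℕ.≤-trans (s≤s (s≤s i≤j)) j+2≤n)))
              (at> (suc j) (not pos) as (ℕ.m≤n⇒m≤1+n i≤j) (trans (cong (λ z → suc (suc z)) (sym (ℕ.+-suc j _))) eq)))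
            (ring₁ Δ (signed pos a) _ _)
      where
      j+2≤n : suc (suc j) ≤ n
      j+2≤n = ℕ.≤-trans (s≤s (ℕ.≤-trans (s≤s (ℕ.m≤m+n j (length as))) (ℕ.≤-reflexive (sym (ℕ.+-suc j _)))))
                        (ℕ.≤-reflexive (ℕ.suc-injective eq))

    minor : ∀ (f : List ℤ → List ℤ) γ′ δ′ → (∀ r → suc i < length r → f (colop i r) ≡ merge i γ′ δ′ r) →
      detN n (map f M) ≡ γ′ ℤ.* detN n (map (deleteAt (suc i)) rows) ℤ.+ δ′ ℤ.* detN n (map (deleteAt i) rows)
    minor f γ′ δ′ f∘colop =
      trans (cong (detN n) (trans (sym (List.map-∘ rows)) (List.map-cong-local
              (All.map (λ len → f∘colop _ (ℕ.≤-trans (s≤s i<n) (ℕ.≤-reflexive (sym len)))) all))))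
            (detN-merge n i γ′ δ′ rows sh i<n)

    at≤ : ∀ j p pos as → j + p ≡ i → length as + j ≡ suc n →
      laplace n M j pos (colop p as) ≡ Δ ℤ.* laplace n rows j pos as
    at≤ j p pos [] refl eq =
      ⊥-elim (ℕ.<-irrefl eq (s≤s (ℕ.≤-trans (ℕ.m≤m+n j p) (ℕ.<⇒≤ i<n))))
    at≤ j zero pos (x ∷ []) refl eq =
      ⊥-elim (ℕ.<-irrefl (ℕ.suc-injective eq) (ℕ.≤-trans (s≤s (ℕ.m≤m+n j 0)) i<n))
    at≤ j zero pos (x ∷ y ∷ as) i≡ eq rewrite trans (sym (ℕ.+-identityʳ j)) i≡ =
      trans (cong₂ (λ u v → signed pos (α ℤ.* x ℤ.+ β ℤ.* y) ℤ.* u ℤ.+ v)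
              (minor (deleteAt i) γ δ (deleteAt-colop i))
              (cong₂ (λ u v → signed (not pos) (γ ℤ.* x ℤ.+ δ ℤ.* y) ℤ.* u ℤ.+ v)
                (minor (deleteAt (suc i)) α β (deleteAt-suc-colop i))
                (at> i (not (not pos)) as ℕ.≤-refl (trans (cong (λ z → suc (suc z)) (ℕ.+-comm i _)) eq))))
            (ring pos x y _ _ _)
    at≤ j (suc p) pos (x ∷ as) refl eq =
      trans (cong₂ (λ u v → signed pos x ℤ.* u ℤ.+ v)
              (trans (cong (detN n) (map-map-cong (λ r → trans (cong (λ z → deleteAt j (colop z r)) (ℕ.+-suc j p))
                                                             (deleteAt-colop-< r (ℕ.m≤m+n j p))) rows))
                     (detN-colop n (j + p) _ (Shape-deleteAt j (ℕ.≤-trans (ℕ.m≤m+n j (suc p)) (ℕ.<⇒≤ i<n)) sh)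
                       (ℕ.≤-trans (ℕ.≤-reflexive (cong suc (sym (ℕ.+-suc j p)))) i<n)))
              (at≤ (suc j) p (not pos) as (sym (ℕ.+-suc j p)) (trans (ℕ.+-suc _ j) eq)))
            (ring₁ Δ (signed pos x) _ _)

-- Integral solutions of linear systems

lin : List ℤ → List ℤ → ℤ
lin (a ∷ as) (x ∷ xs) = a ℤ.* x ℤ.+ lin as xs
lin _        _        = + 0

at : ℕ → List ℤ → ℤ
at c       []      = + 0
at zero    (x ∷ r) = x
at (suc c) (x ∷ r) = at c r

-- Left solutions modulo m. Columns beyond the width impose nothing, since `at` is 0 there.
Sol : ℤ → List ℤ → List (List ℤ) → Set
Sol m as M = ∀ c → m ∣ℤ lin as (map (at c) M)

lin-linear : ∀ {A : Set} (f g h : A → ℤ) γ δ as xs → All (λ x → h x ≡ γ ℤ.* f x ℤ.+ δ ℤ.* g x) xs →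
  lin as (map h xs) ≡ γ ℤ.* lin as (map f xs) ℤ.+ δ ℤ.* lin as (map g xs)
lin-linear f g h γ δ []       xs       _ = sym (cong₂ ℤ._+_ (ℤ.*-zeroʳ γ) (ℤ.*-zeroʳ δ))
lin-linear f g h γ δ (a ∷ as) []       _ = sym (cong₂ ℤ._+_ (ℤ.*-zeroʳ γ) (ℤ.*-zeroʳ δ))
lin-linear f g h γ δ (a ∷ as) (x ∷ xs) (eq ∷ eqs) =
  trans (cong₂ (λ u v → a ℤ.* u ℤ.+ v) eq (lin-linear f g h γ δ as xs eqs)) (ring a γ δ _ _ _ _)
  where
  ring : ∀ a γ δ x y u v → a ℤ.* (γ ℤ.* x ℤ.+ δ ℤ.* y) ℤ.+ (γ ℤ.* u ℤ.+ δ ℤ.* v) ≡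
    γ ℤ.* (a ℤ.* x ℤ.+ u) ℤ.+ δ ℤ.* (a ℤ.* y ℤ.+ v)
  ring = solve-∀

record UnimodularOp : Set where
  constructor op
  field
    index      : ℕ
    α β γ δ    : ℤ
    -- Squared because each Euclidean step swaps two columns and so reverses the sign of the
    -- determinant.
    unimodular : (α ℤ.* δ ℤ.- β ℤ.* γ) ℤ.* (α ℤ.* δ ℤ.- β ℤ.* γ) ≡ + 1

  Δ : ℤ
  Δ = α ℤ.* δ ℤ.- β ℤ.* γ

  run : List ℤ → List ℤ
  run = colop α β γ δ index

open UnimodularOp using (index; run)

shift : UnimodularOp → UnimodularOp
shift (op i α β γ δ u) = op (suc i) α β γ δ u

runs : List UnimodularOp → List ℤ → List ℤ
runs []       r = r
runs (o ∷ os) r = runs os (run o r)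

runs-shift : ∀ os x r → runs (map shift os) (x ∷ r) ≡ x ∷ runs os r
runs-shift []       x r = refl
runs-shift (o ∷ os) x r = runs-shift os x (run o r)

runs-++ : ∀ os os′ r → runs (os ++ os′) r ≡ runs os′ (runs os r)
runs-++ []       os′ r = refl
runs-++ (o ∷ os) os′ r = runs-++ os os′ (run o r)

length-runs : ∀ os r → length (runs os r) ≡ length r
length-runs []                   r = refl
length-runs (op i α β γ δ _ ∷ os) r = trans (length-runs os _) (length-colop α β γ δ i r)

module _ (α β γ δ : ℤ) where

  at-colop : ∀ i r → suc i < length r → at i (colop α β γ δ i r) ≡ α ℤ.* at i r ℤ.+ β ℤ.* at (suc i) r
  at-colop zero    (x ∷ [])    (s≤s ())
  at-colop zero    (x ∷ y ∷ r) p       = refl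
  at-colop (suc i) (x ∷ r)     (s≤s p) = at-colop i r p

  at-suc-colop : ∀ i r → suc i < length r → at (suc i) (colop α β γ δ i r) ≡ γ ℤ.* at i r ℤ.+ δ ℤ.* at (suc i) r
  at-suc-colop zero    (x ∷ [])    (s≤s ())
  at-suc-colop zero    (x ∷ y ∷ r) p       = refl
  at-suc-colop (suc i) (x ∷ r)     (s≤s p) = at-suc-colop i r p

  at-colop-≢ : ∀ c i r → c ≢ i → c ≢ suc i → at c (colop α β γ δ i r) ≡ at c r
  at-colop-≢ c             i       []          p q = refl
  at-colop-≢ c             zero    (x ∷ [])    p q = refl
  at-colop-≢ zero          zero    (x ∷ y ∷ r) p q = contradiction refl p
  at-colop-≢ (suc zero)    zero    (x ∷ y ∷ r) p q = contradiction refl q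
  at-colop-≢ (suc (suc c)) zero    (x ∷ y ∷ r) p q = refl
  at-colop-≢ zero          (suc i) (x ∷ r)     p q = refl
  at-colop-≢ (suc c)       (suc i) (x ∷ r)     p q = at-colop-≢ c i r (p ∘ cong suc) (q ∘ cong suc)

module _ (o : UnimodularOp) {k n : ℕ} (M : List (List ℤ)) (shape : Shape k n M) (i<n : suc (index o) < n)
         (m : ℤ) (as : List ℤ) where

  open UnimodularOp o hiding (index; run)

  private
    i = index o
    M′ = map (run o) M
    L : ℕ → ℤ
    L c = lin as (map (at c) M)
    L′ : ℕ → ℤ
    L′ c = lin as (map (at c) M′)

    map-at : ∀ c → map (at c) M′ ≡ map (at c ∘ run o) M
    map-at c = sym (List.map-∘ M)

    col : ∀ c γ′ δ′ → (∀ r → suc i < length r → at c (run o r) ≡ γ′ ℤ.* at i r ℤ.+ δ′ ℤ.* at (suc i) r) →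
      L′ c ≡ γ′ ℤ.* L i ℤ.+ δ′ ℤ.* L (suc i)
    col c γ′ δ′ eq = trans (cong (lin as) (map-at c))
      (lin-linear (at i) (at (suc i)) (at c ∘ run o) γ′ δ′ as M
        (All.map (λ {r} len → eq r (ℕ.≤-trans i<n (ℕ.≤-reflexive (sym len)))) (proj₂ shape)))

    L′-i : L′ i ≡ α ℤ.* L i ℤ.+ β ℤ.* L (suc i)
    L′-i = col i α β (at-colop α β γ δ i)
    L′-suc : L′ (suc i) ≡ γ ℤ.* L i ℤ.+ δ ℤ.* L (suc i)
    L′-suc = col (suc i) γ δ (at-suc-colop α β γ δ i)
    L′-≢ : ∀ c → c ≢ i → c ≢ suc i → L′ c ≡ L c
    L′-≢ c p q = cong (lin as) (trans (map-at c) (List.map-cong (λ r → at-colop-≢ α β γ δ c i r p q) M))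

    combine : ∀ {x y} γ δ → m ∣ℤ x → m ∣ℤ y → m ∣ℤ γ ℤ.* x ℤ.+ δ ℤ.* y
    combine γ δ p q = ℤ∣.∣m∣n⇒∣m+n (ℤ∣.∣n⇒∣m*n γ p) (ℤ∣.∣n⇒∣m*n δ q)

    -- Since `Δ` is its own inverse, `Δ` times the adjugate undoes the operation.
    solve-i : ∀ α β γ δ x y → (δ ℤ.* (α ℤ.* δ ℤ.- β ℤ.* γ)) ℤ.* (α ℤ.* x ℤ.+ β ℤ.* y) ℤ.+
      (ℤ.- (β ℤ.* (α ℤ.* δ ℤ.- β ℤ.* γ))) ℤ.* (γ ℤ.* x ℤ.+ δ ℤ.* y) ≡
      ((α ℤ.* δ ℤ.- β ℤ.* γ) ℤ.* (α ℤ.* δ ℤ.- β ℤ.* γ)) ℤ.* x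
    solve-i = solve-∀
    solve-suc : ∀ α β γ δ x y → (ℤ.- (γ ℤ.* (α ℤ.* δ ℤ.- β ℤ.* γ))) ℤ.* (α ℤ.* x ℤ.+ β ℤ.* y) ℤ.+
      (α ℤ.* (α ℤ.* δ ℤ.- β ℤ.* γ)) ℤ.* (γ ℤ.* x ℤ.+ δ ℤ.* y) ≡
      ((α ℤ.* δ ℤ.- β ℤ.* γ) ℤ.* (α ℤ.* δ ℤ.- β ℤ.* γ)) ℤ.* y
    solve-suc = solve-∀

    unit* : ∀ x → (Δ ℤ.* Δ) ℤ.* x ≡ x
    unit* x = trans (cong (ℤ._* x) unimodular) (ℤ.*-identityˡ x)

  Sol-run : Sol m as M → Sol m as M′
  Sol-run s c with c ℕ.≟ i | c ℕ.≟ suc i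
  ... | yes refl | _        = subst (m ∣ℤ_) (sym L′-i) (combine α β (s i) (s (suc i)))
  ... | no p     | yes refl = subst (m ∣ℤ_) (sym L′-suc) (combine γ δ (s i) (s (suc i)))
  ... | no p     | no q     = subst (m ∣ℤ_) (sym (L′-≢ c p q)) (s c)

  Sol-run⁻ : Sol m as M′ → Sol m as M
  Sol-run⁻ s c with c ℕ.≟ i | c ℕ.≟ suc i
  ... | yes refl | _        = subst (m ∣ℤ_) (trans (solve-i α β γ δ (L i) (L (suc i))) (unit* _))
    (combine (δ ℤ.* Δ) (ℤ.- (β ℤ.* Δ)) (subst (m ∣ℤ_) L′-i (s i)) (subst (m ∣ℤ_) L′-suc (s (suc i))))
  ... | no p     | yes refl = subst (m ∣ℤ_) (trans (solve-suc α β γ δ (L i) (L (suc i))) (unit* _))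
    (combine (ℤ.- (γ ℤ.* Δ)) (α ℤ.* Δ) (subst (m ∣ℤ_) L′-i (s i)) (subst (m ∣ℤ_) L′-suc (s (suc i))))
  ... | no p     | no q     = subst (m ∣ℤ_) (L′-≢ c p q) (s c)

InRange : ℕ → List UnimodularOp → Set
InRange n = All (λ o → suc (index o) < n)

private
  square-1 : ∀ a b c d → (a ℤ.* d ℤ.- b ℤ.* c) ℤ.* (a ℤ.* d ℤ.- b ℤ.* c) ≡ + 1 → ∀ q →
    (b ℤ.* (c ℤ.- q ℤ.* d) ℤ.- (a ℤ.- q ℤ.* b) ℤ.* d) ℤ.* (b ℤ.* (c ℤ.- q ℤ.* d) ℤ.- (a ℤ.- q ℤ.* b) ℤ.* d) ≡ + 1
  square-1 a b c d eq q = trans (ring a b c d q) eq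
    where
    ring : ∀ a b c d q →
      (b ℤ.* (c ℤ.- q ℤ.* d) ℤ.- (a ℤ.- q ℤ.* b) ℤ.* d) ℤ.* (b ℤ.* (c ℤ.- q ℤ.* d) ℤ.- (a ℤ.- q ℤ.* b) ℤ.* d) ≡
      (a ℤ.* d ℤ.- b ℤ.* c) ℤ.* (a ℤ.* d ℤ.- b ℤ.* c)
    ring = solve-∀

-- Precomposition with `(a , b) ↦ (b , a − q b)`, where q is the quotient: an operation whose second
-- output vanishes at `(b , a % b)` becomes one whose second output vanishes at `(a , b)`.
euclid-step : ∀ i a b .{{_ : ℤ.NonZero b}} →
  (∃ λ o → index o ≡ i × UnimodularOp.γ o ℤ.* b ℤ.+ UnimodularOp.δ o ℤ.* (+ (a ℤ.% b)) ≡ + 0) →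
  ∃ λ o → index o ≡ i × UnimodularOp.γ o ℤ.* a ℤ.+ UnimodularOp.δ o ℤ.* b ≡ + 0
euclid-step i a b (op .i α β γ δ u , refl , eq) =
  op i β (α ℤ.- q ℤ.* β) δ (γ ℤ.- q ℤ.* δ) (square-1 α β γ δ u q) , refl ,
  trans (cong (λ z → δ ℤ.* z ℤ.+ (γ ℤ.- q ℤ.* δ) ℤ.* b) (ℤ.a≡a%n+[a/n]*n a b)) (trans (ring γ δ q b _) eq)
  where
  q = a ℤ./ b
  ring : ∀ γ δ q b r → δ ℤ.* (r ℤ.+ q ℤ.* b) ℤ.+ (γ ℤ.- q ℤ.* δ) ℤ.* b ≡ γ ℤ.* b ℤ.+ δ ℤ.* r
  ring = solve-∀

euclid : ∀ k i a b → ∣ b ∣ < k → ∃ λ o → index o ≡ i × UnimodularOp.γ o ℤ.* a ℤ.+ UnimodularOp.δ o ℤ.* b ≡ + 0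
euclid (suc k) i a (+ 0)          _       = op i (+ 1) (+ 0) (+ 0) (+ 1) refl , refl , refl
euclid (suc k) i a b@(+ (suc _))  (s≤s p) =
  euclid-step i a b (euclid k i b (+ (a ℤ.% b)) (ℕ.<-≤-trans (ℤ.n%d<d a b) p))
euclid (suc k) i a b@(ℤ.-[1+ _ ]) (s≤s p) =
  euclid-step i a b (euclid k i b (+ (a ℤ.% b)) (ℕ.<-≤-trans (ℤ.n%d<d a b) p))

-- Works from the right: the tail is first collapsed to its leading entry g, and one Euclidean
-- operation at index 0 then combines g with the head.
clear-row : ∀ n r → length r ≡ suc n → ∃ λ os → InRange (suc n) os ×
  ∃₂ λ g zs → runs os r ≡ g ∷ zs × All (_≡ + 0) zs
clear-row zero    (x ∷ [])    eq = [] , [] , x , [] , refl , []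
clear-row (suc n) (x ∷ y ∷ r) eq with clear-row n (y ∷ r) (ℕ.suc-injective eq)
... | os , inr , g , zs , eq′ , zeros with euclid (suc ∣ g ∣) 0 x g ℕ.≤-refl
... | o@(op .0 α β γ δ u) , refl , kills =
  map shift os ++ o ∷ [] ,
  All.++⁺ (All.map⁺ (All.map s≤s inr)) (s≤s (s≤s z≤n) ∷ []) ,
  α ℤ.* x ℤ.+ β ℤ.* g , γ ℤ.* x ℤ.+ δ ℤ.* g ∷ zs ,
  trans (runs-++ (map shift os) (o ∷ []) (x ∷ y ∷ r))
        (cong (run o) (trans (runs-shift os x (y ∷ r)) (cong (x ∷_) eq′))) ,
  kills ∷ zeros

detN-runs : ∀ n M os → Shape n n M → InRange n os →
  ∃ λ ε → ε ℤ.* ε ≡ + 1 × detN n (map (runs os) M) ≡ ε ℤ.* detN n M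
detN-runs n M []       shape []        = + 1 , refl , trans (cong (detN n) (List.map-id M)) (sym (ℤ.*-identityˡ _))
detN-runs n M (o@(op i α β γ δ u) ∷ os) shape (p ∷ inr)
  with detN-runs n (map (run o) M) os (Shape-colop α β γ δ i shape) inr
... | ε , ε²≡1 , eq = ε ℤ.* UnimodularOp.Δ o ,
  trans (ring ε _) (cong₂ ℤ._*_ ε²≡1 u) ,
  trans (cong (detN n) (List.map-∘ M))
        (trans eq (trans (cong (ε ℤ.*_) (detN-colop α β γ δ n i M shape p)) (sym (ℤ.*-assoc ε _ _))))
  where
  ring : ∀ x y → (x ℤ.* y) ℤ.* (x ℤ.* y) ≡ (x ℤ.* x) ℤ.* (y ℤ.* y)
  ring = solve-∀

Sol-runs : ∀ {k n} M os → Shape k n M → InRange n os → ∀ m as → Sol m as M → Sol m as (map (runs os) M)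
Sol-runs M []       shape []        m as s = subst (Sol m as) (sym (List.map-id M)) s
Sol-runs M (o@(op i α β γ δ _) ∷ os) shape (p ∷ inr) m as s = subst (Sol m as) (sym (List.map-∘ M))
  (Sol-runs (map (run o) M) os (Shape-colop α β γ δ i shape) inr m as (Sol-run o M shape p m as s))

Sol-runs⁻ : ∀ {k n} M os → Shape k n M → InRange n os → ∀ m as → Sol m as (map (runs os) M) → Sol m as M
Sol-runs⁻ M []       shape []        m as s = subst (Sol m as) (List.map-id M) s
Sol-runs⁻ M (o@(op i α β γ δ _) ∷ os) shape (p ∷ inr) m as s = Sol-run⁻ o M shape p m as
  (Sol-runs⁻ (map (run o) M) os (Shape-colop α β γ δ i shape) inr m as (subst (Sol m as) (List.map-∘ M) s))

at-tail : ∀ c r → at (suc c) r ≡ at c (deleteAt 0 r)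
at-tail c []      = refl
at-tail c (x ∷ r) = refl

at-zeros : ∀ c {zs} → All (_≡ + 0) zs → at c zs ≡ + 0
at-zeros c       []          = refl
at-zeros zero    (eq ∷ _)    = eq
at-zeros (suc c) (_ ∷ zeros) = at-zeros c zeros

laplace-zeros : ∀ n rows j pos {zs} → All (_≡ + 0) zs → laplace n rows j pos zs ≡ + 0
laplace-zeros n rows j pos     []             = refl
laplace-zeros n rows j true  (refl ∷ zeros) = trans (ℤ.+-identityˡ _) (laplace-zeros n rows (suc j) false zeros)
laplace-zeros n rows j false (refl ∷ zeros) = trans (ℤ.+-identityˡ _) (laplace-zeros n rows (suc j) true zeros)

lin-tail : ∀ as rows c → lin as (map (at c) (map (deleteAt 0) rows)) ≡ lin as (map (at (suc c)) rows)
lin-tail as rows c = cong (lin as) (trans (sym (List.map-∘ rows)) (List.map-cong (λ r → sym (at-tail c r)) rows))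

-- Unimodular column operations bring M to a matrix with first row (g,0,…,0).
record Reduction (n : ℕ) (M : List (List ℤ)) : Set where
  field
    g  : ℤ
    zs : List ℤ
    zeros : All (_≡ + 0) zs
    rows  : List (List ℤ)
    rows-shape : Shape n (suc n) rows
    ε  : ℤ
    ε²≡1 : ε ℤ.* ε ≡ + 1
    Sol⇒ : ∀ m as → Sol m as M → Sol m as ((g ∷ zs) ∷ rows)
    Sol⇐ : ∀ m as → Sol m as ((g ∷ zs) ∷ rows) → Sol m as M

  minor : List (List ℤ)
  minor = map (deleteAt 0) rows

  field
    det-eq : detN (suc n) M ≡ ε ℤ.* (g ℤ.* detN n minor)

  minor-shape : Shape n n minor
  minor-shape = Shape-deleteAt 0 z≤n rows-shape

  minor≡0 : g ≢ + 0 → detN (suc n) M ≡ + 0 → detN n minor ≡ + 0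
  minor≡0 g≢0 d≡0 with ℤ.i*j≡0⇒i≡0∨j≡0 ε (trans (sym det-eq) d≡0)
  ... | inj₁ ε≡0 = contradiction (trans (sym ε²≡1) (cong₂ ℤ._*_ ε≡0 ε≡0)) (λ ())
  ... | inj₂ p with ℤ.i*j≡0⇒i≡0∨j≡0 g p
  ... | inj₁ g≡0 = contradiction g≡0 g≢0
  ... | inj₂ q   = q

  column₀ : ∀ m a as → Sol m (a ∷ as) M → m ∣ℤ a ℤ.* g ℤ.+ lin as (map (at 0) rows)
  column₀ m a as s = Sol⇒ m (a ∷ as) s 0

  -- The first reduced row vanishes outside column 0, so `a` is visible only there. Solutions for M
  -- are thus solutions for the minor together with one congruence for `a`.
  Sol-minor : ∀ m a as → Sol m (a ∷ as) M → Sol m as minor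
  Sol-minor m a as s c = subst (m ∣ℤ_)
    (trans (trans (cong (λ z → a ℤ.* z ℤ.+ lin as (map (at (suc c)) rows)) (at-zeros c zeros))
             (trans (cong (ℤ._+ _) (ℤ.*-zeroʳ a)) (ℤ.+-identityˡ _)))
           (sym (lin-tail as rows c)))
    (Sol⇒ m (a ∷ as) s (suc c))

  Sol-extend : ∀ m a as → m ∣ℤ a ℤ.* g ℤ.+ lin as (map (at 0) rows) → Sol m as minor → Sol m (a ∷ as) M
  Sol-extend m a as s₀ s = Sol⇐ m (a ∷ as) go
    where
    go : Sol m (a ∷ as) ((g ∷ zs) ∷ rows)
    go zero    = s₀
    go (suc c) = subst (m ∣ℤ_)
      (sym (trans (trans (cong (λ z → a ℤ.* z ℤ.+ lin as (map (at (suc c)) rows)) (at-zeros c zeros))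
             (trans (cong (ℤ._+ _) (ℤ.*-zeroʳ a)) (ℤ.+-identityˡ _)))
           (sym (lin-tail as rows c))))
      (s c)

reduction : ∀ n M → Shape (suc n) (suc n) M → Reduction n M
reduction n (r ∷ rows) shape@(l , len ∷ all) with clear-row n r len
... | os , inr , g , zs , eq , zeros with detN-runs (suc n) (r ∷ rows) os shape inr
... | ε , ε²≡1 , det-eq = record
  { g = g ; zs = zs ; zeros = zeros
  ; rows = map (runs os) rows
  ; rows-shape = trans (List.length-map (runs os) rows) (ℕ.suc-injective l) ,
            All.map⁺ (All.map (λ {x} → trans (length-runs os x)) all)
  ; ε = ε ; ε²≡1 = ε²≡1
  ; Sol⇒ = λ m as s → subst (λ z → Sol m as (z ∷ map (runs os) rows)) eq (Sol-runs (r ∷ rows) os shape inr m as s)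
  ; Sol⇐ = λ m as s → Sol-runs⁻ (r ∷ rows) os shape inr m as
             (subst (λ z → Sol m as (z ∷ map (runs os) rows)) (sym eq) s)
  ; det-eq = begin
      detN (suc n) (r ∷ rows)                            ≡⟨ ℤ.*-identityˡ _ ⟨
      + 1 ℤ.* detN (suc n) (r ∷ rows)                    ≡⟨ cong (ℤ._* _) ε²≡1 ⟨
      ε ℤ.* ε ℤ.* detN (suc n) (r ∷ rows)                ≡⟨ ℤ.*-assoc ε ε _ ⟩
      ε ℤ.* (ε ℤ.* detN (suc n) (r ∷ rows))              ≡⟨ cong (ε ℤ.*_) det-eq ⟨
      ε ℤ.* detN (suc n) (runs os r ∷ map (runs os) rows) ≡⟨ cong (λ z → ε ℤ.* detN (suc n) (z ∷ map (runs os) rows)) eq ⟩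
      ε ℤ.* detN (suc n) ((g ∷ zs) ∷ map (runs os) rows) ≡⟨ cong (ε ℤ.*_) (detN-laplace n (g ∷ zs) (map (runs os) rows)) ⟩
      ε ℤ.* (g ℤ.* D ℤ.+ laplace n (map (runs os) rows) 1 false zs)
        ≡⟨ cong (λ z → ε ℤ.* (g ℤ.* D ℤ.+ z)) (laplace-zeros n (map (runs os) rows) 1 false zeros) ⟩
      ε ℤ.* (g ℤ.* D ℤ.+ + 0)                            ≡⟨ cong (ε ℤ.*_) (ℤ.+-identityʳ _) ⟩
      ε ℤ.* (g ℤ.* D)                                    ∎
  }
  where
  open ≡-Reasoning
  D : ℤ
  D = detN n (map (deleteAt 0) (map (runs os) rows))

lin-∣ : ∀ {k as} xs → All (k ∣ℤ_) as → k ∣ℤ lin as xs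
lin-∣ xs       []        = divides (+ 0) refl
lin-∣ []       (_ ∷ _)   = divides (+ 0) refl
lin-∣ (x ∷ xs) (p ∷ ps) = ℤ∣.∣m∣n⇒∣m+n (ℤ∣.∣m⇒∣m*n x p) (lin-∣ xs ps)

*≢0 : ∀ {x y} → x ℤ.* y ≢ + 0 → x ≢ + 0 × y ≢ + 0
*≢0 {x} {y} p = (λ { refl → p refl }) , λ { refl → p (ℤ.*-zeroʳ x) }

-- An integral form of Cramer's rule.
Sol-∣ : ∀ n M → Shape n n M → detN n M ≢ + 0 → ∀ m u → m ≡ detN n M ℤ.* u →
  ∀ as → length as ≡ n → Sol m as M → All (u ∣ℤ_) as
Sol-∣ zero    M shape d≢0 m u m≡ []       _  _ = []
Sol-∣ (suc n) M shape d≢0 m u m≡ (a ∷ as) l s =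
  unε (ℤ∣.*-cancelˡ-∣ g {ε ℤ.* u} {a} {{ℤ.≢-nonZero (proj₁ (*≢0 {g} (proj₂ (*≢0 {ε} (d≢0 ∘ trans det-eq)))))}}
    (subst (g ℤ.* (ε ℤ.* u) ∣ℤ_) (ℤ.*-comm a g)
      (ℤ∣.∣m+n∣n⇒∣m {m = a ℤ.* g} (ℤ∣.∣-trans (divides D m≡D) (column₀ m a as s))
        (lin-∣ (map (at 0) rows) tails)))) ∷
  All.map (λ p → unε (ℤ∣.∣-trans (divides g refl) p)) tails
  where
  open Reduction (reduction n M shape)
  D = detN n minor
  ring₁ : ∀ ε g D u → ε ℤ.* (g ℤ.* D) ℤ.* u ≡ D ℤ.* (g ℤ.* (ε ℤ.* u))
  ring₁ = solve-∀
  m≡D : m ≡ D ℤ.* (g ℤ.* (ε ℤ.* u))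
  m≡D = trans m≡ (trans (cong (ℤ._* u) det-eq) (ring₁ ε g D u))
  -- The minor has the smaller determinant D, so by induction the tail has the larger divisor
  -- `g ε u`. Column 0 then shows that `g ε u` divides `a g`, and g cancels.
  tails : All (g ℤ.* (ε ℤ.* u) ∣ℤ_) as
  tails = Sol-∣ n minor minor-shape (proj₂ (*≢0 {g} (proj₂ (*≢0 {ε} (d≢0 ∘ trans det-eq))))) m (g ℤ.* (ε ℤ.* u)) m≡D
            as (ℕ.suc-injective l) (Sol-minor m a as s)
  unε : ∀ {x} → ε ℤ.* u ∣ℤ x → u ∣ℤ x
  unε = ℤ∣.∣-trans (divides ε refl)

-- Sol (+ 0) is the left kernel, since + 0 divides only + 0.
det≡0⇒kernel : ∀ n M → Shape n n M → detN n M ≡ + 0 →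
  ∃ λ as → length as ≡ n × ¬ All (_≡ + 0) as × Sol (+ 0) as M
det≡0⇒kernel (suc n) M shape d≡0 with Reduction.g (reduction n M shape) ℤ.≟ + 0
-- The first reduced row is zero, so the first unit vector is in the kernel.
... | yes g≡0 = + 1 ∷ replicate n (+ 0) , cong suc (List.length-replicate n) , (λ { (() ∷ _) }) ,
  Sol-extend (+ 0) (+ 1) zs′
    (subst (+ 0 ∣ℤ_) (sym (cong₂ ℤ._+_ (trans (ℤ.*-identityˡ g) g≡0) (lin-0 n _))) ℤ∣.∣-refl)
    (λ c → subst (+ 0 ∣ℤ_) (sym (lin-0 n _)) ℤ∣.∣-refl)
  where
  open Reduction (reduction n M shape)
  zs′ : List ℤ
  zs′ = replicate n (+ 0)
  lin-0 : ∀ n xs → lin (replicate n (+ 0)) xs ≡ + 0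
  lin-0 zero    xs       = refl
  lin-0 (suc n) []       = refl
  lin-0 (suc n) (x ∷ xs) = trans (ℤ.+-identityˡ _) (lin-0 n xs)
... | no g≢0 with det≡0⇒kernel n (Reduction.minor (reduction n M shape)) (Reduction.minor-shape (reduction n M shape))
                   (Reduction.minor≡0 (reduction n M shape) g≢0 d≡0)
... | as , l , ≢0 , s =
  -- Scaling the kernel vector of the minor by g makes the equation of column 0 solvable in
  -- integers.
  ℤ.- lin as col ∷ map (g ℤ.*_) as , cong suc (trans (List.length-map (g ℤ.*_) as) l) ,
  (λ { (_ ∷ ps) → ≢0 (All.map unscale (All.map⁻ ps)) }) ,
  Sol-extend (+ 0) (ℤ.- lin as col) (map (g ℤ.*_) as)
    (subst (+ 0 ∣ℤ_) (sym (trans (cong (ℤ._+_ ((ℤ.- lin as col) ℤ.* g)) (lin-scale as col)) (ring (lin as col) g))) ℤ∣.∣-refl)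
    (λ c → subst (+ 0 ∣ℤ_) (sym (lin-scale as _)) (ℤ∣.∣n⇒∣m*n g (s c)))
  where
  open Reduction (reduction n M shape)
  col : List ℤ
  col = map (at 0) rows
  ring : ∀ l g → (ℤ.- l) ℤ.* g ℤ.+ g ℤ.* l ≡ + 0
  ring = solve-∀
  unscale : ∀ {a} → g ℤ.* a ≡ + 0 → a ≡ + 0
  unscale eq with ℤ.i*j≡0⇒i≡0∨j≡0 g eq
  ... | inj₁ q = contradiction q g≢0
  ... | inj₂ q = q
  lin-scale : ∀ as xs → lin (map (g ℤ.*_) as) xs ≡ g ℤ.* lin as xs
  lin-scale []       xs       = sym (ℤ.*-zeroʳ g)
  lin-scale (a ∷ as) []       = sym (ℤ.*-zeroʳ g)
  lin-scale (a ∷ as) (x ∷ xs) = trans (cong₂ ℤ._+_ (ℤ.*-assoc g a x) (lin-scale as xs)) (sym (ℤ.*-distribˡ-+ g _ _))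

Sol-∣∣ : ∀ n M → Shape n n M → detN n M ≢ + 0 → ∀ m u → m ≡ + ∣ detN n M ∣ ℤ.* u →
  ∀ as → length as ≡ n → Sol m as M → All (u ∣ℤ_) as
Sol-∣∣ n M shape d≢0 m u m≡ as l s with ℤ∣.m∣∣m∣ {detN n M}
... | divides q eq = All.map (ℤ∣.∣-trans (divides q refl))
  (Sol-∣ n M shape d≢0 m (q ℤ.* u) (trans m≡ (trans (cong (ℤ._* u) eq) (ring q (detN n M) u))) as l s)
  where
  ring : ∀ q d u → q ℤ.* d ℤ.* u ≡ d ℤ.* (q ℤ.* u)
  ring = solve-∀

-- Counting solutions modulo a multiple of the determinant

record Enumerates {A : Set} (P : A → Set) (n : ℕ) : Set where
  field
    elements : List A
    unique   : Unique elements
    size≡    : length elements ≡ n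
    sound    : ∀ {x} → x ∈ elements → P x
    complete : ∀ {x} → P x → x ∈ elements

open Enumerates

-- Fibres of equal size over a base. This is how one reduction step multiplies the number of
-- solutions by `∣ g ∣`.
enumerate-pairs : ∀ {A B C : Set} {P : A → Set} {R : A → B → Set} {n h} (_▹_ : B → A → C) →
  (∀ {a b a′ b′} → (b ▹ a) ≡ (b′ ▹ a′) → a ≡ a′ × b ≡ b′) →
  Enumerates P n → (∀ a → P a → Enumerates (R a) h) →
  Enumerates (λ c → ∃₂ λ a b → c ≡ (b ▹ a) × P a × R a b) (n * h)
enumerate-pairs {A} {B} {C} {P} {R} {n} {h} _▹_ inj E ES = record
  { elements = proj₁ total
  ; unique   = proj₁ (proj₂ total)
  ; size≡    = trans (proj₁ (proj₂ (proj₂ total))) (cong (_* h) (size≡ E))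
  ; sound    = λ c∈ → let (a , b , eq , a∈ , r) = proj₁ (proj₂ (proj₂ (proj₂ total))) c∈ in a , b , eq , sound E a∈ , r
  ; complete = λ { (a , b , eq , p , r) → proj₂ (proj₂ (proj₂ (proj₂ total))) (a , b , eq , complete E p , r) }
  }
  where
  Good : List A → Set
  Good as = ∃ λ (L : List C) → Unique L × length L ≡ length as * h ×
    (∀ {c} → c ∈ L → ∃₂ λ a b → c ≡ (b ▹ a) × a ∈ as × R a b) ×
    (∀ {c} → (∃₂ λ a b → c ≡ (b ▹ a) × a ∈ as × R a b) → c ∈ L)

  go : ∀ as → Unique as → (∀ {a} → a ∈ as → P a) → Good as
  go []       _         _  = [] , [] , refl , (λ ()) , λ { (_ , _ , _ , () , _) }
  go (a ∷ as) (a∉ ∷ uas) ps with go as uas (ps ∘ there) | ES a (ps (here refl))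
  ... | L , uL , lL , sL , cL | S =
    map (_▹ a) (elements S) ++ L ,
    Unique.++⁺ (Unique.map⁺ (proj₂ ∘ inj) (unique S)) uL disjoint ,
    trans (List.length-++ (map (_▹ a) (elements S)))
          (cong₂ _+_ (trans (List.length-map (_▹ a) (elements S)) (size≡ S)) lL) ,
    sound′ , complete′
    where
    disjoint : ∀ {c} → c ∈ map (_▹ a) (elements S) × c ∈ L → ⊥
    disjoint (p , q) with ∈.∈-map⁻ (_▹ a) p | sL q
    ... | b , _ , eq | a′ , b′ , eq′ , a′∈ , _ with inj (trans (sym eq) eq′)
    ... | refl , _ = All.lookup a∉ a′∈ refl
    sound′ : ∀ {c} → c ∈ map (_▹ a) (elements S) ++ L → ∃₂ λ a′ b → c ≡ (b ▹ a′) × a′ ∈ a ∷ as × R a′ b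
    sound′ c∈ with ∈.∈-++⁻ (map (_▹ a) (elements S)) c∈
    ... | inj₁ p = let (b , b∈ , eq) = ∈.∈-map⁻ (_▹ a) p in a , b , eq , here refl , sound S b∈
    ... | inj₂ q = let (a′ , b , eq , a′∈ , r) = sL q in a′ , b , eq , there a′∈ , r
    complete′ : ∀ {c} → (∃₂ λ a′ b → c ≡ (b ▹ a′) × a′ ∈ a ∷ as × R a′ b) → c ∈ map (_▹ a) (elements S) ++ L
    complete′ (_ , b , refl , here refl , r) = ∈.∈-++⁺ˡ (∈.∈-map⁺ (_▹ a) (complete S r))
    complete′ (a′ , b , eq , there a′∈ , r) = ∈.∈-++⁺ʳ (map (_▹ a) (elements S)) (cL (a′ , b , eq , a′∈ , r))

  total : Good (elements E)
  total = go (elements E) (unique E) (sound E)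

∣-small : ∀ {w} {x : ℤ} → + w ∣ℤ x → ∣ x ∣ < w → x ≡ + 0
∣-small {w} {x} p lt with ∣ x ∣ in eq | ℤ∣.∣⇒∣ᵤ p
... | zero  | _ = ℤ.∣i∣≡0⇒i≡0 eq
... | suc k | d = contradiction (ℕ∣.∣⇒≤ d) (ℕ.<⇒≱ lt)

∣⊖∣< : ∀ {x y w} → x < w → y < w → ∣ + x ℤ.- + y ∣ < w
∣⊖∣< {x} {y} {w} x<w y<w with ℕ.≤-total x y
... | inj₁ x≤y = subst (λ z → z < w) (sym (trans (cong ∣_∣ (ℤ.m-n≡m⊖n x y)) (ℤ.∣⊖∣-≤ x≤y))) (ℕ.≤-<-trans (ℕ.m∸n≤m y x) y<w)
... | inj₂ y≤x = subst (λ z → z < w) (sym (trans (cong ∣_∣ (ℤ.m-n≡m⊖n x y)) (trans (ℤ.∣m⊖n∣≡∣n⊖m∣ x y) (ℤ.∣⊖∣-≤ y≤x))))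
                   (ℕ.≤-<-trans (ℕ.m∸n≤m x y) x<w)

-- The remainder r of -β modulo w and its translates `r + j w` with j < h.
residues : ∀ w .{{_ : NonZero w}} h β → Enumerates (λ a → a < h * w × + w ∣ℤ (+ a) ℤ.+ β) h
residues w h β = record
  { elements = map f (upTo h)
  ; unique   = Unique.map⁺ f-injective (Unique.upTo⁺ h)
  ; size≡    = trans (List.length-map f (upTo h)) (List.length-upTo h)
  ; sound    = sound′
  ; complete = complete′
  }
  where
  r = (ℤ.- β) ℤ.%ℕ w
  q = (ℤ.- β) ℤ./ℕ w
  f : ℕ → ℕ
  f j = r + j * w
  r<w : r < w
  r<w = ℤ.n%ℕd<d (ℤ.- β) w
  f-injective : ∀ {i j} → f i ≡ f j → i ≡ j
  f-injective {i} {j} eq = ℕ.*-cancelʳ-≡ i j w (ℕ.+-cancelˡ-≡ r _ _ eq)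
  β≡ : β ≡ ℤ.- (+ r ℤ.+ q ℤ.* + w)
  β≡ = trans (sym (ℤ.neg-involutive β)) (cong ℤ.-_ (ℤ.a≡a%ℕn+[a/ℕn]*n (ℤ.- β) w))
  ring₁ : ∀ r j w q → (r ℤ.+ j ℤ.* w) ℤ.+ ℤ.- (r ℤ.+ q ℤ.* w) ≡ (j ℤ.- q) ℤ.* w
  ring₁ = solve-∀
  ring₂ : ∀ a j w r q → a ℤ.- r ≡ ((a ℤ.+ j ℤ.* w) ℤ.+ ℤ.- (r ℤ.+ q ℤ.* w)) ℤ.+ (q ℤ.- j) ℤ.* w
  ring₂ = solve-∀

  sound′ : ∀ {a} → a ∈ map f (upTo h) → a < h * w × + w ∣ℤ (+ a) ℤ.+ β
  sound′ a∈ with ∈.∈-map⁻ f a∈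
  ... | j , j∈ , refl =
    ℕ.<-≤-trans (ℕ.+-monoˡ-< (j * w) r<w) (ℕ.*-monoˡ-≤ w (∈.∈-upTo⁻ j∈)) ,
    divides (+ j ℤ.- q) (trans (cong₂ ℤ._+_ (cong (ℤ._+_ (+ r)) (ℤ.pos-* j w)) β≡) (ring₁ (+ r) (+ j) (+ w) q))

  complete′ : ∀ {a} → a < h * w × + w ∣ℤ (+ a) ℤ.+ β → a ∈ map f (upTo h)
  complete′ {a} (a< , w∣) = subst (_∈ map f (upTo h)) (sym a≡) (∈.∈-map⁺ f (∈.∈-upTo⁺ (ℕ.m<n*o⇒m/o<n a<)))
    where
    a≡′ : a ≡ a ℕ.% w + (a ℕ./ w) * w
    a≡′ = ℕ.m≡m%n+[m/n]*n a w
    w∣′ : + w ∣ℤ + (a ℕ.% w) ℤ.- + r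
    w∣′ = subst (+ w ∣ℤ_) (sym (ring₂ (+ (a ℕ.% w)) (+ (a ℕ./ w)) (+ w) (+ r) q))
      (ℤ∣.∣m∣n⇒∣m+n
        (subst (+ w ∣ℤ_) (cong₂ ℤ._+_ (trans (cong +_ a≡′) (cong (ℤ._+_ (+ (a ℕ.% w))) (ℤ.pos-* (a ℕ./ w) w))) β≡) w∣)
        (divides (q ℤ.- + (a ℕ./ w)) refl))
    a≡ : a ≡ f (a ℕ./ w)
    a≡ = trans a≡′ (cong (_+ (a ℕ./ w) * w)
           (ℤ.+-injective (ℤ.i-j≡0⇒i≡j _ _ (∣-small w∣′ (∣⊖∣< (ℕ.m%n<n a w) r<w)))))

Reduced : ℕ → ℕ → List (List ℤ) → List ℕ → Set
Reduced n m M bs = length bs ≡ n × All (_< m) bs × Sol (+ m) (map +_ bs) M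

-- Both sides are the index of the row lattice of M in ℤⁿ.
enumerate-Sol : ∀ n M → Shape n n M → ∀ m u .{{_ : NonZero m}} → m ≡ ∣ detN n M ∣ * u → Enumerates (Reduced n m M) ∣ detN n M ∣
enumerate-Sol zero [] shape m u m≡ = record
  { elements = [] ∷ [] ; unique = [] ∷ [] ; size≡ = refl
  ; sound = λ { (here refl) → refl , [] , λ c → divides (+ 0) refl }
  ; complete = λ { {[]} _ → here refl } }
enumerate-Sol (suc n) M shape m u m≡ = subst (Enumerates _) (sym ∣det∣) (record
  { elements = elements E ; unique = unique E ; size≡ = size≡ E
  ; sound = to ∘ sound E ; complete = complete E ∘ from })
  where
  open Reduction (reduction n M shape)
  D h w : ℕ
  D = ∣ detN n minor ∣
  h = ∣ g ∣
  w = D * u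
  ∣ε∣≡1 : ∣ ε ∣ ≡ 1
  ∣ε∣≡1 = ℕ.m*n≡1⇒m≡1 ∣ ε ∣ ∣ ε ∣ (trans (sym (ℤ.abs-* ε ε)) (cong ∣_∣ ε²≡1))
  ∣det∣ : ∣ detN (suc n) M ∣ ≡ D * h
  ∣det∣ = trans (cong ∣_∣ det-eq) (trans (ℤ.abs-* ε _) (trans (cong₂ _*_ ∣ε∣≡1 (ℤ.abs-* g _)) (trans (ℕ.*-identityˡ _) (ℕ.*-comm h D))))
  m≡hw : m ≡ h * w
  m≡hw = trans m≡ (trans (cong (_* u) ∣det∣) (trans (cong (_* u) (ℕ.*-comm D h)) (ℕ.*-assoc h D u)))
  m≡D : m ≡ D * (h * u)
  m≡D = trans m≡ (trans (cong (_* u) ∣det∣) (ℕ.*-assoc D h u))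
  instance
    hw≢0 : NonZero (h * w)
    hw≢0 = ℕ.≢-nonZero (λ eq → ℕ.≢-nonZero⁻¹ m (trans m≡hw eq))
    h≢0 : NonZero h
    h≢0 = ℕ.m*n≢0⇒m≢0 h
    w≢0 : NonZero w
    w≢0 = ℕ.m*n≢0⇒n≢0 h
    D≢0 : NonZero D
    D≢0 = ℕ.m*n≢0⇒m≢0 D
    g≢0 : ℤ.NonZero g
    g≢0 = h≢0
  -- The modulus stays m while the determinant shrinks, so the cofactor u grows to `h u`; this is
  -- why u is a parameter.
  sub-enum : Enumerates (Reduced n m minor) D
  sub-enum = enumerate-Sol n minor minor-shape m (h * u) m≡D
  R : List ℕ → ℕ → Set
  R bs a = a < m × + m ∣ℤ + a ℤ.* g ℤ.+ lin (map +_ bs) (map (at 0) rows)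
  choices : ∀ bs → Reduced n m minor bs → Enumerates (R bs) h
  choices bs (l , _ , s) = record
    { elements = elements A ; unique = unique A ; size≡ = size≡ A
    ; sound = λ a∈ → let (a< , w∣) = sound A a∈ in ℕ.<-≤-trans a< (ℕ.≤-reflexive (sym m≡hw)) , up w∣
    ; complete = λ { (a< , m∣) → complete A (ℕ.<-≤-trans a< (ℕ.≤-reflexive m≡hw) , down m∣) } }
    where
    B : ℤ
    B = lin (map +_ bs) (map (at 0) rows)
    -- As `m = D (h u)`, Cramer's rule makes all entries of `bs` multiples of `h u`, hence of g.
    -- Dividing the congruence for `a` by g leaves one modulo `w`, which has h solutions below
    -- `m = h w`.
    g∣B : g ∣ℤ B
    g∣B = lin-∣ (map (at 0) rows) (All.map (ℤ∣.∣-trans (ℤ∣.∣-trans ℤ∣.m∣∣m∣ (divides (+ u) (trans (ℤ.pos-* h u) (ℤ.*-comm (+ h) (+ u))))))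
      (Sol-∣∣ n minor minor-shape (λ eq → ℕ.≢-nonZero⁻¹ D (cong ∣_∣ eq)) (+ m) (+ (h * u))
        (trans (cong +_ m≡D) (ℤ.pos-* D (h * u))) (map +_ bs) (trans (List.length-map +_ bs) l) s))
    β : ℤ
    β = ℤ∣.quotient g∣B
    A : Enumerates (λ a → a < h * w × + w ∣ℤ (+ a) ℤ.+ β) h
    A = residues w h β
    aβ : ∀ a → a ℤ.* g ℤ.+ B ≡ (a ℤ.+ β) ℤ.* g
    aβ a = trans (cong (ℤ._+_ (a ℤ.* g)) (ℤ∣._∣_.equality g∣B)) (sym (ℤ.*-distribʳ-+ g a β))
    +m≡ : + m ≡ + w ℤ.* + h
    +m≡ = trans (cong +_ (trans m≡hw (ℕ.*-comm h w))) (ℤ.pos-* w h)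
    up : ∀ {a} → + w ∣ℤ (+ a) ℤ.+ β → + m ∣ℤ + a ℤ.* g ℤ.+ B
    up {a} p = subst₂ _∣ℤ_ (sym +m≡) (sym (aβ (+ a)))
      (ℤ∣.∣-trans (ℤ∣.*-monoʳ-∣ (+ w) (ℤ∣.∣m∣∣m {g})) (ℤ∣.*-monoˡ-∣ g p))
    down : ∀ {a} → + m ∣ℤ + a ℤ.* g ℤ.+ B → + w ∣ℤ (+ a) ℤ.+ β
    down {a} p = ℤ∣.*-cancelʳ-∣ g (ℤ∣.∣-trans (ℤ∣.*-monoʳ-∣ (+ w) (ℤ∣.m∣∣m∣ {g})) (subst₂ _∣ℤ_ +m≡ (aβ (+ a)) p))
  E : Enumerates (λ cs → ∃₂ λ bs a → cs ≡ a ∷ bs × Reduced n m minor bs × R bs a) (D * h)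
  E = enumerate-pairs _∷_ (λ { refl → refl , refl }) sub-enum choices
  to : ∀ {cs} → (∃₂ λ bs a → cs ≡ a ∷ bs × Reduced n m minor bs × R bs a) → Reduced (suc n) m M cs
  to (bs , a , refl , (l , all , s) , a< , s₀) = cong suc l , a< ∷ all , Sol-extend (+ m) (+ a) (map +_ bs) s₀ s
  from : ∀ {cs} → Reduced (suc n) m M cs → ∃₂ λ bs a → cs ≡ a ∷ bs × Reduced n m minor bs × R bs a
  from {a ∷ bs} (l , a< ∷ all , s) = bs , a , refl , (ℕ.suc-injective l , all , Sol-minor (+ m) (+ a) (map +_ bs) s) ,
    a< , column₀ (+ m) (+ a) (map +_ bs) s

-- Simplices in a simplotope

∑ : ∀ {A : Set} → List A → (A → ℤ) → ℤ
∑ []       h = + 0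
∑ (x ∷ xs) h = h x ℤ.+ ∑ xs h

∑-cong : ∀ {A : Set} (xs : List A) {h h′ : A → ℤ} → (∀ {a} → a ∈ xs → h a ≡ h′ a) → ∑ xs h ≡ ∑ xs h′
∑-cong []       eq = refl
∑-cong (x ∷ xs) eq = cong₂ ℤ._+_ (eq (here refl)) (∑-cong xs (eq ∘ there))

∑-0 : ∀ {A : Set} (xs : List A) → ∑ xs (λ _ → + 0) ≡ + 0
∑-0 []       = refl
∑-0 (x ∷ xs) = trans (ℤ.+-identityˡ _) (∑-0 xs)

sel : ∀ {A : Set} → (A → Bool) → List A → List A
sel p = filter (λ a → T? (p a))

𝟙 : Bool → ℤ
𝟙 b = if b then + 1 else + 0

∑-sel : ∀ {A : Set} (p : A → Bool) xs (d : A → ℤ) → ∑ (sel p xs) d ≡ ∑ xs (λ a → d a ℤ.* 𝟙 (p a))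
∑-sel p []       d = refl
∑-sel p (x ∷ xs) d with p x
... | true  = cong₂ ℤ._+_ (sym (ℤ.*-identityʳ (d x))) (∑-sel p xs d)
... | false = trans (∑-sel p xs d) (sym (trans (cong (ℤ._+ ∑ xs (λ a → d a ℤ.* 𝟙 (p a))) (ℤ.*-zeroʳ (d x))) (ℤ.+-identityˡ _)))

lin-map : ∀ {A : Set} (xs : List A) (d h : A → ℤ) → lin (map d xs) (map h xs) ≡ ∑ xs (λ a → d a ℤ.* h a)
lin-map []       d h = refl
lin-map (x ∷ xs) d h = cong (ℤ._+_ (d x ℤ.* h x)) (lin-map xs d h)

∑-𝟙-∉ : ∀ {n} (i : Fin n) es → i ∉ es → ∑ es (λ e → 𝟙 ⌊ i Fin.≟ e ⌋) ≡ + 0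
∑-𝟙-∉ i []       _  = refl
∑-𝟙-∉ i (e ∷ es) i∉ with i Fin.≟ e
... | yes refl = contradiction (here refl) i∉
... | no _     = trans (ℤ.+-identityˡ _) (∑-𝟙-∉ i es (i∉ ∘ there))

∑-𝟙-∈ : ∀ {n} (i : Fin n) es → Unique es → i ∈ es → ∑ es (λ e → 𝟙 ⌊ i Fin.≟ e ⌋) ≡ + 1
∑-𝟙-∈ i (e ∷ es) (e∉ ∷ u) i∈ with i Fin.≟ e
... | yes refl = cong (ℤ._+_ (+ 1)) (∑-𝟙-∉ i es (λ i∈es → All.lookup e∉ i∈es refl))
... | no i≢e   with i∈
... | here i≡e = contradiction i≡e i≢e
... | there p  = trans (ℤ.+-identityˡ _) (∑-𝟙-∈ i es u p)

hit : ∀ {ds} → Coord ds → Vertex ds → Bool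
hit {c ∷ cs} (inj₁ j) (i , w) = ⌊ i Fin.≟ j ⌋
hit {c ∷ cs} (inj₂ x) (i , w) = hit x w

∈-elems⁺ : ∀ {n} (S : Sub n) {j} → T (Vec.lookup S j) → j ∈ elems S
∈-elems⁺ S p = ∈.∈-filter⁺ (λ j → T? (Vec.lookup S j)) (∈.∈-allFin _) p

elems-unique : ∀ {n} (S : Sub n) → Unique (elems S)
elems-unique {n} S = Unique.filter⁺ (λ j → T? (Vec.lookup S j)) (Unique.allFin⁺ n)

inFace-∷ : ∀ {c cs} {S : Sub (suc c)} {G : Face cs} {v : Vertex (c ∷ cs)} → T (inFace {c ∷ cs} (S , G) v) →
  T (Vec.lookup S (proj₁ v)) × T (inFace G (proj₂ v))
inFace-∷ {S = S} {v = i , w} p with Vec.lookup S i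
... | true = tt , p

rdim : ∀ {ds} → Face ds → ℕ
rdim {[]}     G       = 0
rdim {c ∷ cs} (S , G) = length (tail' (elems S)) + rdim G

length-reduced : ∀ {ds} (G : Face ds) w → length (reduced G w) ≡ rdim G
length-reduced {[]}     tt      tt      = refl
length-reduced {c ∷ cs} (S , G) (i , w) =
  trans (List.length-++ (map (λ e → if ⌊ i Fin.≟ e ⌋ then + 1 else + 0) (tail' (elems S))))
        (cong₂ _+_ (List.length-map _ (tail' (elems S))) (length-reduced G w))

module _ {A : Set} (xs : List A) (d : A → ℤ) (m : ℤ) where

  -- Closed in h under integral linear combinations, so that standard and reduced coordinates can be
  -- exchanged without a transition matrix.
  Div : (A → ℤ) → Set
  Div h = m ∣ℤ ∑ xs (λ a → d a ℤ.* h a)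

  private

    Div-cong : ∀ {h h′} → (∀ {a} → a ∈ xs → h a ≡ h′ a) → Div h → Div h′
    Div-cong eq = subst (m ∣ℤ_) (∑-cong xs (λ {a} a∈ → cong (d a ℤ.*_) (eq a∈)))

    Div-0 : Div (λ _ → + 0)
    Div-0 = subst (m ∣ℤ_) (sym (trans (∑-cong xs (λ {a} _ → ℤ.*-zeroʳ (d a))) (∑-0 xs))) (divides (+ 0) refl)

    Div-+ : ∀ {h h′} → Div h → Div h′ → Div (λ a → h a ℤ.+ h′ a)
    Div-+ {h} {h′} p q = subst (m ∣ℤ_) (go xs) (ℤ∣.∣m∣n⇒∣m+n p q)
      where
      ring : ∀ d x y u v → (d ℤ.* x ℤ.+ u) ℤ.+ (d ℤ.* y ℤ.+ v) ≡ d ℤ.* (x ℤ.+ y) ℤ.+ (u ℤ.+ v)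
      ring = solve-∀
      go : ∀ ys → ∑ ys (λ a → d a ℤ.* h a) ℤ.+ ∑ ys (λ a → d a ℤ.* h′ a) ≡ ∑ ys (λ a → d a ℤ.* (h a ℤ.+ h′ a))
      go []       = refl
      go (y ∷ ys) = trans (ring (d y) (h y) (h′ y) _ _) (cong (ℤ._+_ (d y ℤ.* (h y ℤ.+ h′ y))) (go ys))

    Div-neg : ∀ {h} → Div h → Div (λ a → ℤ.- h a)
    Div-neg {h} p = subst (m ∣ℤ_) (go xs) (ℤ∣.∣m⇒∣-m p)
      where
      go : ∀ ys → ℤ.- ∑ ys (λ a → d a ℤ.* h a) ≡ ∑ ys (λ a → d a ℤ.* (ℤ.- h a))
      go []       = refl
      go (y ∷ ys) = trans (ℤ.neg-distrib-+ (d y ℤ.* h y) _) (cong₂ ℤ._+_ (ℤ.neg-distribʳ-* (d y) (h y)) (go ys))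

    Div-∑ : ∀ {E : Set} (es : List E) (h : E → A → ℤ) → (∀ {e} → e ∈ es → Div (h e)) → Div (λ a → ∑ es (λ e → h e a))
    Div-∑ []       h p = Div-0
    Div-∑ (e ∷ es) h p = Div-+ (p (here refl)) (Div-∑ es h (p ∘ there))

    split-block : ∀ {E : Set} (es : List E) (h : A → E → ℤ) (rest : A → List ℤ) →
      (∀ c → Div (λ a → at c (map (h a) es ++ rest a))) →
      (∀ {e} → e ∈ es → Div (λ a → h a e)) × (∀ c → Div (λ a → at c (rest a)))
    split-block []       h rest p = (λ ()) , p
    split-block (e ∷ es) h rest p with split-block es h rest (p ∘ suc)
    ... | q , r = (λ { (here refl) → p 0 ; (there e∈) → q e∈ }) , r

    join-block : ∀ {E : Set} (es : List E) (h : A → E → ℤ) (rest : A → List ℤ) →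
      (∀ {e} → e ∈ es → Div (λ a → h a e)) → (∀ c → Div (λ a → at c (rest a))) →
      ∀ c → Div (λ a → at c (map (h a) es ++ rest a))
    join-block []       h rest p q c       = q c
    join-block (e ∷ es) h rest p q zero    = p (here refl)
    join-block (e ∷ es) h rest p q (suc c) = join-block es h rest (p ∘ there) q c

  coord⇒reduced : ∀ {ds} (G : Face ds) (π : A → Vertex ds) → (∀ x → Div (λ a → 𝟙 (hit x (π a)))) →
    ∀ c → Div (λ a → at c (reduced G (π a)))
  coord⇒reduced {[]}     G       π p c = Div-cong (λ _ → refl) Div-0
  coord⇒reduced {_ ∷ cs} (S , G) π p = join-block (tail' (elems S)) (λ a e → 𝟙 ⌊ proj₁ (π a) Fin.≟ e ⌋)
    (λ a → reduced G (proj₂ (π a))) (λ {e} _ → p (inj₁ e)) (coord⇒reduced G (proj₂ ∘ π) (p ∘ inj₂))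

  -- The deleted coordinate is 1 minus the sum of the remaining ones in its factor.
  reduced⇒coord : ∀ {ds} (G : Face ds) (π : A → Vertex ds) → (∀ {a} → a ∈ xs → T (inFace G (π a))) →
    Div (λ _ → + 1) → (∀ c → Div (λ a → at c (reduced G (π a)))) → ∀ x → Div (λ a → 𝟙 (hit x (π a)))
  reduced⇒coord {_ ∷ cs} (S , G) π inG one p = λ
    { (inj₁ j) → first j
    ; (inj₂ x) → reduced⇒coord G (proj₂ ∘ π) (λ a∈ → proj₂ (inFace-∷ {S = S} {G} {π _} (inG a∈))) one (proj₂ blocks) x }
    where
    blocks = split-block (tail' (elems S)) (λ a e → 𝟙 ⌊ proj₁ (π a) Fin.≟ e ⌋) (λ a → reduced G (proj₂ (π a))) p
    in-elems : ∀ {a} → a ∈ xs → proj₁ (π a) ∈ elems S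
    in-elems a∈ = ∈-elems⁺ S (proj₁ (inFace-∷ {S = S} {G} {π _} (inG a∈)))
    go : ∀ es → Unique es → (∀ {a} → a ∈ xs → proj₁ (π a) ∈ es) →
      (∀ {e} → e ∈ tail' es → Div (λ a → 𝟙 ⌊ proj₁ (π a) Fin.≟ e ⌋)) →
      ∀ j → Div (λ a → 𝟙 ⌊ proj₁ (π a) Fin.≟ j ⌋)
    go []       u ∈es t j = Div-cong (λ a∈ → contradiction (∈es a∈) (λ ())) Div-0
    go (e ∷ es) u ∈es t j with j Fin.≟ e
    ... | yes refl = Div-cong
      (λ {a} a∈ → trans (cong (ℤ._- ∑ es (λ e → 𝟙 ⌊ proj₁ (π a) Fin.≟ e ⌋)) (sym (∑-𝟙-∈ (proj₁ (π a)) (e ∷ es) u (∈es a∈))))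
                    (ring (𝟙 ⌊ proj₁ (π a) Fin.≟ e ⌋) _))
      (Div-+ one (Div-neg (Div-∑ es (λ e a → 𝟙 ⌊ proj₁ (π a) Fin.≟ e ⌋) t)))
      where
      ring : ∀ x y → x ℤ.+ y ℤ.- y ≡ x
      ring = solve-∀
    ... | no j≢e with Any.any? (j Fin.≟_) es
    ... | yes j∈ = t j∈
    ... | no j∉  = Div-cong (λ {a} a∈ → sym (missed a∈)) Div-0
      where
      missed : ∀ {a} → a ∈ xs → 𝟙 ⌊ proj₁ (π a) Fin.≟ j ⌋ ≡ + 0
      missed {a} a∈ with proj₁ (π a) Fin.≟ j
      ... | no _ = refl
      ... | yes refl with ∈es a∈
      ... | here eq  = contradiction eq j≢e
      ... | there i∈ = contradiction i∈ j∉
    first : ∀ j → Div (λ a → 𝟙 ⌊ proj₁ (π a) Fin.≟ j ⌋)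
    first = go (elems S) (elems-unique S) in-elems (proj₁ blocks)

matrix : ∀ {ds} → Face ds → List (Vertex ds) → List (List ℤ)
matrix G = map (λ w → + 1 ∷ reduced G w)

matrix-shape : ∀ {ds} (G : Face ds) W {n} → length W ≡ n → n ≡ suc (rdim G) → Shape n n (matrix G W)
matrix-shape G W refl eq = List.length-map _ W , All.map⁺ (All.universal (λ w → trans (cong suc (length-reduced G w)) (sym eq)) W)

-- Stated in all standard coordinates, so that it does not depend on a face containing W.
Integral : ∀ {ds} → ℤ → (Vertex ds → ℤ) → List (Vertex ds) → Set
Integral m d W = m ∣ℤ ∑ W d × ∀ x → m ∣ℤ ∑ (sel (hit x) W) d

module _ {ds} (G : Face ds) (W : List (Vertex ds)) (d : Vertex ds → ℤ) (m : ℤ) where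

  private
    column : ∀ c → lin (map d W) (map (at c) (matrix G W)) ≡ ∑ W (λ w → d w ℤ.* at c (+ 1 ∷ reduced G w))
    column c = trans (cong (lin (map d W)) (sym (List.map-∘ W))) (lin-map W d _)

    ones : ∑ W (λ w → d w ℤ.* + 1) ≡ ∑ W d
    ones = ∑-cong W (λ {w} _ → ℤ.*-identityʳ (d w))

  Integral⇒Sol : Integral m d W → Sol m (map d W) (matrix G W)
  Integral⇒Sol (p , q) zero    = subst (m ∣ℤ_) (sym (trans (column 0) ones)) p
  Integral⇒Sol (p , q) (suc c) = subst (m ∣ℤ_) (sym (column (suc c)))
    (coord⇒reduced W d m G id (λ x → subst (m ∣ℤ_) (∑-sel (hit x) W d) (q x)) c)

  Sol⇒Integral : (∀ {w} → w ∈ W → T (inFace G w)) → Sol m (map d W) (matrix G W) → Integral m d W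
  Sol⇒Integral inG s = subst (m ∣ℤ_) (trans (column 0) ones) (s 0) , λ x → subst (m ∣ℤ_) (sym (∑-sel (hit x) W d))
    (reduced⇒coord W d m G id inG (subst (m ∣ℤ_) (column 0) (s 0)) (λ c → subst (m ∣ℤ_) (column (suc c)) (s (suc c))) x)

_≟ᵥ_ : ∀ {ds} (v w : Vertex ds) → Dec (v ≡ w)
_≟ᵥ_ {[]}     tt      tt      = yes refl
_≟ᵥ_ {c ∷ cs} (i , v) (j , w) with i Fin.≟ j | v ≟ᵥ w
... | yes refl | yes refl = yes refl
... | no p     | _        = no (p ∘ cong proj₁)
... | yes _    | no p     = no (p ∘ cong proj₂)

_∈ᵥ?_ : ∀ {ds} (v : Vertex ds) W → Dec (v ∈ W)
v ∈ᵥ? W = Any.any? (v ≟ᵥ_) W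

record Extraction {A : Set} (a : A) (xs : List A) : Set where
  field
    rest        : List A
    length-rest : length xs ≡ suc (length rest)
    rest-⊆      : ∀ {x} → x ∈ rest → x ∈ xs
    rest-⊇      : ∀ {x} → x ∈ xs → x ≢ a → x ∈ rest
    rest-unique : Unique xs → Unique rest × a ∉ rest
    ∑-rest      : ∀ h → ∑ xs h ≡ h a ℤ.+ ∑ rest h

extract : ∀ {A : Set} {a : A} {xs} → a ∈ xs → Extraction a xs
extract {xs = x ∷ xs} (here refl) = record
  { rest = xs ; length-rest = refl ; rest-⊆ = there
  ; rest-⊇ = λ { (here eq) ≢a → contradiction eq ≢a ; (there p) _ → p }
  ; rest-unique = λ { (x∉ ∷ u) → u , λ p → All.lookup x∉ p refl }
  ; ∑-rest = λ _ → refl }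
extract {a = a} {xs = x ∷ xs} (there a∈) = record
  { rest = x ∷ rest ; length-rest = cong suc length-rest
  ; rest-⊆ = λ { (here eq) → here eq ; (there p) → there (rest-⊆ p) }
  ; rest-⊇ = λ { (here eq) _ → here eq ; (there p) ≢a → there (rest-⊇ p ≢a) }
  ; rest-unique = λ { (x∉ ∷ u) → (All.tabulate (λ p → All.lookup x∉ (rest-⊆ p)) ∷ proj₁ (rest-unique u)) ,
      λ { (here refl) → All.lookup x∉ a∈ refl ; (there p) → proj₂ (rest-unique u) p } }
  ; ∑-rest = λ h → trans (cong (ℤ._+_ (h x)) (∑-rest h)) (ring (h x) (h a) _) }
  where
  open Extraction (extract a∈)
  ring : ∀ x y z → x ℤ.+ (y ℤ.+ z) ≡ y ℤ.+ (x ℤ.+ z)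
  ring = solve-∀

-- Pigeonhole principle for a relation instead of a function: the codes used later depend on
-- coefficients that are only known to exist.
length-≤ : ∀ {A B : Set} (R : A → B → Set) xs ys → Unique xs →
  (∀ {x} → x ∈ xs → ∃ λ y → y ∈ ys × R x y) → (∀ {x x′ y} → R x y → R x′ y → x ≡ x′) → length xs ≤ length ys
length-≤ R []       ys u       f inj = z≤n
length-≤ R (x ∷ xs) ys (x∉ ∷ u) f inj with f (here refl)
... | y , y∈ , r = ℕ.≤-trans (s≤s (length-≤ R xs rest u f′ inj)) (ℕ.≤-reflexive (sym length-rest))
  where
  open Extraction (extract y∈)
  f′ : ∀ {x′} → x′ ∈ xs → ∃ λ y′ → y′ ∈ rest × R x′ y′
  f′ x′∈ with f (there x′∈)
  ... | y′ , y′∈ , r′ = y′ , rest-⊇ y′∈ (λ { refl → All.lookup x∉ x′∈ (inj r r′) }) , r′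

∑-⊆ : ∀ {ds} (σ W : List (Vertex ds)) (h : Vertex ds → ℤ) → Unique σ → Unique W → (∀ {v} → v ∈ W → v ∈ σ) →
  (∀ {v} → v ∈ σ → v ∉ W → h v ≡ + 0) → ∑ σ h ≡ ∑ W h
∑-⊆ σ []      h uσ _ _ off = trans (∑-cong σ (λ v∈ → off v∈ (λ ()))) (∑-0 σ)
∑-⊆ σ (w ∷ W) h uσ (w∉ ∷ uW) W⊆ off = trans (∑-rest h) (cong (ℤ._+_ (h w))
  (∑-⊆ rest W h (proj₁ (rest-unique uσ)) uW
    (λ v∈ → rest-⊇ (W⊆ (there v∈)) (λ { refl → All.lookup w∉ v∈ refl }))
    (λ v∈ v∉ → off (rest-⊆ v∈) (λ { (here refl) → proj₂ (rest-unique uσ) v∈ ; (there p) → v∉ p }))))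
  where open Extraction (extract (W⊆ (here refl)))

-- A function on vertices, unlike a list of coefficients, survives reordering and restriction to a
-- sublist; the default `z` provides extension by zero.
assign : ∀ {ds} {B : Set} (z : B) (σ : List (Vertex ds)) bs → Unique σ → length bs ≡ length σ →
  ∃ λ (d : Vertex ds → B) → map d σ ≡ bs × (∀ {v} → v ∉ σ → d v ≡ z)
assign z []      []       u l = (λ _ → z) , refl , λ _ → refl
assign z (s ∷ σ) (b ∷ bs) (s∉ ∷ u) l with assign z σ bs u (ℕ.suc-injective l)
... | d , eq , off = d′ , cong₂ _∷_ d′-s (trans (List.map-cong-local (All.tabulate d′-σ)) eq) , d′-off
  where
  d′ : _ → _
  d′ v with v ≟ᵥ s
  ... | yes _ = b
  ... | no  _ = d v
  d′-s : d′ s ≡ b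
  d′-s with s ≟ᵥ s
  ... | yes _ = refl
  ... | no p  = contradiction refl p
  d′-σ : ∀ {v} → v ∈ σ → d′ v ≡ d v
  d′-σ {v} v∈ with v ≟ᵥ s
  ... | yes refl = contradiction refl (All.lookup s∉ v∈)
  ... | no _     = refl
  d′-off : ∀ {v} → v ∉ s ∷ σ → d′ v ≡ z
  d′-off {v} v∉ with v ≟ᵥ s
  ... | yes eq = contradiction (here eq) v∉
  ... | no _   = off (v∉ ∘ there)

map-≡⇒ : ∀ {A B : Set} {f g : A → B} {xs x} → map f xs ≡ map g xs → x ∈ xs → f x ≡ g x
map-≡⇒ eq (here refl) = List.∷-injectiveˡ eq
map-≡⇒ eq (there p)   = map-≡⇒ (List.∷-injectiveʳ eq) p

detOf : ∀ {ds} → Face ds → List (Vertex ds) → ℤ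
detOf G W = detN (length W) (matrix G W)

classIn-detOf : ∀ {ds} (G : Face ds) W → classIn G W ≡ ∣ detOf G W ∣
classIn-detOf G W = cong (λ n → ∣ detN n (matrix G W) ∣) (List.length-map _ W)

-- By `integral-off`, a solution for σ modulo any m is carried by W. For an exterior face this comes
-- from unitriangularity off the face; for a reordering of σ it is vacuous.
record _⊑_ {ds} (W σ : List (Vertex ds)) : Set where
  field
    unique-big   : Unique σ
    unique-small : Unique W
    subset       : ∀ {v} → v ∈ W → v ∈ σ
    integral-off : ∀ m d → Integral m d σ → ∀ {v} → v ∈ σ → v ∉ W → m ∣ℤ d v

module _ {ds} (G H : Face ds) (σ W : List (Vertex ds)) (W⊑σ : W ⊑ σ)
  (lσ : length σ ≡ suc (rdim G)) (lW : length W ≡ suc (rdim H))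
  (σ⊆G : ∀ {v} → v ∈ σ → T (inFace G v)) (W⊆H : ∀ {v} → v ∈ W → T (inFace H v))
  (nonzero : detOf G σ ≢ + 0)
  where

  open _⊑_ W⊑σ

  private
    OffZero : (Vertex ds → ℤ) → Set
    OffZero d = ∀ {v} → v ∈ σ → v ∉ W → d v ≡ + 0

    sums-agree : ∀ d → OffZero d → ∑ σ d ≡ ∑ W d × (∀ x → ∑ (sel (hit x) σ) d ≡ ∑ (sel (hit x) W) d)
    sums-agree d off = ∑-⊆ σ W d unique-big unique-small subset off ,
      λ x → trans (∑-sel (hit x) σ d) (trans
        (∑-⊆ σ W _ unique-big unique-small subset (λ {v} v∈ v∉ → cong (ℤ._* 𝟙 (hit x v)) (off v∈ v∉)))
        (sym (∑-sel (hit x) W d)))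

    shrink : ∀ m d → OffZero d → Integral m d σ → Integral m d W
    shrink m d off (p , q) = subst (m ∣ℤ_) (proj₁ (sums-agree d off)) p ,
      λ x → subst (m ∣ℤ_) (proj₂ (sums-agree d off) x) (q x)

    grow : ∀ m d → OffZero d → Integral m d W → Integral m d σ
    grow m d off (p , q) = subst (m ∣ℤ_) (sym (proj₁ (sums-agree d off))) p ,
      λ x → subst (m ∣ℤ_) (sym (proj₂ (sums-agree d off) x)) (q x)

    shape-σ : Shape (length σ) (length σ) (matrix G σ)
    shape-σ = matrix-shape G σ refl lσ
    shape-W : Shape (length W) (length W) (matrix H W)
    shape-W = matrix-shape H W refl lW

    -- A kernel vector for W, extended by zero, would be one for σ.
    detW≢0 : detOf H W ≢ + 0
    detW≢0 det≡0 with det≡0⇒kernel (length W) (matrix H W) shape-W det≡0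
    ... | as , l , ≢0 , s with assign (+ 0) W as unique-small l
    ... | d , refl , off = ≢0 (All.map⁺ (All.tabulate (λ v∈ → zero-on-σ (subset v∈))))
      where
      sol-σ : Sol (+ 0) (map d σ) (matrix G σ)
      sol-σ = Integral⇒Sol G σ d (+ 0) (grow (+ 0) d (λ _ → off) (Sol⇒Integral H W d (+ 0) W⊆H s))
      zero-on-σ : ∀ {v} → v ∈ σ → d v ≡ + 0
      zero-on-σ v∈ = ℤ∣.0∣⇒≡0 (All.lookup (Sol-∣ (length σ) (matrix G σ) shape-σ nonzero (+ 0) (+ 0)
        (sym (ℤ.*-zeroʳ (detOf G σ))) (map d σ) (List.length-map d σ) sol-σ) (∈.∈-map⁺ d v∈))

    D D′ m : ℕ
    D  = ∣ detOf G σ ∣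
    D′ = ∣ detOf H W ∣
    -- A common multiple, so that the solutions modulo m number exactly D for σ and D′ for W.
    m  = D * D′

    instance
      D≢0 : NonZero D
      D≢0 = ℕ.≢-nonZero (nonzero ∘ ℤ.∣i∣≡0⇒i≡0)
      D′≢0 : NonZero D′
      D′≢0 = ℕ.≢-nonZero (detW≢0 ∘ ℤ.∣i∣≡0⇒i≡0)
      m≢0 : NonZero m
      m≢0 = ℕ.m*n≢0 D D′

    Eσ : Enumerates (Reduced (length σ) m (matrix G σ)) D
    Eσ = enumerate-Sol (length σ) (matrix G σ) shape-σ m D′ refl
    EW : Enumerates (Reduced (length W) m (matrix H W)) D′
    EW = enumerate-Sol (length W) (matrix H W) shape-W m D (ℕ.*-comm D D′)

    R : List ℕ → List ℕ → Set
    R b b′ = ∃ λ (d : Vertex ds → ℕ) → b ≡ map d σ × b′ ≡ map d W × (∀ {v} → v ∈ σ → v ∉ W → d v ≡ 0)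

    R-injective : ∀ {b c b′} → R b b′ → R c b′ → b ≡ c
    R-injective (d , refl , refl , off) (e , refl , eq , off′) = List.map-cong-local (All.tabulate agree)
      where
      agree : ∀ {v} → v ∈ σ → d v ≡ e v
      agree {v} v∈ with v ∈ᵥ? W
      ... | yes v∈W = map-≡⇒ eq v∈W
      ... | no v∉W  = trans (off v∈ v∉W) (sym (off′ v∈ v∉W))

    R-injective′ : ∀ {b c b′} → R b′ b → R b′ c → b ≡ c
    R-injective′ (d , refl , refl , off) (e , eq , refl , off′) =
      List.map-cong-local (All.tabulate (λ v∈ → map-≡⇒ eq (subset v∈)))

    forward : ∀ {b} → b ∈ elements Eσ → ∃ λ b′ → b′ ∈ elements EW × R b b′
    forward {b} b∈ with sound Eσ b∈
    ... | l , small , s with assign 0 σ b unique-big l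
    ... | d , refl , _ = map d W , complete EW (List.length-map d W , All.map⁺ (All.tabulate (bound ∘ subset)) ,
        subst (λ z → Sol (+ m) z (matrix H W)) (List.map-∘ W)
          (Integral⇒Sol H W (+_ ∘ d) (+ m) (shrink (+ m) (+_ ∘ d) (λ v∈ v∉ → cong +_ (off v∈ v∉)) int))) ,
      d , refl , refl , off
      where
      bound : ∀ {v} → v ∈ σ → d v < m
      bound v∈ = All.lookup small (∈.∈-map⁺ d v∈)
      int : Integral (+ m) (+_ ∘ d) σ
      int = Sol⇒Integral G σ (+_ ∘ d) (+ m) σ⊆G (subst (λ z → Sol (+ m) z (matrix G σ)) (sym (List.map-∘ σ)) s)
      -- A multiple of m below m is 0, so reduced solutions vanish off W exactly and not just modulo
      -- m.
      off : ∀ {v} → v ∈ σ → v ∉ W → d v ≡ 0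
      off v∈ v∉ = ℤ.+-injective (∣-small (integral-off (+ m) (+_ ∘ d) int v∈ v∉) (bound v∈))

    backward : ∀ {b} → b ∈ elements EW → ∃ λ b′ → b′ ∈ elements Eσ × R b′ b
    backward {b} b∈ with sound EW b∈
    ... | l , small , s with assign 0 W b unique-small l
    ... | d , refl , off = map d σ , complete Eσ (List.length-map d σ , All.map⁺ (All.tabulate (λ _ → bound _)) ,
        subst (λ z → Sol (+ m) z (matrix G σ)) (List.map-∘ σ)
          (Integral⇒Sol G σ (+_ ∘ d) (+ m) (grow (+ m) (+_ ∘ d) (λ _ v∉ → cong +_ (off v∉))
            (Sol⇒Integral H W (+_ ∘ d) (+ m) W⊆H (subst (λ z → Sol (+ m) z (matrix H W)) (sym (List.map-∘ W)) s))))) ,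
      d , refl , refl , λ _ → off
      where
      bound : ∀ v → d v < m
      bound v with v ∈ᵥ? W
      ... | yes v∈ = All.lookup small (∈.∈-map⁺ d v∈)
      ... | no v∉  = subst (_< m) (sym (off v∉)) (ℕ.>-nonZero⁻¹ m)

  -- Restriction to W and extension by zero match the D reduced solutions for σ with the D′ reduced
  -- solutions for W.
  class-⊑ : ∣ detOf G σ ∣ ≡ ∣ detOf H W ∣
  class-⊑ = ℕ.≤-antisym
    (subst₂ _≤_ (size≡ Eσ) (size≡ EW) (length-≤ R _ _ (unique Eσ) forward R-injective))
    (subst₂ _≤_ (size≡ EW) (size≡ Eσ) (length-≤ (λ b b′ → R b′ b) _ _ (unique EW) backward R-injective′))

-- Vertices off a face

∑ₙ : ∀ {A : Set} → List A → (A → ℕ) → ℕ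
∑ₙ []       f = 0
∑ₙ (x ∷ xs) f = f x + ∑ₙ xs f

∑-pos : ∀ {A : Set} (xs : List A) (f : A → ℕ) → ∑ xs (λ v → + f v) ≡ + ∑ₙ xs f
∑-pos []       f = refl
∑-pos (x ∷ xs) f = cong (ℤ._+_ (+ f x)) (∑-pos xs f)

module _ {A : Set} where

  ∑-split : ∀ (p : A → Bool) xs h → ∑ xs h ≡ ∑ (sel p xs) h ℤ.+ ∑ (sel (not ∘ p) xs) h
  ∑-split p []       h = refl
  ∑-split p (x ∷ xs) h with p x
  ... | true  = trans (cong (ℤ._+_ (h x)) (∑-split p xs h)) (sym (ℤ.+-assoc (h x) _ _))
  ... | false = trans (cong (ℤ._+_ (h x)) (∑-split p xs h)) (ring (h x) (∑ (sel p xs) h) (∑ (sel (not ∘ p) xs) h))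
    where
    ring : ∀ x y z → x ℤ.+ (y ℤ.+ z) ≡ y ℤ.+ (x ℤ.+ z)
    ring = solve-∀

  ∑ₙ-split : ∀ (p : A → Bool) xs f → ∑ₙ xs f ≡ ∑ₙ (sel p xs) f + ∑ₙ (sel (not ∘ p) xs) f
  ∑ₙ-split p []       f = refl
  ∑ₙ-split p (x ∷ xs) f with p x
  ... | true  = trans (cong (ℕ._+_ (f x)) (∑ₙ-split p xs f)) (sym (ℕ.+-assoc (f x) _ _))
  ... | false = trans (cong (ℕ._+_ (f x)) (∑ₙ-split p xs f)) (ring (f x) (∑ₙ (sel p xs) f) (∑ₙ (sel (not ∘ p) xs) f))
    where
    ring : ∀ x y z → x + (y + z) ≡ y + (x + z)
    ring = ℕ-Ring.solve-∀

  length-split : ∀ (p : A → Bool) xs → length xs ≡ length (sel p xs) + length (sel (not ∘ p) xs)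
  length-split p []       = refl
  length-split p (x ∷ xs) with p x
  ... | true  = cong suc (length-split p xs)
  ... | false = trans (cong suc (length-split p xs)) (sym (ℕ.+-suc _ _))

  sel-sel : ∀ (p q : A → Bool) xs → sel q (sel p xs) ≡ sel (λ a → p a ∧ q a) xs
  sel-sel p q []       = refl
  sel-sel p q (x ∷ xs) with p x
  ... | false = sel-sel p q xs
  ... | true with q x
  ... | true  = cong (x ∷_) (sel-sel p q xs)
  ... | false = sel-sel p q xs

  sel-cong : ∀ {p q : A → Bool} → (∀ a → p a ≡ q a) → ∀ xs → sel p xs ≡ sel q xs
  sel-cong {p} {q} eq []       = refl
  sel-cong {p} {q} eq (x ∷ xs) with p x | q x | eq x
  ... | true  | _ | refl = cong (x ∷_) (sel-cong eq xs)
  ... | false | _ | refl = sel-cong eq xs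

  sel-comm : ∀ (p q : A → Bool) xs → sel q (sel p xs) ≡ sel p (sel q xs)
  sel-comm p q xs = trans (sel-sel p q xs) (trans (sel-cong (λ a → 𝔹.∧-comm (p a) (q a)) xs) (sym (sel-sel q p xs)))

  ∑ₙ-sel-≤ : ∀ (p : A → Bool) xs f → ∑ₙ (sel p xs) f ≤ ∑ₙ xs f
  ∑ₙ-sel-≤ p xs f = ℕ.≤-trans (ℕ.m≤m+n _ _) (ℕ.≤-reflexive (sym (∑ₙ-split p xs f)))

  ∈-sel⁺ : ∀ (p : A → Bool) {xs v} → v ∈ xs → T (p v) → v ∈ sel p xs
  ∈-sel⁺ p = ∈.∈-filter⁺ (λ a → T? (p a))

  ∈-sel⁻ : ∀ (p : A → Bool) {xs v} → v ∈ sel p xs → v ∈ xs × T (p v)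
  ∈-sel⁻ p {xs} = ∈.∈-filter⁻ (λ a → T? (p a)) {xs = xs}

  sel-unique : ∀ (p : A → Bool) {xs} → Unique xs → Unique (sel p xs)
  sel-unique p = Unique.filter⁺ (λ a → T? (p a))

-- A superincreasing sequence started at u.
Chain : ∀ {X : Set} → (X → ℕ) → ℕ → List X → Set
Chain c u []       = ⊤
Chain c u (x ∷ xs) = u < c x × Chain c (u + c x) xs

Chain-scale : ∀ {X : Set} D .{{_ : NonZero D}} (z : X → ℕ) u xs → Chain z u xs → Chain (λ x → D * z x) (D * u) xs
Chain-scale D z u []       _         = tt
Chain-scale D z u (x ∷ xs) (lt , ch) = ℕ.*-monoʳ-< D lt ,
  subst (λ k → Chain (λ x → D * z x) k xs) (ℕ.*-distribˡ-+ D u (z x)) (Chain-scale D z (u + z x) xs ch)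

module _ {X A : Set} (hits : X → A → Bool) where

  none : List X → A → Bool
  none []       v = true
  none (x ∷ xs) v = not (hits x v) ∧ none xs v

  -- Unitriangularity of the incidence between coordinates and the vertices that they meet, in the
  -- form needed for forward substitution.
  data Peel : List X → List A → Set where
    done : ∀ {σ} → Peel [] σ
    peel : ∀ {x xs σ v} → sel (hits x) σ ≡ v ∷ [] → Peel xs (sel (not ∘ hits x) σ) → Peel (x ∷ xs) σ

  -- Forward substitution: the first sum has a single term, and once this is a multiple of m it can
  -- be subtracted from the later sums.
  Peel-∣ : ∀ {xs σ} → Peel xs σ → ∀ m d → (∀ {x} → x ∈ xs → m ∣ℤ ∑ (sel (hits x) σ) d) →
    ∀ {v} → v ∈ σ → ¬ T (none xs v) → m ∣ℤ d v
  Peel-∣ done m d p v∈ hit = contradiction tt hit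
  Peel-∣ (peel {x} {xs} {σ} {w} eq pl) m d p {v} v∈ hit with hits x v in eqv
  ... | true  = subst (λ a → m ∣ℤ d a) (sym v≡w) m∣dw
    where
    m∣dw : m ∣ℤ d w
    m∣dw = subst (m ∣ℤ_) (trans (cong (λ l → ∑ l d) eq) (ℤ.+-identityʳ (d w))) (p (here refl))
    v≡w : v ≡ w
    v≡w with subst (v ∈_) eq (∈-sel⁺ (hits x) v∈ (subst T (sym eqv) tt))
    ... | here v≡ = v≡
  ... | false = Peel-∣ pl m d p′ (∈-sel⁺ (not ∘ hits x) v∈ (subst (T ∘ not) (sym eqv) tt)) hit
    where
    m∣dw : m ∣ℤ d w
    m∣dw = subst (m ∣ℤ_) (trans (cong (λ l → ∑ l d) eq) (ℤ.+-identityʳ (d w))) (p (here refl))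
    m∣sel : ∀ x′ → m ∣ℤ ∑ (sel (hits x′) (w ∷ [])) d
    m∣sel x′ with hits x′ w
    ... | true  = ℤ∣.∣m∣n⇒∣m+n m∣dw (divides (+ 0) refl)
    ... | false = divides (+ 0) refl
    p′ : ∀ {x′} → x′ ∈ xs → m ∣ℤ ∑ (sel (hits x′) (sel (not ∘ hits x) σ)) d
    p′ {x′} x′∈ = ℤ∣.∣m+n∣m⇒∣n
      (subst (m ∣ℤ_) (trans (∑-split (hits x) (sel (hits x′) σ) d)
        (cong₂ (λ a b → ∑ a d ℤ.+ ∑ b d) (trans (sel-comm (hits x′) (hits x) σ) (cong (sel (hits x′)) eq))
          (sel-comm (hits x′) (not ∘ hits x) σ))) (p (there x′∈)))
      (m∣sel x′)

  -- The slack u bounds what earlier removals took from the sum of any later coordinate; removing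
  -- the vertices at x adds at most `c x` to it. By the chain condition the slack stays below the
  -- required sum, so every coordinate still meets a remaining vertex and uses up at least one. If
  -- some coordinate uses up two, the inequality is strict; if all use up one, there is a `Peel`.
  Peel-count : ∀ xs σ (f : A → ℕ) c u → Chain c u xs →
    (∀ {x} → x ∈ xs → c x ≤ ∑ₙ (sel (hits x) σ) f + u) →
    (∀ {x} → x ∈ xs → ∑ₙ (sel (hits x) σ) f ≤ c x) →
    (length xs + length (sel (none xs) σ) < length σ) ⊎
    (Peel xs σ × length xs + length (sel (none xs) σ) ≡ length σ)
  Peel-count []       σ f c u ch lo hi = inj₂ (done , cong length (sel-all σ))
    where
    sel-all : ∀ σ → sel (none []) σ ≡ σ
    sel-all []      = refl
    sel-all (v ∷ σ) = cong (v ∷_) (sel-all σ)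
  Peel-count (x ∷ xs) σ f c u (u< , ch) lo hi = go (sel (hits x) σ) refl
    where
    σ′ = sel (not ∘ hits x) σ
    rest≡ : sel (none xs) σ′ ≡ sel (none (x ∷ xs)) σ
    rest≡ = sel-sel (not ∘ hits x) (none xs) σ
    split : ∀ x′ → ∑ₙ (sel (hits x′) σ) f ≡ ∑ₙ (sel (hits x′) (sel (hits x) σ)) f + ∑ₙ (sel (hits x′) σ′) f
    split x′ = trans (∑ₙ-split (hits x) (sel (hits x′) σ) f)
      (cong₂ (λ a b → ∑ₙ a f + ∑ₙ b f) (sel-comm (hits x′) (hits x) σ) (sel-comm (hits x′) (not ∘ hits x) σ))
    lo′ : ∀ {x′} → x′ ∈ xs → c x′ ≤ ∑ₙ (sel (hits x′) σ′) f + (u + c x)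
    lo′ {x′} x′∈ = begin
      c x′                                                                  ≤⟨ lo (there x′∈) ⟩
      ∑ₙ (sel (hits x′) σ) f + u                                            ≡⟨ cong (ℕ._+ u) (split x′) ⟩
      ∑ₙ (sel (hits x′) (sel (hits x) σ)) f + ∑ₙ (sel (hits x′) σ′) f + u
        ≤⟨ ℕ.+-monoˡ-≤ u (ℕ.+-monoˡ-≤ _ (ℕ.≤-trans (∑ₙ-sel-≤ (hits x′) (sel (hits x) σ) f) (hi (here refl)))) ⟩
      c x + ∑ₙ (sel (hits x′) σ′) f + u                                     ≡⟨ ring (c x) _ u ⟩
      ∑ₙ (sel (hits x′) σ′) f + (u + c x)                                   ∎
      where
      open ℕ.≤-Reasoning
      ring : ∀ a b u → a + b + u ≡ b + (u + a)
      ring = ℕ-Ring.solve-∀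
    hi′ : ∀ {x′} → x′ ∈ xs → ∑ₙ (sel (hits x′) σ′) f ≤ c x′
    hi′ {x′} x′∈ = ℕ.≤-trans (ℕ.m≤n+m _ _) (ℕ.≤-trans (ℕ.≤-reflexive (sym (split x′))) (hi (there x′∈)))
    IH = Peel-count xs σ′ f c (u + c x) ch lo′ hi′
    len : ∀ B → sel (hits x) σ ≡ B → length σ ≡ length B + length σ′
    len B eq = trans (length-split (hits x) σ) (cong (λ l → length l + length σ′) eq)
    go : ∀ B → sel (hits x) σ ≡ B →
      (suc (length xs + length (sel (none (x ∷ xs)) σ)) < length σ) ⊎
      (Peel (x ∷ xs) σ × suc (length xs + length (sel (none (x ∷ xs)) σ)) ≡ length σ)
    go [] eq = contradiction (ℕ.≤-trans (lo (here refl)) (ℕ.≤-reflexive (cong (λ l → ∑ₙ l f + u) eq))) (ℕ.<⇒≱ u<)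
    go (w ∷ []) eq with IH
    ... | inj₁ lt        = inj₁ (subst₂ (λ a b → suc (length xs + length a) < b) rest≡ (sym (len _ eq)) (s≤s lt))
    ... | inj₂ (pl , le) = inj₂ (peel eq pl , trans (cong (λ a → suc (length xs + length a)) (sym rest≡)) (trans (cong suc le) (sym (len _ eq))))
    go (w ∷ w′ ∷ B) eq = inj₁ (subst₂ (λ a b → suc (length xs + length a) < b) rest≡ (sym (len _ eq))
      (s≤s (s≤s (ℕ.≤-trans le (ℕ.m≤n+m _ (length B))))))
      where
      le : length xs + length (sel (none xs) σ′) ≤ length σ′
      le with IH
      ... | inj₁ lt       = ℕ.<⇒≤ lt
      ... | inj₂ (_ , eq) = ℕ.≤-reflexive eq

  -- Union bound: a vertex counts on the right once for each listed coordinate that it meets.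
  hit-sum-≤ : ∀ xs σ (f : A → ℕ) → ∑ₙ (sel (not ∘ none xs) σ) f ≤ ∑ₙ xs (λ x → ∑ₙ (sel (hits x) σ) f)
  hit-sum-≤ []       σ f = ℕ.≤-reflexive (nothing σ)
    where
    nothing : ∀ σ → ∑ₙ (sel (not ∘ none []) σ) f ≡ 0
    nothing []      = refl
    nothing (v ∷ σ) = nothing σ
  hit-sum-≤ (x ∷ xs) σ f = ℕ.≤-trans (union σ) (ℕ.+-monoʳ-≤ _ (hit-sum-≤ xs σ f))
    where
    union : ∀ σ → ∑ₙ (sel (not ∘ none (x ∷ xs)) σ) f ≤ ∑ₙ (sel (hits x) σ) f + ∑ₙ (sel (not ∘ none xs) σ) f
    union [] = z≤n
    union (v ∷ σ) with hits x v | none xs v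
    ... | true  | true  = ℕ.≤-trans (ℕ.+-monoʳ-≤ (f v) (union σ)) (ℕ.≤-reflexive (sym (ℕ.+-assoc (f v) _ _)))
    ... | true  | false = ℕ.≤-trans (ℕ.+-monoʳ-≤ (f v) (ℕ.≤-trans (union σ) (ℕ.+-monoʳ-≤ (∑ₙ (sel (hits x) σ) f) (ℕ.m≤n+m (∑ₙ (sel (not ∘ none xs) σ) f) (f v)))))
                            (ℕ.≤-reflexive (sym (ℕ.+-assoc (f v) _ _)))
    ... | false | true  = union σ
    ... | false | false = ℕ.≤-trans (ℕ.+-monoʳ-≤ (f v) (union σ)) (ℕ.≤-reflexive (ring (f v) (∑ₙ (sel (hits x) σ) f) (∑ₙ (sel (not ∘ none xs) σ) f)))
      where
      ring : ∀ x y z → x + (y + z) ≡ y + (x + z)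
      ring = ℕ-Ring.solve-∀

  none-++ : ∀ xs ys v → none (xs ++ ys) v ≡ none xs v ∧ none ys v
  none-++ []       ys v = refl
  none-++ (x ∷ xs) ys v = trans (cong (not (hits x v) ∧_) (none-++ xs ys v)) (sym (𝔹.∧-assoc (not (hits x v)) _ _))

holes : ∀ {X : Set} {n} → Vec Bool n → (Fin n → X) → List X
holes []          ι = []
holes (true ∷ S)  ι = holes S (ι ∘ Fin.suc)
holes (false ∷ S) ι = ι Fin.zero ∷ holes S (ι ∘ Fin.suc)

-- The coordinates that vanish on G, by increasing `weight`. The map `ι` carries coordinates of the
-- remaining factors into those of the whole product.
transversal : ∀ {X : Set} {ds} → Face ds → (Coord ds → X) → List X
transversal {ds = []}     tt      ι = []
transversal {ds = c ∷ cs} (S , G) ι = holes S (ι ∘ inj₁) ++ transversal G (ι ∘ inj₂)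

suc≟suc : ∀ {n} (i j : Fin n) → ⌊ Fin.suc i Fin.≟ Fin.suc j ⌋ ≡ ⌊ i Fin.≟ j ⌋
suc≟suc i j with i Fin.≟ j
... | yes _ = refl
... | no _  = refl

module _ {X A : Set} (hits : X → A → Bool) where

  none-holes-miss : ∀ {n} (S : Vec Bool n) (ι : Fin n → X) v → (∀ j → hits (ι j) v ≡ false) → none hits (holes S ι) v ≡ true
  none-holes-miss []          ι v miss = refl
  none-holes-miss (true ∷ S)  ι v miss = none-holes-miss S (ι ∘ Fin.suc) v (miss ∘ Fin.suc)
  none-holes-miss (false ∷ S) ι v miss = cong₂ (λ a b → not a ∧ b) (miss Fin.zero) (none-holes-miss S (ι ∘ Fin.suc) v (miss ∘ Fin.suc))

  none-holes : ∀ {n} (S : Vec Bool n) (ι : Fin n → X) v i → (∀ j → hits (ι j) v ≡ ⌊ i Fin.≟ j ⌋) →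
    none hits (holes S ι) v ≡ Vec.lookup S i
  none-holes (true ∷ S)  ι v Fin.zero    at-i = none-holes-miss S (ι ∘ Fin.suc) v (at-i ∘ Fin.suc)
  none-holes (false ∷ S) ι v Fin.zero    at-i = cong (λ a → not a ∧ none hits (holes S (ι ∘ Fin.suc)) v) (at-i Fin.zero)
  none-holes (true ∷ S)  ι v (Fin.suc i) at-i = none-holes S (ι ∘ Fin.suc) v i (λ j → trans (at-i (Fin.suc j)) (suc≟suc i j))
  none-holes (false ∷ S) ι v (Fin.suc i) at-i =
    cong₂ (λ a b → not a ∧ b) (at-i Fin.zero) (none-holes S (ι ∘ Fin.suc) v i (λ j → trans (at-i (Fin.suc j)) (suc≟suc i j)))

  none-transversal : ∀ {ds} (G : Face ds) (ι : Coord ds → X) v (w : Vertex ds) → (∀ x → hits (ι x) v ≡ hit x w) →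
    none hits (transversal G ι) v ≡ inFace G w
  none-transversal {[]}     tt      ι v tt      at-w = refl
  none-transversal {c ∷ cs} (S , G) ι v (i , w) at-w = trans (none-++ hits (holes S (ι ∘ inj₁)) _ v)
    (cong₂ _∧_ (none-holes S (ι ∘ inj₁) v i (at-w ∘ inj₁)) (none-transversal G (ι ∘ inj₂) v w (at-w ∘ inj₂)))

coordIn : ∀ {ds} → Face ds → Coord ds → Bool
coordIn {c ∷ cs} (S , G) (inj₁ j) = Vec.lookup S j
coordIn {c ∷ cs} (S , G) (inj₂ x) = coordIn G x

-- The exponent is the position of the coordinate in the whole product; `o` counts the coordinates
-- of earlier factors.
weight : ∀ {ds} → ℕ → Coord ds → ℕ
weight {c ∷ cs} o (inj₁ j) = 2 ^ (o + Fin.toℕ j)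
weight {c ∷ cs} o (inj₂ x) = weight (o + suc c) x

ncoords : List ℕ → ℕ
ncoords []       = 0
ncoords (c ∷ cs) = suc c + ncoords cs

double-< : ∀ {u} o → u < 2 ^ o → u + 2 ^ o < 2 ^ suc o
double-< {u} o u< = ℕ.<-≤-trans (ℕ.+-monoˡ-< (2 ^ o) u<) (ℕ.≤-reflexive (cong (ℕ._+_ (2 ^ o)) (sym (ℕ.+-identityʳ (2 ^ o)))))

2^-mono : ∀ {u} o → u < 2 ^ o → u < 2 ^ suc o
2^-mono o u< = ℕ.<-≤-trans u< (ℕ.m≤m+n (2 ^ o) _)

-- Powers of two: each weight exceeds the sum of all earlier ones.
holes-Chain : ∀ {X : Set} {n} (w : X → ℕ) (S : Vec Bool n) (ι : Fin n → X) o u B ys → (∀ j → w (ι j) ≡ 2 ^ (o + Fin.toℕ j)) →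
  u < 2 ^ o → (∀ u′ → u′ < 2 ^ (o + n) → Chain w u′ ys × u′ + ∑ₙ ys w < B) →
  Chain w u (holes S ι ++ ys) × u + ∑ₙ (holes S ι ++ ys) w < B
holes-Chain w []          ι o u B ys wι u< rest = rest u (subst (λ k → u < 2 ^ k) (sym (ℕ.+-identityʳ o)) u<)
holes-Chain {n = suc n} w (true ∷ S)  ι o u B ys wι u< rest =
  holes-Chain w S (ι ∘ Fin.suc) (suc o) u B ys (λ j → trans (wι (Fin.suc j)) (cong (2 ^_) (ℕ.+-suc o (Fin.toℕ j))))
    (2^-mono o u<) (λ u′ lt → rest u′ (subst (λ k → u′ < 2 ^ k) (sym (ℕ.+-suc o n)) lt))
holes-Chain {n = suc n} w (false ∷ S) ι o u B ys wι u< rest =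
  (subst (u <_) (sym w₀) u< , proj₁ IH) , subst (_< B) (ℕ.+-assoc u _ _) (proj₂ IH)
  where
  w₀ : w (ι Fin.zero) ≡ 2 ^ o
  w₀ = trans (wι Fin.zero) (cong (2 ^_) (ℕ.+-identityʳ o))
  IH = holes-Chain w S (ι ∘ Fin.suc) (suc o) (u + w (ι Fin.zero)) B ys
    (λ j → trans (wι (Fin.suc j)) (cong (2 ^_) (ℕ.+-suc o (Fin.toℕ j))))
    (subst (λ k → u + k < 2 ^ suc o) (sym w₀) (double-< o u<))
    (λ u′ lt → rest u′ (subst (λ k → u′ < 2 ^ k) (sym (ℕ.+-suc o n)) lt))

-- The bound on the sum comes along in the same induction. For `o = u = 0` it says that
-- `2 ^ ncoords ds`, the later constant K, exceeds the total weight off G.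
transversal-Chain : ∀ {X : Set} {ds} (w : X → ℕ) (G : Face ds) (ι : Coord ds → X) o u → (∀ x → w (ι x) ≡ weight o x) →
  u < 2 ^ o → Chain w u (transversal G ι) × u + ∑ₙ (transversal G ι) w < 2 ^ (o + ncoords ds)
transversal-Chain {ds = []}     w tt      ι o u wι u< = tt ,
  subst₂ (λ a b → a < 2 ^ b) (sym (ℕ.+-identityʳ u)) (sym (ℕ.+-identityʳ o)) u<
transversal-Chain {ds = c ∷ cs} w (S , G) ι o u wι u< =
  holes-Chain w S (ι ∘ inj₁) o u _ (transversal G (ι ∘ inj₂)) (wι ∘ inj₁) u<
    (λ u′ lt → subst (λ k → Chain w u′ (transversal G (ι ∘ inj₂)) × u′ + ∑ₙ (transversal G (ι ∘ inj₂)) w < 2 ^ k)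
      (ℕ.+-assoc o (suc c) (ncoords cs)) (transversal-Chain w G (ι ∘ inj₂) (o + suc c) u′ (wι ∘ inj₂) lt))

-- Weak compositions and polynomial growth

bump : List ℕ → List ℕ
bump []       = []
bump (x ∷ xs) = suc x ∷ xs

-- Weak compositions of m into a parts. Splitting by whether the first part is 0 gives Pascal's
-- rule, so for positive a their number is C(m+a-1, a-1).
comps : ℕ → ℕ → List (List ℕ)
comps zero    zero    = [] ∷ []
comps zero    (suc m) = []
comps (suc a) zero    = map (0 ∷_) (comps a zero)
comps (suc a) (suc m) = map (0 ∷_) (comps a (suc m)) ++ map bump (comps (suc a) m)

HasSum : ℕ → ℕ → List ℕ → Set
HasSum a m q = length q ≡ a × sum q ≡ m

HasSum-0∷ : ∀ {a m qs} → (∀ {q} → q ∈ qs → HasSum a m q) → ∀ {q} → q ∈ map (0 ∷_) qs → HasSum (suc a) m q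
HasSum-0∷ ih q∈ with ∈.∈-map⁻ (0 ∷_) q∈
... | q , q∈′ , refl = cong suc (proj₁ (ih q∈′)) , proj₂ (ih q∈′)

HasSum-bump : ∀ {a m qs} → (∀ {q} → q ∈ qs → HasSum (suc a) m q) → ∀ {q} → q ∈ map bump qs → HasSum (suc a) (suc m) q
HasSum-bump ih q∈ with ∈.∈-map⁻ bump q∈
... | q , q∈′ , refl with q | ih q∈′
... | x ∷ xs | l , s = l , cong suc s

comps-sound : ∀ a m {q} → q ∈ comps a m → HasSum a m q
comps-sound zero    zero    (here refl) = refl , refl
comps-sound (suc a) zero    q∈ = HasSum-0∷ (comps-sound a zero) q∈
comps-sound (suc a) (suc m) q∈ = Sum.[ HasSum-0∷ (comps-sound a (suc m)) , HasSum-bump (comps-sound (suc a) m) ]′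
  (∈.∈-++⁻ (map (0 ∷_) (comps a (suc m))) q∈)

comps-complete : ∀ a m q → length q ≡ a → sum q ≡ m → q ∈ comps a m
comps-complete zero    zero    []           l s = here refl
comps-complete (suc a) zero    (zero ∷ q)   l s = ∈.∈-map⁺ (0 ∷_) (comps-complete a zero q (ℕ.suc-injective l) s)
comps-complete (suc a) (suc m) (zero ∷ q)   l s = ∈.∈-++⁺ˡ (∈.∈-map⁺ (0 ∷_) (comps-complete a (suc m) q (ℕ.suc-injective l) s))
comps-complete (suc a) (suc m) (suc x ∷ q)  l s = ∈.∈-++⁺ʳ (map (0 ∷_) (comps a (suc m)))
  (∈.∈-map⁺ bump (comps-complete (suc a) m (x ∷ q) l (ℕ.suc-injective s)))

comps-unique : ∀ a m → Unique (comps a m)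
comps-unique zero    zero    = [] ∷ []
comps-unique zero    (suc m) = []
comps-unique (suc a) zero    = Unique.map⁺ List.∷-injectiveʳ (comps-unique a zero)
comps-unique (suc a) (suc m) = Unique.++⁺ (Unique.map⁺ List.∷-injectiveʳ (comps-unique a (suc m)))
  (Unique.map⁺ bump-injective (comps-unique (suc a) m)) disjoint
  where
  bump-injective : ∀ {q r} → bump q ≡ bump r → q ≡ r
  bump-injective {[]}    {[]}    _  = refl
  bump-injective {x ∷ q} {y ∷ r} eq = cong₂ _∷_ (ℕ.suc-injective (List.∷-injectiveˡ eq)) (List.∷-injectiveʳ eq)
  disjoint : ∀ {q} → q ∈ map (0 ∷_) (comps a (suc m)) × q ∈ map bump (comps (suc a) m) → ⊥
  disjoint (p , p′) with ∈.∈-map⁻ (0 ∷_) p | ∈.∈-map⁻ bump p′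
  ... | q , _ , refl | []    , _ , ()
  ... | q , _ , refl | x ∷ r , _ , ()

#comps : ℕ → ℕ → ℕ
#comps a m = length (comps a m)

#comps-zero : ∀ a → #comps a 0 ≡ 1
#comps-zero zero    = refl
#comps-zero (suc a) = trans (List.length-map (0 ∷_) (comps a 0)) (#comps-zero a)

#comps-suc : ∀ a m → #comps (suc a) (suc m) ≡ #comps a (suc m) + #comps (suc a) m
#comps-suc a m = trans (List.length-++ (map (0 ∷_) (comps a (suc m))))
  (cong₂ _+_ (List.length-map (0 ∷_) (comps a (suc m))) (List.length-map bump (comps (suc a) m)))

#comps-1 : ∀ m → #comps 1 m ≡ 1
#comps-1 zero    = refl
#comps-1 (suc m) = trans (#comps-suc 0 m) (#comps-1 m)

#comps-2 : ∀ m → #comps 2 m ≡ suc m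
#comps-2 zero    = refl
#comps-2 (suc m) = trans (#comps-suc 1 m) (cong₂ _+_ (#comps-1 (suc m)) (#comps-2 m))

-- The leading coefficient ½ here is the origin of `2 ^ t′`.
#comps-3 : ∀ m → 2 * #comps 3 m ≡ suc m * suc (suc m)
#comps-3 zero    = refl
#comps-3 (suc m) = begin
  2 * #comps 3 (suc m)                      ≡⟨ cong (2 *_) (#comps-suc 2 m) ⟩
  2 * (#comps 2 (suc m) + #comps 3 m)       ≡⟨ ℕ.*-distribˡ-+ 2 (#comps 2 (suc m)) (#comps 3 m) ⟩
  2 * #comps 2 (suc m) + 2 * #comps 3 m     ≡⟨ cong₂ (λ a b → 2 * a + b) (#comps-2 (suc m)) (#comps-3 m) ⟩
  2 * suc (suc m) + suc m * suc (suc m)     ≡⟨ ring m ⟩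
  suc (suc m) * suc (suc (suc m))           ∎
  where
  open ≡-Reasoning
  ring : ∀ m → 2 * suc (suc m) + suc m * suc (suc m) ≡ suc (suc m) * suc (suc (suc m))
  ring = ℕ-Ring.solve-∀

-- The two leading terms of the binomial expansion; this is the induction step of `#comps-≤`.
bernoulli : ∀ a x → suc a * x ^ a + x ^ suc a ≤ suc x ^ suc a
bernoulli zero    x = ℕ.≤-reflexive (ring x)
  where
  ring : ∀ x → 1 * 1 + x * 1 ≡ suc x * 1
  ring = ℕ-Ring.solve-∀
bernoulli (suc a) x = begin
  suc (suc a) * x ^ suc a + x ^ suc (suc a)                            ≤⟨ ℕ.m≤m+n _ _ ⟩
  suc (suc a) * x ^ suc a + x ^ suc (suc a) + suc a * x ^ a            ≡⟨ ring a x (x ^ a) ⟩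
  suc x * (suc a * x ^ a + x ^ suc a)                                  ≤⟨ ℕ.*-monoʳ-≤ (suc x) (bernoulli a x) ⟩
  suc x ^ suc (suc a)                                                  ∎
  where
  open ℕ.≤-Reasoning
  ring : ∀ a x p → suc (suc a) * (x * p) + x * (x * p) + suc a * p ≡ suc x * (suc a * p + x * p)
  ring = ℕ-Ring.solve-∀

-- The count is C(m+a, a), and a! times it is the product (m+1)⋯(m+a).
#comps-≤ : ∀ a m → a ! * #comps (suc a) m ≤ (m + a) ^ a
#comps-≤ zero    m       = ℕ.≤-reflexive (trans (ℕ.*-identityˡ _) (#comps-1 m))
#comps-≤ (suc a) zero    = subst (_≤ suc a ^ suc a)
  (sym (trans (cong (suc a ! *_) (#comps-zero (suc (suc a)))) (ℕ.*-identityʳ (suc a !)))) (!≤^ (suc a))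
  where
  !≤^ : ∀ n → n ! ≤ n ^ n
  !≤^ zero    = ℕ.≤-refl
  !≤^ (suc n) = ℕ.*-monoʳ-≤ (suc n) (ℕ.≤-trans (!≤^ n) (ℕ.^-monoˡ-≤ n (ℕ.n≤1+n n)))
#comps-≤ (suc a) (suc m) = begin
  suc a ! * #comps (suc (suc a)) (suc m)                                    ≡⟨ cong (suc a ! *_) (#comps-suc (suc a) m) ⟩
  suc a ! * (#comps (suc a) (suc m) + #comps (suc (suc a)) m)               ≡⟨ ring (suc a) (a !) _ _ ⟩
  suc a * (a ! * #comps (suc a) (suc m)) + suc a ! * #comps (suc (suc a)) m
    ≤⟨ ℕ.+-mono-≤ (ℕ.*-monoʳ-≤ (suc a) (#comps-≤ a (suc m))) (#comps-≤ (suc a) m) ⟩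
  suc a * (suc m + a) ^ a + (m + suc a) ^ suc a                             ≡⟨ cong (λ z → suc a * (suc m + a) ^ a + z ^ suc a) (ℕ.+-suc m a) ⟩
  suc a * (suc m + a) ^ a + (suc m + a) ^ suc a                             ≤⟨ bernoulli a (suc m + a) ⟩
  suc (suc m + a) ^ suc a                                                   ≡⟨ cong (λ z → suc z ^ suc a) (sym (ℕ.+-suc m a)) ⟩
  (suc m + suc a) ^ suc a                                                   ∎
  where
  open ℕ.≤-Reasoning
  ring : ∀ b f x y → b * f * (x + y) ≡ b * (f * x) + b * f * y
  ring = ℕ-Ring.solve-∀

*-^ : ∀ k x y → (x * y) ^ k ≡ x ^ k * y ^ k
*-^ zero    x y = refl
*-^ (suc k) x y = trans (cong (x * y *_) (*-^ k x y)) (ℕ.[m*n]*[o*p]≡[m*o]*[n*p] x y (x ^ k) (y ^ k))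

-- A division-free form of (1 + 1/j)^k ≤ 1 + c/j, with c depending on k only.
power-growth : ∀ k → ∃ λ c → ∀ j → 1 ≤ j → j * suc j ^ k ≤ j ^ k * (j + c)
power-growth zero    = 0 , λ j _ → ℕ.≤-reflexive (ring j)
  where
  ring : ∀ j → j * 1 ≡ 1 * (j + 0)
  ring = ℕ-Ring.solve-∀
power-growth (suc k) with power-growth k
... | c , p = suc (c + c) , λ j 1≤j → begin
  j * suc j ^ suc k                     ≡⟨ ring₁ j (suc j ^ k) ⟩
  suc j * (j * suc j ^ k)               ≤⟨ ℕ.*-monoʳ-≤ (suc j) (p j 1≤j) ⟩
  suc j * (j ^ k * (j + c))             ≡⟨ ring₂ j (j ^ k) c ⟩
  j ^ k * (j * (j + suc c) + c)         ≤⟨ ℕ.*-monoʳ-≤ (j ^ k) (ℕ.+-monoʳ-≤ (j * (j + suc c)) (ℕ.≤-trans (ℕ.≤-reflexive (sym (ℕ.*-identityˡ c))) (ℕ.*-monoˡ-≤ c 1≤j))) ⟩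
  j ^ k * (j * (j + suc c) + j * c)     ≡⟨ ring₃ j (j ^ k) c ⟩
  j ^ suc k * (j + suc (c + c))         ∎
  where
  open ℕ.≤-Reasoning
  ring₁ : ∀ j s → j * (suc j * s) ≡ suc j * (j * s)
  ring₁ = ℕ-Ring.solve-∀
  ring₂ : ∀ j p c → suc j * (p * (j + c)) ≡ p * (j * (j + suc c) + c)
  ring₂ = ℕ-Ring.solve-∀
  ring₃ : ∀ j p c → p * (j * (j + suc c) + j * c) ≡ j * p * (j + suc (c + c))
  ring₃ = ℕ-Ring.solve-∀

-- Both sides grow like n^(k+1), with coefficients X and Y, and one explicit n refutes X > Y. The
-- shift is a successor so that its powers can be cancelled.
leading-coefficient : ∀ X Y C κ k →
  (∀ n → n * X * n ^ k ≤ n * Y * (n + suc κ) ^ k + C * (n + suc κ) ^ k) → X ≤ Y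
leading-coefficient X Y C κ k hyp with X ℕ.≤? Y
... | yes p = p
... | no X≰Y with power-growth k
... | c , growth = contradiction (ℕ.*-cancelˡ-≤ j absurd) (ℕ.<⇒≱ (ℕ.n<1+n L))
  where
  open ℕ.≤-Reasoning
  K L j : ℕ
  K = suc κ
  -- The test value is `K j`, since `K j + K = K (j + 1)` lets `K ^ k` factor out. If X exceeded Y,
  -- the inequality would give j ≤ L; hence j is L + 1.
  L = K * Y * c + C + C * c
  j = suc L
  instance
    K^k≢0 : NonZero (K ^ k)
    K^k≢0 = m^n≢0 K k
    j^k≢0 : NonZero (j ^ k)
    j^k≢0 = m^n≢0 j k
  ring₁ : ∀ j X Kk jk K → Kk * jk * (K * j * j * X) ≡ j * (K * j * X * (Kk * jk))
  ring₁ = ℕ-Ring.solve-∀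
  ring₂ : ∀ j Y C K Kk p → j * (K * j * Y * (Kk * p) + C * (Kk * p)) ≡ Kk * ((K * j * Y + C) * (j * p))
  ring₂ = ℕ-Ring.solve-∀
  ring₃ : ∀ Kk a jk b → Kk * (a * (jk * b)) ≡ Kk * jk * (a * b)
  ring₃ = ℕ-Ring.solve-∀
  K*j : K * j + K ≡ K * suc j
  K*j = trans (ℕ.+-comm (K * j) K) (sym (ℕ.*-suc K j))
  scaled : K * j * j * X ≤ (K * j * Y + C) * (j + c)
  scaled = ℕ.*-cancelˡ-≤ (K ^ k * j ^ k) {{ℕ.m*n≢0 (K ^ k) (j ^ k)}} (begin
    K ^ k * j ^ k * (K * j * j * X)             ≡⟨ ring₁ j X (K ^ k) (j ^ k) K ⟩
    j * (K * j * X * (K ^ k * j ^ k))           ≡⟨ cong (λ z → j * (K * j * X * z)) (*-^ k K j) ⟨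
    j * (K * j * X * (K * j) ^ k)               ≤⟨ ℕ.*-monoʳ-≤ j (hyp (K * j)) ⟩
    j * (K * j * Y * (K * j + K) ^ k + C * (K * j + K) ^ k)
      ≡⟨ cong (λ z → j * (K * j * Y * z + C * z)) (trans (cong (_^ k) K*j) (*-^ k K (suc j))) ⟩
    j * (K * j * Y * (K ^ k * suc j ^ k) + C * (K ^ k * suc j ^ k)) ≡⟨ ring₂ j Y C K (K ^ k) (suc j ^ k) ⟩
    K ^ k * ((K * j * Y + C) * (j * suc j ^ k)) ≤⟨ ℕ.*-monoʳ-≤ (K ^ k) (ℕ.*-monoʳ-≤ (K * j * Y + C) (growth j (s≤s z≤n))) ⟩
    K ^ k * ((K * j * Y + C) * (j ^ k * (j + c))) ≡⟨ ring₃ (K ^ k) (K * j * Y + C) (j ^ k) (j + c) ⟩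
    K ^ k * j ^ k * ((K * j * Y + C) * (j + c)) ∎)
  ring₄ : ∀ K j Y → K * j * j * suc Y ≡ K * j * j * Y + K * (j * j)
  ring₄ = ℕ-Ring.solve-∀
  ring₅ : ∀ K j Y C c → (K * j * Y + C) * (j + c) ≡ K * j * j * Y + (j * (K * Y * c + C) + C * c)
  ring₅ = ℕ-Ring.solve-∀
  absurd : j * j ≤ j * L
  absurd = begin
    j * j                          ≤⟨ ℕ.m≤m+n (j * j) (κ * (j * j)) ⟩
    K * (j * j)                    ≤⟨ ℕ.+-cancelˡ-≤ (K * j * j * Y) _ _ (begin
        K * j * j * Y + K * (j * j)  ≡⟨ ring₄ K j Y ⟨
        K * j * j * suc Y            ≤⟨ ℕ.*-monoʳ-≤ (K * j * j) (ℕ.≰⇒> X≰Y) ⟩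
        K * j * j * X                ≤⟨ scaled ⟩
        (K * j * Y + C) * (j + c)    ≡⟨ ring₅ K j Y C c ⟩
        K * j * j * Y + (j * (K * Y * c + C) + C * c) ∎) ⟩
    j * (K * Y * c + C) + C * c      ≤⟨ ℕ.+-monoʳ-≤ (j * (K * Y * c + C)) (ℕ.m≤m+n (C * c) (L * (C * c))) ⟩
    j * (K * Y * c + C) + j * (C * c) ≡⟨ ℕ.*-distribˡ-+ j (K * Y * c + C) (C * c) ⟨
    j * L                          ∎

-- Dimensions and enumeration of faces

trues : ∀ {n} → Vec Bool n → ℕ
trues []          = 0
trues (true ∷ S)  = suc (trues S)
trues (false ∷ S) = trues S

size-trues : ∀ {n} (S : Vec Bool n) → size S ≡ trues S
size-trues S = go S (Vec.lookup S) id (λ _ → refl)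
  where
  go : ∀ {A : Set} {n} (S : Vec Bool n) (g : A → Bool) (h : Fin n → A) → (∀ i → g (h i) ≡ Vec.lookup S i) →
    length (filter (λ j → T? (g j)) (tabulate h)) ≡ trues S
  go []          g h eq = refl
  go (true ∷ S)  g h eq with g (h Fin.zero) | eq Fin.zero
  ... | true  | refl = cong suc (go S g (h ∘ Fin.suc) (eq ∘ Fin.suc))
  go (false ∷ S) g h eq with g (h Fin.zero) | eq Fin.zero
  ... | false | refl = go S g (h ∘ Fin.suc) (eq ∘ Fin.suc)

trues-holes : ∀ {X : Set} {n} (S : Vec Bool n) (ι : Fin n → X) → length (holes S ι) + trues S ≡ n
trues-holes []          ι = refl
trues-holes (true ∷ S)  ι = trans (ℕ.+-suc _ _) (cong suc (trues-holes S (ι ∘ Fin.suc)))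
trues-holes (false ∷ S) ι = cong suc (trues-holes S (ι ∘ Fin.suc))

trues≤ : ∀ {n} (S : Vec Bool n) → trues S ≤ n
trues≤ S = ℕ.≤-trans (ℕ.m≤n+m _ _) (ℕ.≤-reflexive (trues-holes S id))

length-tail′ : ∀ {A : Set} (xs : List A) → length (tail' xs) ≡ length xs ∸ 1
length-tail′ []       = refl
length-tail′ (x ∷ xs) = refl

Nonempty : ∀ {ds} → Face ds → Set
Nonempty {[]}     tt      = ⊤
Nonempty {c ∷ cs} (S , G) = 1 ≤ size S × Nonempty G

Small : List ℕ → Set
Small = All (_≤ 2)

Small-dims : ∀ s t → Small (dims s t)
Small-dims s t = All.++⁺ (All.replicate⁺ s (s≤s z≤n)) (All.replicate⁺ t (s≤s (s≤s z≤n)))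

rdim-∷ : ∀ {c cs} (S : Sub (suc c)) (G : Face cs) → rdim {c ∷ cs} (S , G) ≡ (size S ∸ 1) + rdim G
rdim-∷ S G = cong (_+ rdim G) (length-tail′ (elems S))

-- Factorwise, a nonempty S has dimension `size S ∸ 1` and misses `suc c ∸ size S` positions, which
-- together make c.
length-transversal : ∀ {X : Set} {ds} (G : Face ds) (ι : Coord ds → X) → Nonempty G → length (transversal G ι) + rdim G ≡ dimOf ds
length-transversal {ds = []}     tt      ι ne = refl
length-transversal {ds = c ∷ cs} (S , G) ι (1≤ , ne) = begin
  length (holes S (ι ∘ inj₁) ++ transversal G (ι ∘ inj₂)) + rdim {c ∷ cs} (S , G)
    ≡⟨ cong₂ _+_ (List.length-++ (holes S (ι ∘ inj₁))) (rdim-∷ S G) ⟩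
  (length (holes S (ι ∘ inj₁)) + length (transversal G (ι ∘ inj₂))) + (size S ∸ 1 + rdim G)
    ≡⟨ ring (length (holes S (ι ∘ inj₁))) (length (transversal G (ι ∘ inj₂))) (size S ∸ 1) (rdim G) ⟩
  (length (holes S (ι ∘ inj₁)) + (size S ∸ 1)) + (length (transversal G (ι ∘ inj₂)) + rdim G)
    ≡⟨ cong₂ _+_ factor (length-transversal G (ι ∘ inj₂) ne) ⟩
  c + dimOf cs ∎
  where
  open ≡-Reasoning
  ring : ∀ a b c d → (a + b) + (c + d) ≡ (a + c) + (b + d)
  ring = ℕ-Ring.solve-∀
  factor : length (holes S (ι ∘ inj₁)) + (size S ∸ 1) ≡ c
  factor = trans (sym (ℕ.+-∸-assoc (length (holes S (ι ∘ inj₁))) 1≤))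
    (cong (_∸ 1) (trans (cong (ℕ._+_ (length (holes S (ι ∘ inj₁)))) (size-trues S)) (trues-holes S (ι ∘ inj₁))))

trues-replicate : ∀ n → trues (Vec.replicate n true) ≡ n
trues-replicate zero    = refl
trues-replicate (suc n) = cong suc (trues-replicate n)

rdim-fullFace : ∀ ds → rdim (fullFace ds) ≡ dimOf ds
rdim-fullFace []       = refl
rdim-fullFace (c ∷ cs) = trans (rdim-∷ (Vec.replicate (suc c) true) (fullFace cs))
  (cong₂ (λ a b → (a ∸ 1) + b) (trans (size-trues (Vec.replicate (suc c) true)) (trues-replicate (suc c))) (rdim-fullFace cs))

inFace-fullFace : ∀ {ds} (v : Vertex ds) → T (inFace (fullFace ds) v)
inFace-fullFace {[]}     tt      = tt
inFace-fullFace {c ∷ cs} (i , w) with Vec.lookup (Vec.replicate (suc c) true) i | Vec.lookup-replicate i true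
... | true | _ = inFace-fullFace w

data Size : ℕ → Set where
  point    : Size 1
  segment  : Size 2
  triangle : Size 3

sizeOf : ∀ {c} (S : Sub (suc c)) → c ≤ 2 → 1 ≤ size S → Size (size S)
sizeOf {c} S c≤2 1≤ = go (size S) 1≤ (ℕ.≤-trans (ℕ.≤-reflexive (size-trues S)) (ℕ.≤-trans (trues≤ S) (s≤s c≤2)))
  where
  go : ∀ b → 1 ≤ b → b ≤ 3 → Size b
  go 1 _ _ = point
  go 2 _ _ = segment
  go 3 _ _ = triangle
  go (suc (suc (suc (suc b)))) _ (s≤s (s≤s (s≤s ())))

rdim-type : ∀ {ds} (G : Face ds) → Small ds → Nonempty G → rdim G ≡ nSeg G + 2 * nTri G
rdim-type {[]}     tt      _           _         = refl
rdim-type {c ∷ cs} (S , G) (c≤2 ∷ sm) (1≤ , ne) rewrite rdim-∷ S G | rdim-type G sm ne with size S | sizeOf S c≤2 1≤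
... | .1 | point    = refl
... | .2 | segment  = refl
... | .3 | triangle = ring (nSeg G) (nTri G)
  where
  ring : ∀ a b → 2 + (a + 2 * b) ≡ a + 2 * suc b
  ring = ℕ-Ring.solve-∀

concatMap-product : ∀ {A B : Set} (xs : List A) (ys : List B) →
  concatMap (λ x → map (λ y → (x , y)) ys) xs ≡ cartesianProduct xs ys
concatMap-product []       ys = refl
concatMap-product (x ∷ xs) ys = cong (map (λ y → (x , y)) ys ++_) (concatMap-product xs ys)

length-product : ∀ {A B : Set} (xs : List A) (ys : List B) → length (cartesianProduct xs ys) ≡ length xs * length ys
length-product []       ys = refl
length-product (x ∷ xs) ys = trans (List.length-++ (map (x ,_) ys))
  (cong₂ _+_ (List.length-map (x ,_) ys) (length-product xs ys))

allSubs-unique : ∀ n → Unique (allSubs n)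
allSubs-unique zero    = [] ∷ []
allSubs-unique (suc n) = Unique.++⁺ (Unique.map⁺ (cong Vec.tail) (allSubs-unique n)) (Unique.map⁺ (cong Vec.tail) (allSubs-unique n)) disjoint
  where
  disjoint : ∀ {S : Sub (suc n)} → S ∈ map (true ∷_) (allSubs n) × S ∈ map (false ∷_) (allSubs n) → ⊥
  disjoint (p , q) with ∈.∈-map⁻ (true ∷_) p | ∈.∈-map⁻ (false ∷_) q
  ... | _ , _ , refl | _ , _ , ()

allFaces-unique : ∀ ds → Unique (allFaces ds)
allFaces-unique []       = [] ∷ []
allFaces-unique (c ∷ cs) = subst Unique (sym (concatMap-product (filter (λ S → 1 ℕ.≤? size S) (allSubs (suc c))) (allFaces cs)))
  (Unique.cartesianProduct⁺ (Unique.filter⁺ (λ S → 1 ℕ.≤? size S) (allSubs-unique (suc c))) (allFaces-unique cs))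

allFaces-nonempty : ∀ {ds} {G : Face ds} → G ∈ allFaces ds → Nonempty G
allFaces-nonempty {[]}     _  = tt
allFaces-nonempty {c ∷ cs} G∈
  with ∈.∈-cartesianProduct⁻ (filter (λ S → 1 ℕ.≤? size S) (allSubs (suc c))) (allFaces cs)
         (subst (_ ∈_) (concatMap-product (filter (λ S → 1 ℕ.≤? size S) (allSubs (suc c))) (allFaces cs)) G∈)
... | S∈ , G′∈ = proj₂ (∈.∈-filter⁻ (λ S → 1 ℕ.≤? size S) {xs = allSubs (suc c)} S∈) , allFaces-nonempty G′∈

allVertices-unique : ∀ ds → Unique (allVertices ds)
allVertices-unique []       = [] ∷ []
allVertices-unique (c ∷ cs) = subst Unique (sym (concatMap-product (allFin (suc c)) (allVertices cs)))
  (Unique.cartesianProduct⁺ (Unique.allFin⁺ (suc c)) (allVertices-unique cs))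

∈-allVertices : ∀ {ds} (v : Vertex ds) → v ∈ allVertices ds
∈-allVertices {[]}     tt      = here refl
∈-allVertices {c ∷ cs} (i , w) = subst ((i , w) ∈_) (sym (concatMap-product (allFin (suc c)) (allVertices cs)))
  (∈.∈-cartesianProduct⁺ (∈.∈-allFin i) (∈-allVertices w))

map-unique : ∀ {A B : Set} (f : A → B) {xs} → (∀ {a b} → a ∈ xs → b ∈ xs → f a ≡ f b → a ≡ b) → Unique xs → Unique (map f xs)
map-unique f inj []       = []
map-unique f inj (x∉ ∷ u) = All.map⁺ (All.tabulate (λ y∈ eq → All.lookup x∉ y∈ (inj (here refl) (there y∈) eq))) ∷
  map-unique f (λ a∈ b∈ → inj (there a∈) (there b∈)) u

-- Lattice points near a face

-- With `Balanced n` below, these are the lattice points of the n-fold dilate of the simplotope.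
Grid : List ℕ → Set
Grid []       = ⊤
Grid (c ∷ cs) = Vec ℕ (suc c) × Grid cs

entry : ∀ {ds} → Grid ds → Coord ds → ℕ
entry {c ∷ cs} (u , y) (inj₁ j) = Vec.lookup u j
entry {c ∷ cs} (u , y) (inj₂ x) = entry y x

Grid-ext : ∀ {ds} (y y′ : Grid ds) → (∀ x → entry y x ≡ entry y′ x) → y ≡ y′
Grid-ext {[]}     tt      tt        eq = refl
Grid-ext {c ∷ cs} (u , y) (u′ , y′) eq = cong₂ _,_ (Vec-ext u u′ (eq ∘ inj₁)) (Grid-ext y y′ (eq ∘ inj₂))
  where
  Vec-ext : ∀ {n} (u u′ : Vec ℕ n) → (∀ j → Vec.lookup u j ≡ Vec.lookup u′ j) → u ≡ u′
  Vec-ext []      []        eq = refl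
  Vec-ext (a ∷ u) (b ∷ u′) eq = cong₂ _∷_ (eq Fin.zero) (Vec-ext u u′ (eq ∘ Fin.suc))

Balanced : ∀ {ds} → ℕ → Grid ds → Set
Balanced {[]}     n tt      = ⊤
Balanced {c ∷ cs} n (u , y) = Vec.sum u ≡ n × Balanced n y

module _ (K : ℕ) where

  -- Every coordinate in S receives at least K, more than all weights off the face together. A list
  -- `q` that is too short is read as padded with zeros.
  place : ∀ {n} → Vec Bool n → (Fin n → ℕ) → List ℕ → Vec ℕ n
  place []          w q       = []
  place (false ∷ S) w q       = w Fin.zero ∷ place S (w ∘ Fin.suc) q
  place (true ∷ S)  w []      = K ∷ place S (w ∘ Fin.suc) []
  place (true ∷ S)  w (a ∷ q) = K + a ∷ place S (w ∘ Fin.suc) q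

  place-hole : ∀ {n} (S : Vec Bool n) w q j → Vec.lookup S j ≡ false → Vec.lookup (place S w q) j ≡ w j
  place-hole (false ∷ S) w q       Fin.zero    eq = refl
  place-hole (false ∷ S) w q       (Fin.suc j) eq = place-hole S (w ∘ Fin.suc) q j eq
  place-hole (true ∷ S)  w []      (Fin.suc j) eq = place-hole S (w ∘ Fin.suc) [] j eq
  place-hole (true ∷ S)  w (a ∷ q) (Fin.suc j) eq = place-hole S (w ∘ Fin.suc) q j eq

  place-true : ∀ {n} (S : Vec Bool n) w q j → Vec.lookup S j ≡ true → K ≤ Vec.lookup (place S w q) j
  place-true (true ∷ S)  w []      Fin.zero    eq = ℕ.≤-refl
  place-true (true ∷ S)  w (a ∷ q) Fin.zero    eq = ℕ.m≤m+n K a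
  place-true (false ∷ S) w q       (Fin.suc j) eq = place-true S (w ∘ Fin.suc) q j eq
  place-true (true ∷ S)  w []      (Fin.suc j) eq = place-true S (w ∘ Fin.suc) [] j eq
  place-true (true ∷ S)  w (a ∷ q) (Fin.suc j) eq = place-true S (w ∘ Fin.suc) q j eq

  place-injective : ∀ {n} (S : Vec Bool n) w q r → length q ≡ trues S → length r ≡ trues S → place S w q ≡ place S w r → q ≡ r
  place-injective []          w []      []      lq lr eq = refl
  place-injective (false ∷ S) w q       r       lq lr eq = place-injective S (w ∘ Fin.suc) q r lq lr (cong Vec.tail eq)
  place-injective (true ∷ S)  w (a ∷ q) (b ∷ r) lq lr eq = cong₂ _∷_ (ℕ.+-cancelˡ-≡ K a b (cong Vec.head eq))
    (place-injective S (w ∘ Fin.suc) q r (ℕ.suc-injective lq) (ℕ.suc-injective lr) (cong Vec.tail eq))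

  place-sum : ∀ {X : Set} {n} (S : Vec Bool n) (w : X → ℕ) (ι : Fin n → X) q → length q ≡ trues S →
    Vec.sum (place S (w ∘ ι) q) ≡ ∑ₙ (holes S ι) w + trues S * K + sum q
  place-sum []          w ι []      l = refl
  place-sum (false ∷ S) w ι q       l = trans (cong (ℕ._+_ (w (ι Fin.zero))) (place-sum S w (ι ∘ Fin.suc) q l))
    (ring (w (ι Fin.zero)) (∑ₙ (holes S (ι ∘ Fin.suc)) w) (trues S * K) (sum q))
    where
    ring : ∀ a b c d → a + (b + c + d) ≡ a + b + c + d
    ring = ℕ-Ring.solve-∀
  place-sum (true ∷ S)  w ι (a ∷ q) l = trans (cong (ℕ._+_ (K + a)) (place-sum S w (ι ∘ Fin.suc) q (ℕ.suc-injective l)))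
    (ring K a (∑ₙ (holes S (ι ∘ Fin.suc)) w) (trues S * K) (sum q))
    where
    ring : ∀ k a b c d → k + a + (b + c + d) ≡ b + (k + c) + (a + d)
    ring = ℕ-Ring.solve-∀

  module _ (n : ℕ) where

    -- What the holes and the offsets K leave of n is distributed freely; by `room` below, nothing
    -- is lost in the truncated subtraction.
    block : ∀ {X : Set} {c} → Sub c → (X → ℕ) → (Fin c → X) → List (Vec ℕ c)
    block S w ι = map (place S (w ∘ ι)) (comps (trues S) (n ∸ (∑ₙ (holes S ι) w + trues S * K)))

    grid : ∀ {X : Set} {ds} → Face ds → (X → ℕ) → (Coord ds → X) → List (Grid ds)
    grid {ds = []}     tt      w ι = tt ∷ []
    grid {ds = c ∷ cs} (S , G) w ι = cartesianProduct (block S w (ι ∘ inj₁)) (grid G w (ι ∘ inj₂))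

    grid-unique : ∀ {X : Set} {ds} (G : Face ds) (w : X → ℕ) (ι : Coord ds → X) → Unique (grid G w ι)
    grid-unique {ds = []}     tt      w ι = [] ∷ []
    grid-unique {ds = c ∷ cs} (S , G) w ι = Unique.cartesianProduct⁺
      (map-unique (place S (w ∘ ι ∘ inj₁))
        (λ a∈ b∈ → place-injective S (w ∘ ι ∘ inj₁) _ _ (proj₁ (comps-sound (trues S) _ a∈)) (proj₁ (comps-sound (trues S) _ b∈)))
        (comps-unique (trues S) _))
      (grid-unique G w (ι ∘ inj₂))

    grid-hole : ∀ {X : Set} {ds} (G : Face ds) (w : X → ℕ) (ι : Coord ds → X) {y} → y ∈ grid G w ι →
      ∀ x → coordIn G x ≡ false → entry y x ≡ w (ι x)
    grid-hole {ds = c ∷ cs} (S , G) w ι y∈ x eq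
      with ∈.∈-cartesianProduct⁻ (block S w (ι ∘ inj₁)) (grid G w (ι ∘ inj₂)) y∈ | x
    ... | u∈ , y∈′ | inj₂ x′ = grid-hole G w (ι ∘ inj₂) y∈′ x′ eq
    ... | u∈ , y∈′ | inj₁ j with ∈.∈-map⁻ (place S (w ∘ ι ∘ inj₁)) u∈
    ... | q , _ , refl = place-hole S (w ∘ ι ∘ inj₁) q j eq

    grid-large : ∀ {X : Set} {ds} (G : Face ds) (w : X → ℕ) (ι : Coord ds → X) {y} → y ∈ grid G w ι →
      ∀ x → coordIn G x ≡ true → K ≤ entry y x
    grid-large {ds = c ∷ cs} (S , G) w ι y∈ x eq
      with ∈.∈-cartesianProduct⁻ (block S w (ι ∘ inj₁)) (grid G w (ι ∘ inj₂)) y∈ | x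
    ... | u∈ , y∈′ | inj₂ x′ = grid-large G w (ι ∘ inj₂) y∈′ x′ eq
    ... | u∈ , y∈′ | inj₁ j with ∈.∈-map⁻ (place S (w ∘ ι ∘ inj₁)) u∈
    ... | q , _ , refl = place-true S (w ∘ ι ∘ inj₁) q j eq

∑ₙ-++ : ∀ {A : Set} (xs ys : List A) f → ∑ₙ (xs ++ ys) f ≡ ∑ₙ xs f + ∑ₙ ys f
∑ₙ-++ []       ys f = refl
∑ₙ-++ (x ∷ xs) ys f = trans (cong (ℕ._+_ (f x)) (∑ₙ-++ xs ys f)) (sym (ℕ.+-assoc (f x) _ _))

module _ (K n′ : ℕ) where

  private
    n : ℕ
    n = n′ + 4 * K

  -- The holes take at most K and each of the at most three positions in S takes K: this is the 4 in
  -- `4 * K`.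
  room : ∀ {c} (S : Sub (suc c)) h → c ≤ 2 → h ≤ K → n′ + (h + trues S * K) ≤ n
  room S h c≤2 h≤K = ℕ.+-monoʳ-≤ n′ (ℕ.≤-trans (ℕ.+-mono-≤ h≤K (ℕ.*-monoˡ-≤ K (ℕ.≤-trans (trues≤ S) (s≤s c≤2)))) ℕ.≤-refl)

  grid-balanced : ∀ {X : Set} {ds} (G : Face ds) (w : X → ℕ) (ι : Coord ds → X) → Small ds → ∑ₙ (transversal G ι) w ≤ K →
    ∀ {y} → y ∈ grid K n G w ι → Balanced n y
  grid-balanced {ds = []}     tt      w ι sm         w≤ y∈ = tt
  grid-balanced {ds = c ∷ cs} (S , G) w ι (c≤2 ∷ sm) w≤ y∈
    with ∈.∈-cartesianProduct⁻ (block K n S w (ι ∘ inj₁)) (grid K n G w (ι ∘ inj₂)) y∈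
       | ℕ.≤-trans (ℕ.≤-reflexive (sym (∑ₙ-++ (holes S (ι ∘ inj₁)) (transversal G (ι ∘ inj₂)) w))) w≤
  ... | u∈ , y∈′ | w≤′ with ∈.∈-map⁻ (place K S (w ∘ ι ∘ inj₁)) u∈
  ... | q , q∈ , refl with comps-sound (trues S) _ q∈
  ... | lq , sq =
    trans (place-sum K S w (ι ∘ inj₁) q lq) (trans (cong (ℕ._+_ _) sq)
      (ℕ.m+[n∸m]≡n (ℕ.≤-trans (ℕ.m≤n+m _ n′) (room S (∑ₙ (holes S (ι ∘ inj₁)) w) c≤2 (ℕ.≤-trans (ℕ.m≤m+n _ _) w≤′))))) ,
    grid-balanced G w (ι ∘ inj₂) sm (ℕ.≤-trans (ℕ.m≤n+m _ _) w≤′) y∈′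

  -- In each factor some m ≥ n′ remains to be distributed, in 1, m+1 or (m+1)(m+2)/2 ways for a
  -- point, a segment or a triangle.
  length-grid : ∀ {X : Set} {ds} (G : Face ds) (w : X → ℕ) (ι : Coord ds → X) → Small ds → Nonempty G → ∑ₙ (transversal G ι) w ≤ K →
    n′ ^ rdim G ≤ 2 ^ nTri G * length (grid K n G w ι)
  length-grid {ds = []}     tt      w ι sm         ne        w≤ = ℕ.≤-refl
  length-grid {ds = c ∷ cs} (S , G) w ι (c≤2 ∷ sm) (1≤ , ne) w≤ = begin
    n′ ^ rdim {c ∷ cs} (S , G)                               ≡⟨ cong (n′ ^_) (rdim-∷ S G) ⟩
    n′ ^ (size S ∸ 1 + rdim G)                               ≡⟨ ℕ.^-distribˡ-+-* n′ (size S ∸ 1) (rdim G) ⟩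
    n′ ^ (size S ∸ 1) * n′ ^ rdim G                          ≤⟨ ℕ.*-mono-≤ factor (length-grid G w (ι ∘ inj₂) sm ne (ℕ.≤-trans (ℕ.m≤n+m _ _) w≤′)) ⟩
    2 ^ t * length B * (2 ^ nTri G * length Y)               ≡⟨ ℕ.[m*n]*[o*p]≡[m*o]*[n*p] (2 ^ t) (length B) (2 ^ nTri G) (length Y) ⟩
    2 ^ t * 2 ^ nTri G * (length B * length Y)               ≡⟨ cong₂ _*_ (ℕ.^-distribˡ-+-* 2 t (nTri G)) (length-product B Y) ⟨
    2 ^ (t + nTri G) * length (cartesianProduct B Y)         ∎
    where
    open ℕ.≤-Reasoning
    B : List (Vec ℕ (suc c))
    B = block K n S w (ι ∘ inj₁)
    Y : List (Grid cs)
    Y = grid K n G w (ι ∘ inj₂)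
    t : ℕ
    t = if ⌊ size S ℕ.≟ 3 ⌋ then 1 else 0
    h m : ℕ
    h = ∑ₙ (holes S (ι ∘ inj₁)) w
    m = n ∸ (h + trues S * K)
    w≤′ : h + ∑ₙ (transversal G (ι ∘ inj₂)) w ≤ K
    w≤′ = ℕ.≤-trans (ℕ.≤-reflexive (sym (∑ₙ-++ (holes S (ι ∘ inj₁)) (transversal G (ι ∘ inj₂)) w))) w≤
    n′≤m : n′ ≤ m
    n′≤m = ℕ.m+n≤o⇒m≤o∸n n′ (room S h c≤2 (ℕ.≤-trans (ℕ.m≤m+n _ _) w≤′))
    length-B : length B ≡ #comps (size S) m
    length-B = trans (List.length-map (place K S (w ∘ ι ∘ inj₁)) (comps (trues S) m)) (cong (λ b → #comps b m) (sym (size-trues S)))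
    by-size : ∀ b → Size b → n′ ^ (b ∸ 1) ≤ 2 ^ (if ⌊ b ℕ.≟ 3 ⌋ then 1 else 0) * #comps b m
    by-size .1 point    = ℕ.≤-reflexive (sym (trans (ℕ.*-identityˡ (#comps 1 m)) (#comps-1 m)))
    by-size .2 segment  = ℕ.≤-trans (ℕ.≤-reflexive (ℕ.*-identityʳ n′)) (ℕ.≤-trans (ℕ.m≤n⇒m≤1+n n′≤m)
                            (ℕ.≤-reflexive (sym (trans (ℕ.*-identityˡ (#comps 2 m)) (#comps-2 m)))))
    by-size .3 triangle = ℕ.≤-trans (ℕ.*-mono-≤ (ℕ.m≤n⇒m≤1+n n′≤m)
                            (ℕ.≤-trans (ℕ.≤-reflexive (ℕ.*-identityʳ n′)) (ℕ.m≤n⇒m≤1+n (ℕ.m≤n⇒m≤1+n n′≤m))))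
                            (ℕ.≤-reflexive (sym (#comps-3 m)))
    factor : n′ ^ (size S ∸ 1) ≤ 2 ^ t * length B
    factor = subst (λ l → n′ ^ (size S ∸ 1) ≤ 2 ^ t * l) (sym length-B) (by-size (size S) (sizeOf S c≤2 1≤))

-- From rational hull coefficients to integers

/-cross : ∀ a q b r .{{_ : NonZero q}} .{{_ : NonZero r}} → (+ a) / q ≡ (+ b) / r → a * r ≡ b * q
/-cross a (suc q) b (suc r) eq with ℚ./-injective-≃ (ℚᵘ.mkℚᵘ (+ a) q) (ℚᵘ.mkℚᵘ (+ b) r) eq
... | ℚᵘ.*≡* e = ℤ.+-injective (trans (ℤ.pos-* a (suc r)) (trans e (sym (ℤ.pos-* b (suc q)))))

/-cross⁻ : ∀ a q b r .{{_ : NonZero q}} .{{_ : NonZero r}} → a * r ≡ b * q → (+ a) / q ≡ (+ b) / r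
/-cross⁻ a (suc q) b (suc r) eq = ℚ.fromℚᵘ-cong {ℚᵘ.mkℚᵘ (+ a) q} {ℚᵘ.mkℚᵘ (+ b) r}
  (ℚᵘ.*≡* (trans (sym (ℤ.pos-* a (suc r))) (trans (cong +_ eq) (ℤ.pos-* b (suc q)))))

/-mono-≤ : ∀ a q b r .{{_ : NonZero q}} .{{_ : NonZero r}} → a * r ≤ b * q → (+ a) / q ≤ℚ (+ b) / r
/-mono-≤ a (suc q) b (suc r) le = ℚ.toℚᵘ-cancel-≤
  (ℚᵘ.≤-respˡ-≃ (ℚᵘ.≃-sym (ℚ.toℚᵘ-fromℚᵘ (ℚᵘ.mkℚᵘ (+ a) q)))
  (ℚᵘ.≤-respʳ-≃ (ℚᵘ.≃-sym (ℚ.toℚᵘ-fromℚᵘ (ℚᵘ.mkℚᵘ (+ b) r)))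
    (ℚᵘ.*≤* (subst₂ ℤ._≤_ (ℤ.pos-* a (suc r)) (ℤ.pos-* b (suc q)) (ℤ.+≤+ le)))))

/-+ : ∀ a b q .{{_ : NonZero q}} → (+ a) / q ℚ.+ (+ b) / q ≡ (+ (a + b)) / q
/-+ a b (suc q) = ℚ.toℚᵘ-injective (begin
  ℚ.toℚᵘ ((+ a) / suc q ℚ.+ (+ b) / suc q)               ≈⟨ ℚ.toℚᵘ-homo-+ ((+ a) / suc q) ((+ b) / suc q) ⟩
  ℚ.toℚᵘ ((+ a) / suc q) ℚᵘ.+ ℚ.toℚᵘ ((+ b) / suc q)     ≈⟨ ℚᵘ.+-cong (ℚ.toℚᵘ-fromℚᵘ (ℚᵘ.mkℚᵘ (+ a) q)) (ℚ.toℚᵘ-fromℚᵘ (ℚᵘ.mkℚᵘ (+ b) q)) ⟩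
  ℚᵘ.mkℚᵘ (+ a) q ℚᵘ.+ ℚᵘ.mkℚᵘ (+ b) q                   ≈⟨ ℚᵘ.*≡* (ring (+ a) (+ b) (+ suc q)) ⟩
  ℚᵘ.mkℚᵘ (+ (a + b)) q                                  ≈⟨ ℚ.toℚᵘ-fromℚᵘ (ℚᵘ.mkℚᵘ (+ (a + b)) q) ⟨
  ℚ.toℚᵘ ((+ (a + b)) / suc q)                           ∎)
  where
  open import Relation.Binary.Reasoning.Setoid ℚᵘ.≃-setoid
  ring : ∀ a b q → (a ℤ.* q ℤ.+ b ℤ.* q) ℤ.* q ≡ (a ℤ.+ b) ℤ.* (q ℤ.* q)
  ring = solve-∀

0/ : ∀ q .{{_ : NonZero q}} → (+ 0) / q ≡ ℚ.0ℚ
0/ q = /-cross⁻ 0 q 0 1 refl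

nonneg-/ : ∀ p → ℚ.0ℚ ≤ℚ p → ∃₂ λ a d → p ≡ (+ a) / suc d
nonneg-/ p@(ℚ.mkℚ (+ a) d c) _ = a , d , sym (ℚ.↥p/↧p≡p p)
nonneg-/ p@(ℚ.mkℚ ℤ.-[1+ a ] d c) le with ℚ.nonNegative {p} le
... | ()

sumℚ-/ : ∀ {A : Set} q .{{_ : NonZero q}} (xs : List A) (f : A → ℕ) →
  sumℚ (map (λ x → (+ f x) / q) xs) ≡ (+ ∑ₙ xs f) / q
sumℚ-/ q []       f = sym (0/ q)
sumℚ-/ q (x ∷ xs) f = trans (cong (ℚ._+_ ((+ f x) / q)) (sumℚ-/ q xs f)) (/-+ (f x) (∑ₙ xs f) q)

common-denominator : ∀ ps → All (λ a → ℚ.0ℚ ≤ℚ a) ps → ∃₂ λ q bs → ps ≡ map (λ b → (+ b) / suc q) bs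
common-denominator []       []         = 0 , [] , refl
common-denominator (p ∷ ps) (le ∷ les) with nonneg-/ p le | common-denominator ps les
... | a , d , refl | q , bs , refl =
  q + d * suc q , a * suc q ∷ map (_* suc d) bs ,
  cong₂ _∷_ (/-cross⁻ a (suc d) (a * suc q) (suc d * suc q) (ring₁ a (suc d) (suc q)))
    (trans (List.map-cong (λ b → /-cross⁻ b (suc q) (b * suc d) (suc d * suc q) (ring₂ b (suc d) (suc q))) bs) (List.map-∘ bs))
  where
  ring₁ : ∀ a d q → a * (d * q) ≡ a * q * d
  ring₁ = ℕ-Ring.solve-∀
  ring₂ : ∀ b d q → b * (d * q) ≡ b * d * q
  ring₂ = ℕ-Ring.solve-∀

vcoord-hit : ∀ {ds} (v : Vertex ds) x → vcoord v x ≡ (if hit x v then ℚ.1ℚ else ℚ.0ℚ)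
vcoord-hit {c ∷ cs} (i , w) (inj₁ j) = refl
vcoord-hit {c ∷ cs} (i , w) (inj₂ x) = vcoord-hit w x

combination-/ : ∀ {ds} q .{{_ : NonZero q}} (σ : List (Vertex ds)) (b : Vertex ds → ℕ) x →
  sumℚ (zipWith (λ a w → a ℚ.* vcoord w x) (map (λ v → (+ b v) / q) σ) σ) ≡ (+ ∑ₙ (sel (hit x) σ) b) / q
combination-/ q []      b x = sym (0/ q)
combination-/ q (v ∷ σ) b x rewrite vcoord-hit v x with hit x v
... | true  = trans (cong₂ ℚ._+_ (ℚ.*-identityʳ ((+ b v) / q)) (combination-/ q σ b x)) (/-+ (b v) (∑ₙ (sel (hit x) σ) b) q)
... | false = trans (cong₂ ℚ._+_ (ℚ.*-zeroʳ ((+ b v) / q)) (combination-/ q σ b x)) (ℚ.+-identityˡ _)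

rescale : ∀ {ds} n .{{_ : NonZero n}} → Grid ds → Point ds
rescale n y x = (+ entry y x) / n

rescale-InP : ∀ {ds} n .{{_ : NonZero n}} (y : Grid ds) → Balanced n y → InP (rescale n y)
rescale-InP {[]}     n y       bal         = tt
rescale-InP {c ∷ cs} n (u , y) (eq , bal) =
  (λ j → subst (_≤ℚ (+ Vec.lookup u j) / n) (0/ n) (/-mono-≤ 0 n (Vec.lookup u j) n z≤n)) ,
  trans (sumℚ-/ n (allFin (suc c)) (Vec.lookup u))
    (/-cross⁻ (∑ₙ (allFin (suc c)) (Vec.lookup u)) n 1 1 (trans (ℕ.*-identityʳ _)
      (trans (∑-lookup u (Vec.lookup u) id (λ _ → refl)) (trans eq (sym (ℕ.*-identityˡ n)))))) ,
  rescale-InP n y bal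
  where
  ∑-lookup : ∀ {A : Set} {k} (u : Vec ℕ k) (g : A → ℕ) (h : Fin k → A) → (∀ i → g (h i) ≡ Vec.lookup u i) →
    ∑ₙ (tabulate h) g ≡ Vec.sum u
  ∑-lookup []      g h eq = refl
  ∑-lookup (a ∷ u) g h eq = cong₂ _+_ (eq Fin.zero) (∑-lookup u g (h ∘ Fin.suc) (eq ∘ Fin.suc))

-- The common denominator `suc q` is not controlled here; Cramer's rule replaces it by the class
-- later.
InHull-integers : ∀ {ds} n .{{_ : NonZero n}} (y : Grid ds) σ → Unique σ → InHull σ (rescale n y) →
  ∃₂ λ q (b : Vertex ds → ℕ) → ∑ₙ σ b ≡ suc q × (∀ x → n * ∑ₙ (sel (hit x) σ) b ≡ suc q * entry y x)
InHull-integers n y σ uσ (ps , len , pos , total , coords) with common-denominator ps pos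
... | q , bs , refl with assign 0 σ bs uσ (trans (sym (List.length-map _ bs)) len)
... | b , refl , _ = q , b ,
  trans (sym (ℕ.*-identityʳ _)) (trans (/-cross (∑ₙ σ b) (suc q) 1 1
    (trans (sym (sumℚ-/ (suc q) σ b)) (trans (cong sumℚ (List.map-∘ σ)) total))) (ℕ.*-identityˡ (suc q))) ,
  λ x → trans (ℕ.*-comm n _) (trans (sym (/-cross (entry y x) n (∑ₙ (sel (hit x) σ) b) (suc q)
    (trans (coords x) (trans (cong (λ l → sumℚ (zipWith (λ a w → a ℚ.* vcoord w x) l σ)) (sym (List.map-∘ σ)))
      (combination-/ (suc q) σ b x))))) (ℕ.*-comm (entry y x) (suc q)))

∑ₙ-cong : ∀ {A : Set} (xs : List A) {f g : A → ℕ} → (∀ {a} → a ∈ xs → f a ≡ g a) → ∑ₙ xs f ≡ ∑ₙ xs g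
∑ₙ-cong []       eq = refl
∑ₙ-cong (x ∷ xs) eq = cong₂ _+_ (eq (here refl)) (∑ₙ-cong xs (eq ∘ there))

∑ₙ-*ˡ : ∀ {A : Set} c (xs : List A) (f : A → ℕ) → ∑ₙ xs (λ a → c * f a) ≡ c * ∑ₙ xs f
∑ₙ-*ˡ c []       f = sym (ℕ.*-zeroʳ c)
∑ₙ-*ˡ c (x ∷ xs) f = trans (cong (ℕ._+_ (c * f x)) (∑ₙ-*ˡ c xs f)) (sym (ℕ.*-distribˡ-+ c (f x) (∑ₙ xs f)))

≤-∑ₙ : ∀ {A : Set} {xs : List A} (f : A → ℕ) {a} → a ∈ xs → f a ≤ ∑ₙ xs f
≤-∑ₙ f (here refl) = ℕ.m≤m+n _ _
≤-∑ₙ f (there p)   = ℕ.≤-trans (≤-∑ₙ f p) (ℕ.m≤n+m _ _)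

∑ₙ-same : ∀ {ds} (σ α : List (Vertex ds)) (f : Vertex ds → ℕ) → Unique σ → Unique α →
  (∀ {v} → v ∈ α → v ∈ σ) → (∀ {v} → v ∈ σ → v ∈ α) → ∑ₙ σ f ≡ ∑ₙ α f
∑ₙ-same σ α f uσ uα α⊆σ σ⊆α = ℤ.+-injective (trans (sym (∑-pos σ f)) (trans
  (∑-⊆ σ α (λ v → + f v) uσ uα α⊆σ (λ v∈ v∉ → contradiction (σ⊆α v∈) v∉)) (∑-pos α f)))

∈-choose-∷ : ∀ {A : Set} k {x : A} {xs ys} → ys ∈ choose k xs → ys ∈ choose k (x ∷ xs)
∈-choose-∷ zero    p = p
∈-choose-∷ (suc k) {x} {xs} p = ∈.∈-++⁺ʳ (map (x ∷_) (choose k xs)) p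

-- Filtering keeps the order, as `choose` does. This places reordered simplices and their exterior
-- faces in the lists that `F` and `extCount` range over.
filter-∈-choose : ∀ {A : Set} {P : A → Set} (P? : ∀ a → Dec (P a)) xs → filter P? xs ∈ choose (length (filter P? xs)) xs
filter-∈-choose P? []       = here refl
filter-∈-choose P? (x ∷ xs) with P? x
... | yes _ = ∈.∈-++⁺ˡ (∈.∈-map⁺ (x ∷_) (filter-∈-choose P? xs))
... | no _  = ∈-choose-∷ (length (filter P? xs)) (filter-∈-choose P? xs)

-- Lattice points in a simplex

module Canonical {ds} (σ : List (Vertex ds)) (full : IsFullSimplex σ) where

  -- The simplex in the order of `allVertices`, the only order that `F` considers.
  α : List (Vertex ds)
  α = filter (_∈ᵥ? σ) (allVertices ds)

  uσ : Unique σ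
  uσ = proj₁ (proj₂ full)

  uα : Unique α
  uα = Unique.filter⁺ (_∈ᵥ? σ) (allVertices-unique ds)

  α⊆σ : ∀ {v} → v ∈ α → v ∈ σ
  α⊆σ v∈ = proj₂ (∈.∈-filter⁻ (_∈ᵥ? σ) {xs = allVertices ds} v∈)

  σ⊆α : ∀ {v} → v ∈ σ → v ∈ α
  σ⊆α v∈ = ∈.∈-filter⁺ (_∈ᵥ? σ) (∈-allVertices _) v∈

  length-σ : length σ ≡ suc (rdim (fullFace ds))
  length-σ = trans (proj₁ full) (cong suc (sym (rdim-fullFace ds)))

  length-α : length α ≡ suc (dimOf ds)
  length-α = trans (ℕ.≤-antisym (length-≤ _≡_ α σ uα (λ v∈ → _ , α⊆σ v∈ , refl) (λ { refl refl → refl }))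
                                (length-≤ _≡_ σ α uσ (λ v∈ → _ , σ⊆α v∈ , refl) (λ { refl refl → refl }))) (proj₁ full)

  length-α′ : length α ≡ suc (rdim (fullFace ds))
  length-α′ = trans length-α (cong suc (sym (rdim-fullFace ds)))

  D : ℕ
  D = ∣ detOf (fullFace ds) α ∣

  -- Invariance under reordering of the rows, obtained by counting solutions instead of tracking
  -- signs of permutations.
  D≡class : D ≡ classOf σ
  D≡class = trans (sym (class-⊑ (fullFace ds) (fullFace ds) σ α
    (record { unique-big = uσ ; unique-small = uα ; subset = α⊆σ
            ; integral-off = λ _ _ _ v∈ v∉ → contradiction (σ⊆α v∈) v∉ })
    length-σ length-α′ (λ {v} _ → inFace-fullFace {ds} v) (λ {v} _ → inFace-fullFace {ds} v)
    (λ eq → proj₂ (proj₂ full) (trans (classIn-detOf (fullFace ds) σ) (cong ∣_∣ eq)))))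
    (sym (classIn-detOf (fullFace ds) σ))

  classOf-α : classOf α ≡ D
  classOf-α = classIn-detOf (fullFace ds) α

  D≢0 : D ≢ 0
  D≢0 eq = proj₂ (proj₂ full) (trans (sym D≡class) eq)

  instance
    D-nonZero : NonZero D
    D-nonZero = ℕ.≢-nonZero D≢0

  det≢0 : detOf (fullFace ds) α ≢ + 0
  det≢0 eq = D≢0 (cong ∣_∣ eq)

  α∈choose : α ∈ choose (suc (dimOf ds)) (allVertices ds)
  α∈choose = subst (λ k → α ∈ choose k (allVertices ds)) length-α (filter-∈-choose (_∈ᵥ? σ) (allVertices ds))

  record Coefficients (n : ℕ) (y : Grid ds) (f : Vertex ds → ℕ) : Set where
    field
      total  : ∑ₙ α f ≡ D * n
      coords : ∀ x → ∑ₙ (sel (hit x) α) f ≡ D * entry y x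

  -- n times the barycentric coordinates of a lattice point of n P, with denominator D by Cramer's rule.
  coefficients : ∀ n .{{_ : NonZero n}} y → InHull σ (rescale n y) → ∃ λ f → Coefficients n y f
  coefficients n y hull with InHull-integers n y σ uσ hull
  ... | q , b , totalσ , coordsσ = f , record
    { total  = ℕ.*-cancelˡ-≡ _ _ (suc q) (trans (f-sum α id) (trans (cong (n * D *_) totalα) (ring₁ n D (suc q))))
    ; coords = λ x → ℕ.*-cancelˡ-≡ _ _ (suc q) (trans (f-sum (sel (hit x) α) (proj₁ ∘ ∈-sel⁻ (hit x))) (trans (ring₂ n D _)
        (trans (cong (D *_) (coordsα x)) (ring₃ D (suc q) (entry y x))))) }
    where
    ring₁ : ∀ n d q → n * d * q ≡ q * (d * n)
    ring₁ = ℕ-Ring.solve-∀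
    ring₂ : ∀ n d s → n * d * s ≡ d * (n * s)
    ring₂ = ℕ-Ring.solve-∀
    ring₃ : ∀ d q e → d * (q * e) ≡ q * (d * e)
    ring₃ = ℕ-Ring.solve-∀
    totalα : ∑ₙ α b ≡ suc q
    totalα = trans (sym (∑ₙ-same σ α b uσ uα α⊆σ σ⊆α)) totalσ
    coordsα : ∀ x → n * ∑ₙ (sel (hit x) α) b ≡ suc q * entry y x
    coordsα x = trans (cong (n *_) (sym (∑ₙ-same (sel (hit x) σ) (sel (hit x) α) b (sel-unique (hit x) uσ) (sel-unique (hit x) uα)
      (λ v∈ → ∈-sel⁺ (hit x) (α⊆σ (proj₁ (∈-sel⁻ (hit x) v∈))) (proj₂ (∈-sel⁻ (hit x) {α} v∈)))
      (λ v∈ → ∈-sel⁺ (hit x) (σ⊆α (proj₁ (∈-sel⁻ (hit x) v∈))) (proj₂ (∈-sel⁻ (hit x) {σ} v∈)))))) (coordsσ x)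
    -- The sums of `a` over α and over each coordinate are multiples of `D (q + 1)`. By Cramer's
    -- rule with this modulus, `q + 1` divides each value of `a` on α, so there the quotient `f` is
    -- exact.
    a f : Vertex ds → ℕ
    a v = n * D * b v
    f v = a v ℕ./ suc q
    a-sum : ∀ xs → ∑ xs (λ v → + a v) ≡ + (n * D * ∑ₙ xs b)
    a-sum xs = trans (∑-pos xs a) (cong +_ (∑ₙ-*ˡ (n * D) xs b))
    integral : Integral (+ D ℤ.* + suc q) (λ v → + a v) α
    integral = divides (+ n) (trans (a-sum α) (trans (cong +_ (trans (cong (n * D *_) totalα) (ℕ.*-assoc n D (suc q))))
                 (trans (ℤ.pos-* n (D * suc q)) (cong (+ n ℤ.*_) (ℤ.pos-* D (suc q)))))) ,
      λ x → divides (+ entry y x) (trans (a-sum (sel (hit x) α)) (trans (cong +_ (trans (ring₂ n D _)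
        (trans (cong (D *_) (coordsα x)) (ring₄ D (suc q) (entry y x)))))
        (trans (ℤ.pos-* (entry y x) (D * suc q)) (cong (+ entry y x ℤ.*_) (ℤ.pos-* D (suc q))))))
      where
      ring₄ : ∀ d q e → d * (q * e) ≡ e * (d * q)
      ring₄ = ℕ-Ring.solve-∀
    q∣a : ∀ {v} → v ∈ α → suc q ℕ∣.∣ a v
    q∣a v∈ = ℤ∣.∣⇒∣ᵤ (All.lookup (Sol-∣∣ (length α) (matrix (fullFace ds) α) (matrix-shape (fullFace ds) α refl length-α′)
      det≢0 (+ D ℤ.* + suc q) (+ suc q) refl (map (λ v → + a v) α) (List.length-map (λ v → + a v) α)
      (Integral⇒Sol (fullFace ds) α (λ v → + a v) (+ D ℤ.* + suc q) integral)) (∈.∈-map⁺ (λ v → + a v) v∈))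
    f-sum : ∀ xs → (∀ {v} → v ∈ xs → v ∈ α) → suc q * ∑ₙ xs f ≡ n * D * ∑ₙ xs b
    f-sum xs xs⊆ = trans (sym (∑ₙ-*ˡ (suc q) xs f)) (trans (∑ₙ-cong xs (λ v∈ → ℕ.m*[n/m]≡n (q∣a (xs⊆ v∈)))) (∑ₙ-*ˡ (n * D) xs b))

∈-holes⁻ : ∀ {X : Set} {n} (S : Vec Bool n) (ι : Fin n → X) {z} → z ∈ holes S ι → ∃ λ j → z ≡ ι j × Vec.lookup S j ≡ false
∈-holes⁻ (true ∷ S)  ι z∈          = let (j , eq , h) = ∈-holes⁻ S (ι ∘ Fin.suc) z∈ in Fin.suc j , eq , h
∈-holes⁻ (false ∷ S) ι (here refl) = Fin.zero , refl , refl
∈-holes⁻ (false ∷ S) ι (there z∈)  = let (j , eq , h) = ∈-holes⁻ S (ι ∘ Fin.suc) z∈ in Fin.suc j , eq , h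

∈-transversal⁻ : ∀ {X : Set} {ds} (G : Face ds) (ι : Coord ds → X) {z} → z ∈ transversal G ι → ∃ λ x → z ≡ ι x × coordIn G x ≡ false
∈-transversal⁻ {ds = c ∷ cs} (S , G) ι z∈ with ∈.∈-++⁻ (holes S (ι ∘ inj₁)) z∈
... | inj₁ p = let (j , eq , h) = ∈-holes⁻ S (ι ∘ inj₁) p in inj₁ j , eq , h
... | inj₂ p = let (x , eq , h) = ∈-transversal⁻ G (ι ∘ inj₂) p in inj₂ x , eq , h

Spans : ∀ {ds} → Face ds → List (Vertex ds) → Set
Spans G W = ∀ x → coordIn G x ≡ true → ∃ λ v → v ∈ W × T (hit x v)

hit-coordIn : ∀ {ds} (G : Face ds) v x → T (inFace G v) → T (hit x v) → coordIn G x ≡ true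
hit-coordIn {c ∷ cs} (S , G) (i , w) (inj₁ j) inG h with i Fin.≟ j
... | yes refl with Vec.lookup S i
... | true = refl
hit-coordIn {c ∷ cs} (S , G) (i , w) (inj₂ x) inG h = hit-coordIn G w x (proj₂ (inFace-∷ {S = S} {G} {i , w} inG)) h

Face-ext : ∀ {ds} (G H : Face ds) → (∀ x → coordIn G x ≡ coordIn H x) → G ≡ H
Face-ext {[]}     tt      tt      eq = refl
Face-ext {c ∷ cs} (S , G) (R , H) eq = cong₂ _,_ (Vec-ext S R (eq ∘ inj₁)) (Face-ext G H (eq ∘ inj₂))
  where
  Vec-ext : ∀ {n} (S R : Vec Bool n) → (∀ j → Vec.lookup S j ≡ Vec.lookup R j) → S ≡ R
  Vec-ext []      []      eq = refl
  Vec-ext (a ∷ S) (b ∷ R) eq = cong₂ _∷_ (eq Fin.zero) (Vec-ext S R (eq ∘ Fin.suc))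

-- In each factor the set of the face is exactly the set of positions that W meets. A code that
-- records W therefore need not record the face.
Spans-determines : ∀ {ds} (G H : Face ds) W → (∀ {v} → v ∈ W → T (inFace G v)) → (∀ {v} → v ∈ W → T (inFace H v)) →
  Spans G W → Spans H W → G ≡ H
Spans-determines G H W W⊆G W⊆H sG sH = Face-ext G H agree
  where
  agree : ∀ x → coordIn G x ≡ coordIn H x
  agree x with coordIn G x in eqG | coordIn H x in eqH
  ... | true  | true  = refl
  ... | false | false = refl
  ... | true  | false = let (v , v∈ , h) = sG x eqG in trans (sym (hit-coordIn H v x (W⊆H v∈) h)) eqH
  ... | false | true  = let (v , v∈ , h) = sH x eqH in trans (sym eqG) (hit-coordIn G v x (W⊆G v∈) h)

module PerSimplex {ds} (σ : List (Vertex ds)) (full : IsFullSimplex σ) (n′ : ℕ) where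

  open Canonical σ full public

  K n : ℕ
  K = 2 ^ ncoords ds
  n = n′ + 4 * K

  w : Coord ds → ℕ
  w = weight 0

  transv : Face ds → List (Coord ds)
  transv G = transversal G id

  inner outer : Face ds → List (Vertex ds)
  inner G = sel (inFace G) α
  outer G = sel (not ∘ inFace G) α

  Y : Face ds → List (Grid ds)
  Y G = grid K n G w id

  instance
    K-nonZero : NonZero K
    K-nonZero = m^n≢0 2 (ncoords ds)

  K≤n : K ≤ n
  K≤n = ℕ.≤-trans (ℕ.m≤m+n K (3 * K)) (ℕ.m≤n+m (4 * K) n′)

  module AtFace (G : Face ds) (ne : Nonempty G) where

    none≡inFace : ∀ v → none hit (transv G) v ≡ inFace G v
    none≡inFace v = none-transversal hit G id v v (λ _ → refl)

    chain = transversal-Chain w G id 0 0 (λ _ → refl) (s≤s z≤n)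

    size-α : length α ≡ suc (length (transv G) + rdim G)
    size-α = trans length-α (cong suc (sym (length-transversal G id ne)))

    module AtPoint {y} (y∈ : y ∈ Y G) {f} (coeff : Coefficients n y f) where

      open Coefficients coeff

      transv-sum : ∀ {x} → x ∈ transv G → ∑ₙ (sel (hit x) α) f ≡ D * w x
      transv-sum x∈ with ∈-transversal⁻ G id x∈
      ... | x , refl , x∉G = trans (coords x) (cong (D *_) (grid-hole K n G w id y∈ x x∉G))

      -- Every outer vertex meets a coordinate that vanishes on G, and over each of these the
      -- coefficients sum to D times a fixed power of two.
      outer-small : ∑ₙ (outer G) f < D * K
      outer-small = begin-strict
        ∑ₙ (outer G) f                                         ≡⟨ cong (λ l → ∑ₙ l f) (sel-cong (λ v → cong not (sym (none≡inFace v))) α) ⟩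
        ∑ₙ (sel (not ∘ none hit (transv G)) α) f               ≤⟨ hit-sum-≤ hit (transv G) α f ⟩
        ∑ₙ (transv G) (λ x → ∑ₙ (sel (hit x) α) f)             ≡⟨ ∑ₙ-cong (transv G) transv-sum ⟩
        ∑ₙ (transv G) (λ x → D * w x)                          ≡⟨ ∑ₙ-*ˡ D (transv G) w ⟩
        D * ∑ₙ (transv G) w                                    <⟨ ℕ.*-monoʳ-< D (proj₂ chain) ⟩
        D * K                                                  ∎
        where open ℕ.≤-Reasoning

      -- `Peel-count` starts with slack 0, as the sums off G are known exactly. Of the N + 1
      -- vertices at least one is used up by each of the `N − rdim G` coordinates off G.
      dichotomy : (length (inner G) ≤ rdim G) ⊎ (Peel hit (transv G) α × length (inner G) ≡ suc (rdim G))
      dichotomy with Peel-count hit (transv G) α f (λ x → D * w x) 0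
        (subst (λ u → Chain (λ x → D * w x) u (transv G)) (ℕ.*-zeroʳ D) (Chain-scale D w 0 (transv G) (proj₁ chain)))
        (λ x∈ → ℕ.≤-reflexive (trans (sym (transv-sum x∈)) (sym (ℕ.+-identityʳ _))))
        (λ x∈ → ℕ.≤-reflexive (transv-sum x∈))
      ... | inj₁ lt = inj₁ (ℕ.+-cancelˡ-≤ (length (transv G)) _ _ (ℕ.≤-pred (subst₂ _<_
              (cong (λ l → length (transv G) + length l) (sel-cong none≡inFace α)) size-α lt)))
      ... | inj₂ (pl , eq) = inj₂ (pl , ℕ.+-cancelˡ-≡ (length (transv G)) _ _
              (trans (cong (λ l → length (transv G) + length l) (sym (sel-cong none≡inFace α))) (trans eq (trans size-α (sym (ℕ.+-suc _ _))))))

      -- The vertices outside G carry too little weight to account for D K.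
      inner-pos : ∀ p → D * K ≤ ∑ₙ (sel p α) f → ∃ λ v → v ∈ inner G × T (p v)
      inner-pos p DK≤ with sel p (inner G) in eq
      ... | v ∷ _ = v , ∈-sel⁻ p (subst (v ∈_) (sym eq) (here refl))
      ... | [] = contradiction DK≤ (ℕ.<⇒≱ (begin-strict
        ∑ₙ (sel p α) f                                                ≡⟨ ∑ₙ-split (inFace G) (sel p α) f ⟩
        ∑ₙ (sel (inFace G) (sel p α)) f + ∑ₙ (sel (not ∘ inFace G) (sel p α)) f
          ≡⟨ cong₂ (λ a b → ∑ₙ a f + ∑ₙ b f) (sel-comm p (inFace G) α) (sel-comm p (not ∘ inFace G) α) ⟩
        ∑ₙ (sel p (inner G)) f + ∑ₙ (sel p (outer G)) f               ≡⟨ cong (λ l → ∑ₙ l f + ∑ₙ (sel p (outer G)) f) eq ⟩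
        ∑ₙ (sel p (outer G)) f                                        ≤⟨ ∑ₙ-sel-≤ p (outer G) f ⟩
        ∑ₙ (outer G) f                                                <⟨ outer-small ⟩
        D * K                                                         ∎))
        where open ℕ.≤-Reasoning

      inner-spans : Spans G (inner G)
      inner-spans x x∈G = inner-pos (hit x)
        (ℕ.≤-trans (ℕ.*-monoʳ-≤ D (grid-large K n G w id y∈ x x∈G)) (ℕ.≤-reflexive (sym (coords x))))

      inner-nonempty : 1 ≤ length (inner G)
      inner-nonempty = ∈.∈-length (proj₁ (proj₂ (inner-pos (λ _ → true)
        (ℕ.≤-trans (ℕ.*-monoʳ-≤ D K≤n) (ℕ.≤-reflexive (sym (trans (cong (λ l → ∑ₙ l f) (sel-true α)) total)))))))
        where
        sel-true : ∀ xs → sel (λ _ → true) xs ≡ xs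
        sel-true []       = refl
        sel-true (x ∷ xs) = cong (x ∷_) (sel-true xs)

      f/D≤n : ∀ {v} → v ∈ α → f v ℕ./ D ≤ n
      f/D≤n v∈ = ℕ.≤-trans (ℕ./-monoˡ-≤ D (ℕ.≤-trans (≤-∑ₙ f v∈) (ℕ.≤-reflexive (trans total (ℕ.*-comm D n)))))
        (ℕ.≤-reflexive (ℕ.m*n/n≡m n D))

      f/D<K : ∀ {v} → v ∈ outer G → f v ℕ./ D < K
      f/D<K v∈ = ℕ.m<n*o⇒m/o<n (ℕ.≤-<-trans (≤-∑ₙ f v∈) (ℕ.<-≤-trans outer-small (ℕ.≤-reflexive (ℕ.*-comm D K))))

      inner-/D≤n : ∑ₙ (tail' (inner G)) (λ v → f v ℕ./ D) ≤ n
      inner-/D≤n = ℕ.*-cancelˡ-≤ D (begin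
        D * ∑ₙ (tail' (inner G)) (λ v → f v ℕ./ D)    ≡⟨ ∑ₙ-*ˡ D (tail' (inner G)) _ ⟨
        ∑ₙ (tail' (inner G)) (λ v → D * (f v ℕ./ D))  ≤⟨ ∑ₙ-mono (tail' (inner G)) (λ v → ℕ.≤-trans (ℕ.≤-reflexive (ℕ.*-comm D (f v ℕ./ D))) (ℕ.m/n*n≤m (f v) D)) ⟩
        ∑ₙ (tail' (inner G)) f                        ≤⟨ ∑ₙ-tail (inner G) ⟩
        ∑ₙ (inner G) f                                ≤⟨ ∑ₙ-sel-≤ (inFace G) α f ⟩
        ∑ₙ α f                                        ≡⟨ total ⟩
        D * n                                         ∎)
        where
        open ℕ.≤-Reasoning
        ∑ₙ-mono : ∀ {A : Set} (xs : List A) {f g : A → ℕ} → (∀ a → f a ≤ g a) → ∑ₙ xs f ≤ ∑ₙ xs g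
        ∑ₙ-mono []       le = z≤n
        ∑ₙ-mono (x ∷ xs) le = ℕ.+-mono-≤ (le x) (∑ₙ-mono xs le)
        ∑ₙ-tail : ∀ xs → ∑ₙ (tail' xs) f ≤ ∑ₙ xs f
        ∑ₙ-tail []       = z≤n
        ∑ₙ-tail (x ∷ xs) = ℕ.m≤n+m _ _

      remainders : List ℕ
      remainders = map (λ v → f v ℕ.% D) α

      -- The coefficients differ from their remainders by multiples of D, and their sums are
      -- multiples of D. So the remainders form one of exactly D vectors.
      remainders-reduced : Reduced (length α) D (matrix (fullFace ds) α) remainders
      remainders-reduced = List.length-map _ α , All.map⁺ (All.universal (λ v → ℕ.m%n<n (f v) D) α) ,
        subst (λ l → Sol (+ D) l (matrix (fullFace ds) α)) (List.map-∘ α)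
          (Integral⇒Sol (fullFace ds) α (λ v → + (f v ℕ.% D)) (+ D)
            (reduce α total , λ x → reduce (sel (hit x) α) (coords x)))
        where
        reduce : ∀ xs {s} → ∑ₙ xs f ≡ D * s → + D ∣ℤ ∑ xs (λ v → + (f v ℕ.% D))
        reduce xs {s} eq = ℤ∣.∣ᵤ⇒∣ (subst (D ℕ∣.∣_) (cong ∣_∣ (sym (∑-pos xs (λ v → f v ℕ.% D))))
          (ℕ∣.∣m+n∣m⇒∣n (subst (D ℕ∣.∣_) (trans (sym eq) (split xs)) (ℕ∣.m∣m*n s))
            (ℕ∣.m∣m*n (∑ₙ xs (λ v → f v ℕ./ D)))))
          where
          ring : ∀ a b c d e → a + b * c + (c * e + d) ≡ c * (b + e) + (a + d)
          ring = ℕ-Ring.solve-∀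
          split : ∀ xs → ∑ₙ xs f ≡ D * ∑ₙ xs (λ v → f v ℕ./ D) + ∑ₙ xs (λ v → f v ℕ.% D)
          split []       = sym (trans (ℕ.+-identityʳ _) (ℕ.*-zeroʳ D))
          split (x ∷ xs) = trans (cong₂ _+_ (ℕ.m≡m%n+[m/n]*n (f x) D) (split xs))
            (ring (f x ℕ.% D) (f x ℕ./ D) D (∑ₙ xs (λ v → f v ℕ.% D)) (∑ₙ xs (λ v → f v ℕ./ D)))

    inner⊆G : ∀ {v} → v ∈ inner G → T (inFace G v)
    inner⊆G v∈ = proj₂ (∈-sel⁻ (inFace G) {α} v∈)

    ∉inner : ∀ {v} → v ∈ α → v ∉ inner G → ¬ T (none hit (transv G) v)
    ∉inner {v} v∈ v∉ t = v∉ (∈-sel⁺ (inFace G) v∈ (subst T (none≡inFace v) t))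

    inner⊑α : Peel hit (transv G) α → inner G ⊑ α
    inner⊑α pl = record
      { unique-big = uα ; unique-small = sel-unique (inFace G) uα ; subset = proj₁ ∘ ∈-sel⁻ (inFace G)
      ; integral-off = λ { m d (_ , int) v∈ v∉ → Peel-∣ hit pl m d (λ {x} _ → int x) v∈ (∉inner v∈ v∉) } }

    class-inner : Peel hit (transv G) α → length (inner G) ≡ suc (rdim G) → classIn G (inner G) ≡ D
    class-inner pl len = trans (classIn-detOf G (inner G)) (sym (class-⊑ (fullFace ds) G α (inner G) (inner⊑α pl)
      length-α′ len (λ {v} _ → inFace-fullFace {ds} v) inner⊆G det≢0))

    module Determined {y y′ f f′} (c : Coefficients n y f) (c′ : Coefficients n y′ f′)
      (same-outer : ∀ {v} → v ∈ outer G → f v ≡ f′ v) (same-tail : ∀ {v} → v ∈ tail' (inner G) → f v ≡ f′ v) where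

      private
        module C  = Coefficients c
        module C′ = Coefficients c′

      same-inner-sum : ∑ₙ (inner G) f ≡ ∑ₙ (inner G) f′
      same-inner-sum = ℕ.+-cancelʳ-≡ (∑ₙ (outer G) f) _ _ (begin
        ∑ₙ (inner G) f + ∑ₙ (outer G) f     ≡⟨ ∑ₙ-split (inFace G) α f ⟨
        ∑ₙ α f                              ≡⟨ trans C.total (sym C′.total) ⟩
        ∑ₙ α f′                             ≡⟨ ∑ₙ-split (inFace G) α f′ ⟩
        ∑ₙ (inner G) f′ + ∑ₙ (outer G) f′   ≡⟨ cong (ℕ._+_ (∑ₙ (inner G) f′)) (∑ₙ-cong (outer G) same-outer) ⟨
        ∑ₙ (inner G) f′ + ∑ₙ (outer G) f    ∎)
        where open ≡-Reasoning

      same-inner : ∀ xs → ∑ₙ xs f ≡ ∑ₙ xs f′ → (∀ {v} → v ∈ tail' xs → f v ≡ f′ v) → ∀ {v} → v ∈ xs → f v ≡ f′ v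
      same-inner (x ∷ xs) eq tl (here refl) = ℕ.+-cancelʳ-≡ (∑ₙ xs f) _ _ (trans eq (cong (ℕ._+_ (f′ x)) (sym (∑ₙ-cong xs tl))))
      same-inner (x ∷ xs) eq tl (there v∈)  = tl v∈

      same : ∀ {v} → v ∈ α → f v ≡ f′ v
      same {v} v∈ with inFace G v in eq
      ... | true  = same-inner (inner G) same-inner-sum same-tail (∈-sel⁺ (inFace G) v∈ (subst T (sym eq) tt))
      ... | false = same-outer (∈-sel⁺ (not ∘ inFace G) v∈ (subst (T ∘ not) (sym eq) tt))

      -- The coefficient at the first inner vertex follows from the total `D n`; codes can therefore
      -- omit it.
      determined : y ≡ y′
      determined = Grid-ext y y′ (λ x → ℕ.*-cancelˡ-≡ _ _ D
        (trans (sym (C.coords x)) (trans (∑ₙ-cong (sel (hit x) α) (same ∘ proj₁ ∘ ∈-sel⁻ (hit x))) (C′.coords x))))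

    -- All points of `Y G` agree off G, so the difference of the two coefficient functions has sum 0
    -- over each coordinate there. Forward substitution with modulus 0 makes it vanish at the outer
    -- vertices.
    Peel-same-outer : Peel hit (transv G) α → ∀ {y y′ f f′} → y ∈ Y G → y′ ∈ Y G → Coefficients n y f → Coefficients n y′ f′ →
      ∀ {v} → v ∈ outer G → f v ≡ f′ v
    Peel-same-outer pl {f = f} {f′} y∈ y′∈ c c′ {v} v∈ = ℤ.+-injective (ℤ.i-j≡0⇒i≡j (+ f v) (+ f′ v) (ℤ∣.0∣⇒≡0
      (Peel-∣ hit pl (+ 0) (λ v → + f v ℤ.- + f′ v) balance (proj₁ v∈α) (λ t → inner-outer (subst T (none≡inFace v) t) (proj₂ v∈α)))))
      where
      v∈α : v ∈ α × T (not (inFace G v))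
      v∈α = ∈-sel⁻ (not ∘ inFace G) v∈
      inner-outer : ∀ {b} → T b → T (not b) → ⊥
      inner-outer {true} _ ()
      ∑-minus : ∀ xs → ∑ xs (λ v → + f v ℤ.- + f′ v) ≡ + ∑ₙ xs f ℤ.- + ∑ₙ xs f′
      ∑-minus []       = refl
      ∑-minus (x ∷ xs) = trans (cong (ℤ._+_ (+ f x ℤ.- + f′ x)) (∑-minus xs)) (ring (+ f x) (+ f′ x) (+ ∑ₙ xs f) (+ ∑ₙ xs f′))
        where
        ring : ∀ a b c d → (a ℤ.- b) ℤ.+ (c ℤ.- d) ≡ (a ℤ.+ c) ℤ.- (b ℤ.+ d)
        ring = solve-∀
      balance : ∀ {x} → x ∈ transv G → + 0 ∣ℤ ∑ (sel (hit x) α) (λ v → + f v ℤ.- + f′ v)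
      balance {x} x∈ = subst (+ 0 ∣ℤ_) (sym (trans (∑-minus (sel (hit x) α))
        (ℤ.i≡j⇒i-j≡0 (cong +_ (trans (AtPoint.transv-sum y∈ c x∈) (sym (AtPoint.transv-sum y′∈ c′ x∈))))))) ℤ∣.∣-refl

-- Counting by codes

boxes : ℕ → ℕ → List (List ℕ)
boxes zero    b = [] ∷ []
boxes (suc l) b = map (λ p → proj₁ p ∷ proj₂ p) (cartesianProduct (upTo b) (boxes l b))

length-boxes : ∀ l b → length (boxes l b) ≡ b ^ l
length-boxes zero    b = refl
length-boxes (suc l) b = trans (List.length-map _ (cartesianProduct (upTo b) (boxes l b)))
  (trans (length-product (upTo b) (boxes l b)) (cong₂ _*_ (List.length-upTo b) (length-boxes l b)))

∈-boxes : ∀ {l b q} → length q ≡ l → All (_< b) q → q ∈ boxes l b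
∈-boxes {zero}  {q = []}    _  _           = here refl
∈-boxes {suc l} {q = a ∷ q} eq (a<b ∷ all) =
  ∈.∈-map⁺ (λ p → proj₁ p ∷ proj₂ p) (∈.∈-cartesianProduct⁺ (∈.∈-upTo⁺ a<b) (∈-boxes (ℕ.suc-injective eq) all))

record Partition {P : Set} (A B : P → Set) (ps : List P) : Set where
  field
    left right   : List P
    length-parts : length ps ≡ length left + length right
    left-unique  : Unique left
    right-unique : Unique right
    left-ok      : ∀ {p} → p ∈ left → p ∈ ps × A p
    right-ok     : ∀ {p} → p ∈ right → p ∈ ps × B p

-- The proof of the disjunction chooses the side, so membership in a hull never has to be decided.
partition : ∀ {P : Set} {A B : P → Set} ps → Unique ps → (∀ {p} → p ∈ ps → A p ⊎ B p) → Partition A B ps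
partition []       u        f = record
  { left = [] ; right = [] ; length-parts = refl ; left-unique = [] ; right-unique = [] ; left-ok = λ () ; right-ok = λ () }
partition (p ∷ ps) (p∉ ∷ u) f with f (here refl)
... | inj₁ a = record
  { left = p ∷ left ; right = right ; length-parts = cong suc length-parts
  ; left-unique = All.tabulate (λ q∈ → All.lookup p∉ (proj₁ (left-ok q∈))) ∷ left-unique ; right-unique = right-unique
  ; left-ok = λ { (here refl) → here refl , a ; (there q∈) → let (q∈′ , aq) = left-ok q∈ in there q∈′ , aq }
  ; right-ok = λ q∈ → let (q∈′ , bq) = right-ok q∈ in there q∈′ , bq }
  where open Partition (partition ps u (f ∘ there))
... | inj₂ b = record
  { left = left ; right = p ∷ right ; length-parts = trans (cong suc length-parts) (sym (ℕ.+-suc _ _))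
  ; left-unique = left-unique ; right-unique = All.tabulate (λ q∈ → All.lookup p∉ (proj₁ (right-ok q∈))) ∷ right-unique
  ; left-ok = λ q∈ → let (q∈′ , aq) = left-ok q∈ in there q∈′ , aq
  ; right-ok = λ { (here refl) → here refl , b ; (there q∈) → let (q∈′ , bq) = right-ok q∈ in there q∈′ , bq } }
  where open Partition (partition ps u (f ∘ there))

-- Each point is charged only to the simplex named by its proof of being covered, so overlaps do no
-- harm.
cover-count : ∀ {P S : Set} (Rel : P → S → Set) s (bound : S → ℕ) cov →
  (∀ {σ} → σ ∈ cov → ∀ ps → Unique ps → (∀ {p} → p ∈ ps → Rel p σ) → s * length ps ≤ bound σ) →
  ∀ ps → Unique ps → (∀ {p} → p ∈ ps → Any.Any (Rel p) cov) → s * length ps ≤ ∑ₙ cov bound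
cover-count Rel s bound [] each []       u f = ℕ.≤-reflexive (ℕ.*-zeroʳ s)
cover-count Rel s bound [] each (p ∷ ps) u f with f (here refl)
... | ()
cover-count Rel s bound (σ ∷ cov) each ps u f = begin
  s * length ps                          ≡⟨ trans (cong (s *_) length-parts) (ℕ.*-distribˡ-+ s (length left) (length right)) ⟩
  s * length left + s * length right     ≤⟨ ℕ.+-mono-≤ (each (here refl) left left-unique (proj₂ ∘ left-ok))
                                              (cover-count Rel s bound cov (each ∘ there) right right-unique (proj₂ ∘ right-ok)) ⟩
  bound σ + ∑ₙ cov bound                 ∎
  where
  open ℕ.≤-Reasoning
  open Partition (partition ps u (Any.toSum ∘ f))

sum-map : ∀ {A : Set} (xs : List A) (f : A → ℕ) → sum (map f xs) ≡ ∑ₙ xs f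
sum-map []       f = refl
sum-map (x ∷ xs) f = cong (ℕ._+_ (f x)) (sum-map xs f)

module CountPairs {ds} (σ : List (Vertex ds)) (full : IsFullSimplex σ) (n′ k : ℕ)
  (Gs : List (Face ds)) (Gs-ok : ∀ {G} → G ∈ Gs → Nonempty G × rdim G ≡ k)
  (choices : List (List (Vertex ds)))
  (choices-ok : ∀ {G} → G ∈ Gs → length (sel (inFace G) (Canonical.α σ full)) ≡ suc k →
    classIn G (sel (inFace G) (Canonical.α σ full)) ≡ Canonical.D σ full → sel (inFace G) (Canonical.α σ full) ∈ choices)
  where

  open PerSimplex σ full n′

  -- All faces of one type are treated together, because the bound sought is in terms of the
  -- exterior faces of σ, whatever face of the simplotope they lie in.
  Pair : Set
  Pair = Face ds × Grid ds

  Covered : Pair → Set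
  Covered (G , y) = G ∈ Gs × y ∈ Y G × ∃ (Coefficients n y)

  abstract
    E : Enumerates (Reduced (length α) D (matrix (fullFace ds) α)) D
    E = enumerate-Sol (length α) (matrix (fullFace ds) α) (matrix-shape (fullFace ds) α refl length-α′) D 1 (sym (ℕ.*-identityʳ D))

  /%-injective : ∀ {a b} → a ℕ.% D ≡ b ℕ.% D → a ℕ./ D ≡ b ℕ./ D → a ≡ b
  /%-injective {a} {b} eq eq′ = trans (ℕ.m≡m%n+[m/n]*n a D) (trans (cong₂ (λ x y → x + y * D) eq eq′) (sym (ℕ.m≡m%n+[m/n]*n b D)))

  Good : Pair → Set
  Good (G , y) = Peel hit (transv G) α × length (inner G) ≡ suc k

  quotients : Face ds → (Vertex ds → ℕ) → List ℕ
  quotients G f = map (λ v → f v ℕ./ D) (tail' (inner G))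

  -- The slack `n ∸ sum` in front turns k quotients of sum at most n into a composition of n into k
  -- + 1 parts. No quotients are recorded off G, where `Peel` fixes the coefficients.
  GoodCode : Pair → List (Vertex ds) × (List ℕ × List ℕ) → Set
  GoodCode (G , y) (W , r , q) = ∃ λ f → G ∈ Gs × y ∈ Y G × Coefficients n y f × Peel hit (transv G) α ×
    W ≡ inner G × r ≡ map (λ v → f v ℕ.% D) α × q ≡ (n ∸ sum (quotients G f)) ∷ quotients G f

  tail-⊆ : ∀ {A : Set} (xs : List A) {x} → x ∈ tail' xs → x ∈ xs
  tail-⊆ (x ∷ xs) = there

  GoodCode-face : ∀ {p p′ c} → GoodCode p c → GoodCode p′ c → proj₁ p ≡ proj₁ p′
  GoodCode-face {G , y} {G′ , y′} (f , G∈ , y∈ , c , pl , W≡ , _) (f′ , G′∈ , y′∈ , c′ , pl′ , W≡′ , _) =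
    Spans-determines G G′ (inner G) (AtFace.inner⊆G G (proj₁ (Gs-ok G∈)))
      (λ v∈ → AtFace.inner⊆G G′ (proj₁ (Gs-ok G′∈)) (subst (_ ∈_) (trans (sym W≡) W≡′) v∈))
      (AtFace.AtPoint.inner-spans G (proj₁ (Gs-ok G∈)) y∈ c)
      (subst (Spans G′) (trans (sym W≡′) W≡) (AtFace.AtPoint.inner-spans G′ (proj₁ (Gs-ok G′∈)) y′∈ c′))

  GoodCode-point : ∀ {G y y′ c} → GoodCode (G , y) c → GoodCode (G , y′) c → y ≡ y′
  GoodCode-point {G} (f , G∈ , y∈ , c , pl , _ , r≡ , q≡) (f′ , _ , y′∈ , c′ , _ , _ , r≡′ , q≡′) =
    Determined.determined c c′ (Peel-same-outer pl y∈ y′∈ c c′)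
      (λ v∈ → /%-injective (map-≡⇒ (trans (sym r≡) r≡′) (proj₁ (∈-sel⁻ (inFace G) (tail-⊆ (inner G) v∈))))
                           (map-≡⇒ (List.∷-injectiveʳ (trans (sym q≡) q≡′)) v∈))
    where open AtFace G (proj₁ (Gs-ok G∈))

  GoodCode-injective : ∀ {p p′ c} → GoodCode p c → GoodCode p′ c → p ≡ p′
  GoodCode-injective {G , y} {G′ , y′} {c} g g′ = go (GoodCode-face {G , y} {G′ , y′} g g′) g g′
    where
    go : ∀ {G′ y′} → G ≡ G′ → GoodCode (G , y) c → GoodCode (G′ , y′) c → (G , y) ≡ (G′ , y′)
    go refl g g′ = cong (G ,_) (GoodCode-point g g′)

  code : Face ds → (Vertex ds → ℕ) → List (Vertex ds) × (List ℕ × List ℕ)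
  code G f = inner G , map (λ v → f v ℕ.% D) α , (n ∸ sum (quotients G f)) ∷ quotients G f

  GoodCodes : List (List (Vertex ds) × (List ℕ × List ℕ))
  GoodCodes = cartesianProduct choices (cartesianProduct (elements E) (comps (suc k) n))

  code-∈ : ∀ {G y f} → G ∈ Gs → y ∈ Y G → Coefficients n y f → Good (G , y) → code G f ∈ GoodCodes
  code-∈ {G} {y} {f} G∈ y∈ c (pl , len) =
    ∈.∈-cartesianProduct⁺ (choices-ok G∈ len (class-inner pl (trans len (cong suc (sym (proj₂ (Gs-ok G∈)))))))
      (∈.∈-cartesianProduct⁺ (complete E remainders-reduced) (comps-complete (suc k) n _
        (cong suc (trans (List.length-map (λ v → f v ℕ./ D) (tail' (inner G))) (trans (length-tail′ (inner G)) (cong (_∸ 1) len))))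
        (ℕ.m∸n+n≡m (ℕ.≤-trans (ℕ.≤-reflexive (sum-map (tail' (inner G)) (λ v → f v ℕ./ D))) inner-/D≤n))))
    where
    open AtFace G (proj₁ (Gs-ok G∈))
    open AtPoint y∈ c

  length-GoodCodes : length GoodCodes ≡ length choices * (D * #comps (suc k) n)
  length-GoodCodes = trans (length-product choices (cartesianProduct (elements E) (comps (suc k) n)))
    (cong (length choices *_) (trans (length-product (elements E) (comps (suc k) n)) (cong (_* #comps (suc k) n) (size≡ E))))

  good-count : ∀ ps → Unique ps → (∀ {p} → p ∈ ps → Covered p × Good p) →
    length ps ≤ length choices * (D * #comps (suc k) n)
  good-count ps u ok = subst (length ps ≤_) length-GoodCodes
    (length-≤ GoodCode ps GoodCodes u (λ p∈ → encode (ok p∈)) (λ {p} {p′} → GoodCode-injective {p} {p′}))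
    where
    encode : ∀ {p} → Covered p × Good p → ∃ λ c → c ∈ GoodCodes × GoodCode p c
    encode {G , y} ((G∈ , y∈ , f , c) , good) =
      code G f , code-∈ G∈ y∈ c good , f , G∈ , y∈ , c , proj₁ good , refl , refl , refl

  -- Without a `Peel` the outer quotients must be recorded too, but they are below the constant K.
  -- With at most k inner vertices, at most k - 1 quotients can be of order n.
  BadCode : Face ds → Pair → List ℕ × (List ℕ × List ℕ) → Set
  BadCode G (G′ , y) (r , q₁ , q₂) = G′ ≡ G × ∃ λ f → Coefficients n y f ×
    r ≡ map (λ v → f v ℕ.% D) α × q₁ ≡ map (λ v → f v ℕ./ D) (outer G) × q₂ ≡ quotients G f

  bad-weight : Face ds → ℕ
  bad-weight G = D * K ^ length (outer G)

  -- The factor n′, at most `suc n`, raises the exponent of `suc n` from i - 1 to i, where i ≤ k is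
  -- the number of inner vertices.
  bad-count : ∀ {G} → G ∈ Gs → ∀ ps → Unique ps →
    (∀ {p} → p ∈ ps → proj₁ p ≡ G × Covered p × length (inner (proj₁ p)) ≤ k) →
    n′ * length ps ≤ bad-weight G * suc n ^ k
  -- Separate because only an actual pair guarantees an inner vertex, without which `i ∸ 1` would
  -- not be one less than i.
  bad-count {G} G∈ []           u ok = ℕ.≤-trans (ℕ.≤-reflexive (ℕ.*-zeroʳ n′)) z≤n
  bad-count {G} G∈ ps@(_ ∷ _) u ok = begin
    n′ * length ps                          ≤⟨ ℕ.*-mono-≤ (ℕ.m≤n⇒m≤1+n (ℕ.m≤m+n n′ (4 * K))) codes ⟩
    suc n * (D * (K ^ o * suc n ^ (i ∸ 1))) ≡⟨ ring (suc n) D (K ^ o) (suc n ^ (i ∸ 1)) ⟩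
    bad-weight G * (suc n * suc n ^ (i ∸ 1)) ≡⟨ cong (λ e → bad-weight G * suc n ^ e) (ℕ.m+[n∸m]≡n 1≤i) ⟩
    bad-weight G * suc n ^ i                ≤⟨ ℕ.*-monoʳ-≤ (bad-weight G) (ℕ.^-monoʳ-≤ (suc n) i≤k) ⟩
    bad-weight G * suc n ^ k                ∎
    where
    open ℕ.≤-Reasoning
    open AtFace G (proj₁ (Gs-ok G∈))
    i o : ℕ
    i = length (inner G)
    o = length (outer G)
    ring : ∀ s d a b → s * (d * (a * b)) ≡ d * a * (s * b)
    ring = ℕ-Ring.solve-∀
    bounds-at : ∀ {p} → proj₁ p ≡ G × Covered p × length (inner (proj₁ p)) ≤ k → 1 ≤ i × i ≤ k
    bounds-at {_ , y} (refl , (_ , y∈ , f , c) , le) = AtPoint.inner-nonempty y∈ c , le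
    bounds = bounds-at (ok (here refl))
    1≤i = proj₁ bounds
    i≤k = proj₂ bounds
    Codes : List (List ℕ × (List ℕ × List ℕ))
    Codes = cartesianProduct (elements E) (cartesianProduct (boxes o K) (boxes (i ∸ 1) (suc n)))
    code′ : (Vertex ds → ℕ) → List ℕ × (List ℕ × List ℕ)
    code′ f = map (λ v → f v ℕ.% D) α , map (λ v → f v ℕ./ D) (outer G) , quotients G f
    code′-∈ : ∀ {y f} → y ∈ Y G → Coefficients n y f → code′ f ∈ Codes
    code′-∈ {y} {f} y∈ c = ∈.∈-cartesianProduct⁺ (complete E remainders-reduced) (∈.∈-cartesianProduct⁺
        (∈-boxes (List.length-map (λ v → f v ℕ./ D) (outer G)) (All.map⁺ (All.tabulate f/D<K)))
        (∈-boxes (trans (List.length-map (λ v → f v ℕ./ D) (tail' (inner G))) (length-tail′ (inner G)))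
          (All.map⁺ (All.tabulate (λ v∈ → s≤s (f/D≤n (proj₁ (∈-sel⁻ (inFace G) (tail-⊆ (inner G) v∈)))))))))
      where open AtPoint y∈ c
    encode : ∀ {p} → proj₁ p ≡ G × Covered p × length (inner (proj₁ p)) ≤ k → ∃ λ c → c ∈ Codes × BadCode G p c
    encode {_ , y} (refl , (_ , y∈ , f , c) , _) = code′ f , code′-∈ y∈ c , refl , f , c , refl , refl , refl
    injective : ∀ {p p′ c} → BadCode G p c → BadCode G p′ c → p ≡ p′
    injective (refl , f , c , r≡ , q₁≡ , q₂≡) (refl , f′ , c′ , r≡′ , q₁≡′ , q₂≡′) = cong (G ,_) (Determined.determined c c′
      (λ v∈ → /%-injective (map-≡⇒ (trans (sym r≡) r≡′) (proj₁ (∈-sel⁻ (not ∘ inFace G) v∈))) (map-≡⇒ (trans (sym q₁≡) q₁≡′) v∈))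
      (λ v∈ → /%-injective (map-≡⇒ (trans (sym r≡) r≡′) (proj₁ (∈-sel⁻ (inFace G) (tail-⊆ (inner G) v∈))))
                           (map-≡⇒ (trans (sym q₂≡) q₂≡′) v∈)))
    codes : length ps ≤ D * (K ^ o * suc n ^ (i ∸ 1))
    codes = ℕ.≤-trans (length-≤ (BadCode G) ps Codes u (λ p∈ → encode (ok p∈)) (λ {p} {p′} → injective {p} {p′})) (ℕ.≤-reflexive
      (trans (length-product (elements E) (cartesianProduct (boxes o K) (boxes (i ∸ 1) (suc n)))) (cong₂ _*_ (size≡ E)
        (trans (length-product (boxes o K) (boxes (i ∸ 1) (suc n)))
        (cong₂ _*_ (length-boxes o K) (length-boxes (i ∸ 1) (suc n)))))))

  bad-total : ℕ
  bad-total = ∑ₙ Gs bad-weight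

  pairs-count : ∀ ps → Unique ps → (∀ {p} → p ∈ ps → Covered p) →
    n′ * k ! * length ps ≤ n′ * (length choices * D) * (n + k) ^ k + k ! * bad-total * suc n ^ k
  pairs-count ps u ok = begin
    n′ * k ! * length ps                                 ≡⟨ cong (n′ * k ! *_) length-parts ⟩
    n′ * k ! * (length left + length right)              ≡⟨ ring₁ n′ (k !) (length left) (length right) ⟩
    n′ * (k ! * length left) + k ! * (n′ * length right) ≤⟨ ℕ.+-mono-≤ (ℕ.*-monoʳ-≤ n′ good) (ℕ.*-monoʳ-≤ (k !) bad) ⟩
    n′ * (length choices * D * (n + k) ^ k) + k ! * (bad-total * suc n ^ k)
      ≡⟨ cong₂ _+_ (sym (ℕ.*-assoc n′ _ _)) (sym (ℕ.*-assoc (k !) bad-total _)) ⟩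
    n′ * (length choices * D) * (n + k) ^ k + k ! * bad-total * suc n ^ k ∎
    where
    open ℕ.≤-Reasoning
    ring₁ : ∀ n f a b → n * f * (a + b) ≡ n * (f * a) + f * (n * b)
    ring₁ = ℕ-Ring.solve-∀
    ring₂ : ∀ f a d c → f * (a * (d * c)) ≡ a * d * (f * c)
    ring₂ = ℕ-Ring.solve-∀
    classify : ∀ {p} → Covered p → Good p ⊎ (length (inner (proj₁ p)) ≤ k)
    classify {G , y} (G∈ , y∈ , f , c) =
      subst (λ r → Good′ r ⊎ (length (inner G) ≤ r)) (proj₂ (Gs-ok G∈)) (Sum.swap (AtFace.AtPoint.dichotomy G (proj₁ (Gs-ok G∈)) y∈ c))
      where
      Good′ : ℕ → Set
      Good′ r = Peel hit (transv G) α × length (inner G) ≡ suc r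
    parts : Partition Good (λ p → length (inner (proj₁ p)) ≤ k) ps
    parts = partition ps u (λ p∈ → classify (ok p∈))
    open Partition parts
    good : k ! * length left ≤ length choices * D * (n + k) ^ k
    good = begin
      k ! * length left                                 ≤⟨ ℕ.*-monoʳ-≤ (k !) (good-count left left-unique (λ p∈ → let (q , g) = left-ok p∈ in ok q , g)) ⟩
      k ! * (length choices * (D * #comps (suc k) n))   ≡⟨ ring₂ (k !) (length choices) D (#comps (suc k) n) ⟩
      length choices * D * (k ! * #comps (suc k) n)     ≤⟨ ℕ.*-monoʳ-≤ (length choices * D) (#comps-≤ k n) ⟩
      length choices * D * (n + k) ^ k                  ∎
    ∑ₙ-*ʳ : ∀ xs c → ∑ₙ xs (λ G → bad-weight G * c) ≡ ∑ₙ xs bad-weight * c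
    ∑ₙ-*ʳ []       c = refl
    ∑ₙ-*ʳ (x ∷ xs) c = trans (cong (ℕ._+_ (bad-weight x * c)) (∑ₙ-*ʳ xs c)) (sym (ℕ.*-distribʳ-+ c (bad-weight x) (∑ₙ xs bad-weight)))
    bad : n′ * length right ≤ bad-total * suc n ^ k
    bad = ℕ.≤-trans (cover-count (λ p G → proj₁ p ≡ G × Covered p × length (inner (proj₁ p)) ≤ k) n′
        (λ G → bad-weight G * suc n ^ k) Gs (λ G∈ qs uq okq → bad-count G∈ qs uq okq) right right-unique at-face)
      (ℕ.≤-reflexive (∑ₙ-*ʳ Gs (suc n ^ k)))
      where
      at-face : ∀ {p} → p ∈ right → Any.Any (λ G → proj₁ p ≡ G × Covered p × length (inner (proj₁ p)) ≤ k) Gs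
      at-face p∈ = Any.map (λ eq → eq , ok (proj₁ (right-ok p∈)) , proj₂ (right-ok p∈)) (proj₁ (ok (proj₁ (right-ok p∈))))

-- Summation over the cover

pairs : ∀ {A B : Set} → (A → List B) → List A → List (A × B)
pairs f = concatMap (λ a → map (a ,_) (f a))

∈-pairs⁻ : ∀ {A B : Set} (f : A → List B) as {p} → p ∈ pairs f as → proj₁ p ∈ as × proj₂ p ∈ f (proj₁ p)
∈-pairs⁻ f (a ∷ as) p∈ with ∈.∈-++⁻ (map (a ,_) (f a)) p∈
... | inj₂ q = let (a∈ , b∈) = ∈-pairs⁻ f as q in there a∈ , b∈
... | inj₁ q with ∈.∈-map⁻ (a ,_) q
... | b , b∈ , refl = here refl , b∈

pairs-unique : ∀ {A B : Set} (f : A → List B) as → Unique as → (∀ a → Unique (f a)) → Unique (pairs f as)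
pairs-unique f []       u        uf = []
pairs-unique f (a ∷ as) (a∉ ∷ u) uf = Unique.++⁺ (Unique.map⁺ (cong proj₂) (uf a)) (pairs-unique f as u uf) disjoint
  where
  disjoint : ∀ {p} → p ∈ map (a ,_) (f a) × p ∈ pairs f as → ⊥
  disjoint (q , r) with ∈.∈-map⁻ (a ,_) q
  ... | b , _ , refl = All.lookup a∉ (proj₁ (∈-pairs⁻ f as r)) refl

length-pairs : ∀ {A B : Set} (f : A → List B) as m d → (∀ {a} → a ∈ as → m ≤ d * length (f a)) → length as * m ≤ d * length (pairs f as)
length-pairs f []       m d le = z≤n
length-pairs f (a ∷ as) m d le = begin
  m + length as * m                               ≤⟨ ℕ.+-mono-≤ (le (here refl)) (length-pairs f as m d (le ∘ there)) ⟩
  d * length (f a) + d * length (pairs f as)      ≡⟨ ℕ.*-distribˡ-+ d (length (f a)) (length (pairs f as)) ⟨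
  d * (length (f a) + length (pairs f as))        ≡⟨ cong (d *_) (trans (List.length-++ (map (a ,_) (f a))) (cong (_+ length (pairs f as)) (List.length-map (a ,_) (f a)))) ⟨
  d * length (pairs f (a ∷ as))                   ∎
  where open ℕ.≤-Reasoning

∑ₙ-mono : ∀ {A : Set} (xs : List A) {f g : A → ℕ} → (∀ {a} → a ∈ xs → f a ≤ g a) → ∑ₙ xs f ≤ ∑ₙ xs g
∑ₙ-mono []       le = z≤n
∑ₙ-mono (x ∷ xs) le = ℕ.+-mono-≤ (le (here refl)) (∑ₙ-mono xs (le ∘ there))

≤-maximum : ∀ {a xs} → a ∈ xs → a ≤ maximum xs
≤-maximum {xs = x ∷ xs} (here refl) = ℕ.m≤m⊔n x (maximum xs)
≤-maximum {xs = x ∷ xs} (there a∈)  = ℕ.≤-trans (≤-maximum a∈) (ℕ.m≤n⊔m x (maximum xs))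

sum-by-class : ∀ {A : Set} (cl : A → ℕ) (g : ℕ → ℕ) (cov : List A) cs → (∀ {σ} → σ ∈ cov → cl σ ∈ cs) →
  ∑ₙ cov (g ∘ cl) ≤ ∑ₙ cs (λ c → length (filter (λ σ → cl σ ℕ.≟ c) cov) * g c)
sum-by-class cl g []        cs cl∈ = z≤n
sum-by-class {A} cl g (σ ∷ cov) cs cl∈ = ℕ.≤-trans (ℕ.+-monoʳ-≤ (g (cl σ)) (sum-by-class cl g cov cs (cl∈ ∘ there))) (add (cl∈ (here refl)))
  where
  tally : List A → ℕ → ℕ
  tally cov c = length (filter (λ σ → cl σ ℕ.≟ c) cov)
  grows : ∀ c → tally cov c ≤ tally (σ ∷ cov) c
  grows c with cl σ ℕ.≟ c
  ... | yes eq = ℕ.≤-trans (ℕ.n≤1+n _) (ℕ.≤-reflexive (sym (cong length (List.filter-accept (λ σ′ → cl σ′ ℕ.≟ c) {x = σ} {xs = cov} eq))))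
  ... | no ≢   = ℕ.≤-reflexive (sym (cong length (List.filter-reject (λ σ′ → cl σ′ ℕ.≟ c) {x = σ} {xs = cov} ≢)))
  tally-self : tally (σ ∷ cov) (cl σ) ≡ suc (tally cov (cl σ))
  tally-self = cong length (List.filter-accept (λ σ′ → cl σ′ ℕ.≟ cl σ) {x = σ} {xs = cov} refl)
  add : ∀ {cs} → cl σ ∈ cs → g (cl σ) + ∑ₙ cs (λ c → tally cov c * g c) ≤ ∑ₙ cs (λ c → tally (σ ∷ cov) c * g c)
  add {c ∷ cs} (here refl) = ℕ.≤-trans (ℕ.≤-reflexive (sym (ℕ.+-assoc (g c) _ _)))
    (ℕ.+-mono-≤ (ℕ.≤-reflexive (sym (cong (_* g c) tally-self))) (∑ₙ-mono cs (λ {c} _ → ℕ.*-monoˡ-≤ (g c) (grows c))))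
  add {c ∷ cs} (there p) = ℕ.≤-trans (ℕ.≤-reflexive (ring (g (cl σ)) (tally cov c * g c) (∑ₙ cs (λ c → tally cov c * g c))))
    (ℕ.+-mono-≤ (ℕ.*-monoˡ-≤ (g c) (grows c)) (add p))
    where
    ring : ∀ x y z → x + (y + z) ≡ y + (x + z)
    ring = ℕ-Ring.solve-∀

T-∧⁺ : ∀ {a b} → T a → T b → T (a ∧ b)
T-∧⁺ {true} _ q = q

T-∧⁻ : ∀ {a b} → T (a ∧ b) → T a × T b
T-∧⁻ {true} q = tt , q

T-⌊⌋⁺ : ∀ {P : Set} (p? : Dec P) → P → T ⌊ p? ⌋
T-⌊⌋⁺ (yes _) p = tt
T-⌊⌋⁺ (no ¬p) p = ¬p p

T-⌊⌋⁻ : ∀ {P : Set} (p? : Dec P) → T ⌊ p? ⌋ → P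
T-⌊⌋⁻ (yes p) _ = p

module Bound (s t s′ t′ : ℕ) (cov : List (List (Vertex (dims s t)))) (cover : IsCover cov) where

  ds : List ℕ
  ds = dims s t

  k : ℕ
  k = s′ + 2 * t′

  Gs : List (Face ds)
  Gs = sel (isType s′ t′) (allFaces ds)

  type-of : ∀ {G} → G ∈ Gs → nSeg G ≡ s′ × nTri G ≡ t′
  type-of {G} G∈ = let (a , b) = T-∧⁻ {⌊ nSeg G ℕ.≟ s′ ⌋} (proj₂ (∈-sel⁻ (isType s′ t′) {allFaces ds} G∈)) in
    T-⌊⌋⁻ (nSeg G ℕ.≟ s′) a , T-⌊⌋⁻ (nTri G ℕ.≟ t′) b

  Gs-ok : ∀ {G} → G ∈ Gs → Nonempty G × rdim G ≡ k
  Gs-ok {G} G∈ = ne , trans (rdim-type G (Small-dims s t) ne) (cong₂ (λ a b → a + 2 * b) (proj₁ (type-of G∈)) (proj₂ (type-of G∈)))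
    where
    ne : Nonempty G
    ne = allFaces-nonempty (proj₁ (∈-sel⁻ (isType s′ t′) G∈))

  -- The list `Canonical.α` without the proof that σ is a simplex, so that sums over the cover can
  -- mention it.
  canonical : List (Vertex ds) → List (Vertex ds)
  canonical σ = filter (_∈ᵥ? σ) (allVertices ds)

  full : ∀ {σ} → σ ∈ cov → IsFullSimplex σ
  full = All.lookup (proj₁ cover)

  counted : ℕ → List (Vertex ds) → Bool
  counted c W = BoolList.any (λ G → isType s′ t′ G ∧ BoolList.all (inFace G) W ∧ ⌊ classIn G W ℕ.≟ c ⌋) (allFaces ds)

  -- Chosen so that its length is `extCount` by definition.
  choices : ℕ → List (Vertex ds) → List (List (Vertex ds))
  choices c α = sel (counted c) (choose (suc k) α)

  choices-ok : ∀ {G} → G ∈ Gs → ∀ α c → let W = sel (inFace G) α in length W ≡ suc k → classIn G W ≡ c → W ∈ choices c α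
  choices-ok {G} G∈ α c len cl = ∈-sel⁺ (counted c)
    (subst (λ j → W ∈ choose j α) len (filter-∈-choose (λ v → T? (inFace G v)) α))
    (Any.any⁺ _ (Any.map (λ { refl → T-∧⁺ (proj₂ G∈′) (T-∧⁺
      (All.all⁻ (inFace G) (All.tabulate (λ v∈ → proj₂ (∈-sel⁻ (inFace G) {α} v∈)))) (T-⌊⌋⁺ (classIn G W ℕ.≟ c) cl)) }) (proj₁ G∈′)))
    where
    W = sel (inFace G) α
    G∈′ = ∈-sel⁻ (isType s′ t′) {allFaces ds} G∈

  weighted : List (Vertex ds) → ℕ
  weighted σ = extCount s t s′ t′ (classOf σ) (canonical σ) * classOf σ

  A B K κ : ℕ
  A = ∑ₙ cov weighted
  K = 2 ^ ncoords ds
  bad : List (Vertex ds) → ℕ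
  bad σ = ∑ₙ Gs (λ G → classOf σ * K ^ length (sel (not ∘ inFace G) (canonical σ)))
  B = ∑ₙ cov bad
  -- Large enough that `n + k` and `suc n` are both at most `n′ + suc κ`.
  κ = 4 * K + k

  module _ (n′ : ℕ) where

    n : ℕ
    n = n′ + 4 * K

    instance
      K≢0 : NonZero K
      K≢0 = m^n≢0 2 (ncoords ds)
      n≢0 : NonZero n
      n≢0 = ℕ.>-nonZero (ℕ.≤-trans (ℕ.>-nonZero⁻¹ K) (ℕ.≤-trans (ℕ.m≤m+n K (3 * K)) (ℕ.m≤n+m (4 * K) n′)))

    Y : Face ds → List (Grid ds)
    Y G = grid K n G (weight 0) id

    transv≤K : ∀ (G : Face ds) → ∑ₙ (transversal G id) (weight 0) ≤ K
    transv≤K G = ℕ.<⇒≤ (proj₂ (transversal-Chain (weight 0) G id 0 0 (λ _ → refl) (s≤s z≤n)))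

    ps : List (Face ds × Grid ds)
    ps = pairs Y Gs

    ps-unique : Unique ps
    ps-unique = pairs-unique Y Gs (sel-unique (isType s′ t′) (allFaces-unique ds)) (λ G → grid-unique K n G (weight 0) id)

    length-ps : Q s t s′ t′ * n′ ^ k ≤ 2 ^ t′ * length ps
    length-ps = length-pairs Y Gs (n′ ^ k) (2 ^ t′) (λ {G} G∈ → subst₂ (λ a b → n′ ^ a ≤ 2 ^ b * length (Y G)) (proj₂ (Gs-ok G∈)) (proj₂ (type-of G∈))
      (length-grid K n′ G (weight 0) id (Small-dims s t) (proj₁ (Gs-ok G∈)) (transv≤K G)))

    Lies : Face ds × Grid ds → List (Vertex ds) → Set
    Lies (G , y) σ = G ∈ Gs × y ∈ Y G × InHull σ (rescale n y)

    covered : ∀ {p} → p ∈ ps → Any.Any (Lies p) cov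
    covered {G , y} p∈ = let (G∈ , y∈) = ∈-pairs⁻ Y Gs p∈ in
      Any.map (λ h → G∈ , y∈ , h) (proj₂ (proj₂ cover) (rescale n y)
        (rescale-InP n y (grid-balanced K n′ G (weight 0) id (Small-dims s t) (transv≤K G) y∈)))

    bound : List (Vertex ds) → ℕ
    bound σ = n′ * weighted σ * (n + k) ^ k + k ! * bad σ * suc n ^ k

    per-simplex : ∀ {σ} → σ ∈ cov → ∀ qs → Unique qs → (∀ {p} → p ∈ qs → Lies p σ) → n′ * k ! * length qs ≤ bound σ
    per-simplex {σ} σ∈ qs u lies = subst (λ c → n′ * k ! * length qs ≤ n′ * (length (choices c (canonical σ)) * c) * (n + k) ^ k +
        k ! * ∑ₙ Gs (λ G → c * K ^ length (sel (not ∘ inFace G) (canonical σ))) * suc n ^ k) D≡class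
      (CountPairs.pairs-count σ (full σ∈) n′ k Gs Gs-ok (choices D (canonical σ)) (λ G∈ → choices-ok G∈ (canonical σ) D) qs u
        (λ {p} p∈ → let (G∈ , y∈ , h) = lies p∈ in G∈ , y∈ , coefficients n (proj₂ p) h))
      where open Canonical σ (full σ∈)

    -- The factor k! clears the denominator of the composition counts, `2 ^ t′` those of the
    -- triangles, and n′ that of the lower-order terms.
    growth : n′ * (Q s t s′ t′ * k !) * n′ ^ k ≤ n′ * (2 ^ t′ * A) * (n′ + suc κ) ^ k + 2 ^ t′ * (k ! * B) * (n′ + suc κ) ^ k
    growth = begin
      n′ * (q * k !) * n′ ^ k                     ≡⟨ ring₁ n′ q (k !) (n′ ^ k) ⟩
      n′ * k ! * (q * n′ ^ k)                     ≤⟨ ℕ.*-monoʳ-≤ (n′ * k !) length-ps ⟩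
      n′ * k ! * (2 ^ t′ * length ps)             ≡⟨ ring₂ (n′ * k !) (2 ^ t′) (length ps) ⟩
      2 ^ t′ * (n′ * k ! * length ps)             ≤⟨ ℕ.*-monoʳ-≤ (2 ^ t′) (cover-count Lies (n′ * k !) bound cov per-simplex ps ps-unique covered) ⟩
      2 ^ t′ * ∑ₙ cov bound                       ≤⟨ ℕ.*-monoʳ-≤ (2 ^ t′) (ℕ.≤-reflexive (∑-bound cov)) ⟩
      2 ^ t′ * (n′ * A * (n + k) ^ k + k ! * B * suc n ^ k)
        ≤⟨ ℕ.*-monoʳ-≤ (2 ^ t′) (ℕ.+-mono-≤ (ℕ.*-monoʳ-≤ (n′ * A) (ℕ.^-monoˡ-≤ k n+k≤)) (ℕ.*-monoʳ-≤ (k ! * B) (ℕ.^-monoˡ-≤ k sn≤))) ⟩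
      2 ^ t′ * (n′ * A * p + k ! * B * p)         ≡⟨ ring₃ (2 ^ t′) n′ A p (k ! * B) ⟩
      n′ * (2 ^ t′ * A) * p + 2 ^ t′ * (k ! * B) * p ∎
      where
      open ℕ.≤-Reasoning
      q p : ℕ
      q = Q s t s′ t′
      p = (n′ + suc κ) ^ k
      n+k≤ : n + k ≤ n′ + suc κ
      n+k≤ = ℕ.≤-trans (ℕ.≤-reflexive (ℕ.+-assoc n′ (4 * K) k)) (ℕ.+-monoʳ-≤ n′ (ℕ.n≤1+n κ))
      sn≤ : suc n ≤ n′ + suc κ
      sn≤ = ℕ.≤-trans (ℕ.≤-reflexive (sym (ℕ.+-suc n′ (4 * K)))) (ℕ.+-monoʳ-≤ n′ (s≤s (ℕ.m≤m+n (4 * K) k)))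
      ring₁ : ∀ n q f p → n * (q * f) * p ≡ n * f * (q * p)
      ring₁ = ℕ-Ring.solve-∀
      ring₂ : ∀ a b c → a * (b * c) ≡ b * (a * c)
      ring₂ = ℕ-Ring.solve-∀
      ring₃ : ∀ b n a p c → b * (n * a * p + c * p) ≡ n * (b * a) * p + b * c * p
      ring₃ = ℕ-Ring.solve-∀
      ∑-bound : ∀ cov → ∑ₙ cov bound ≡ n′ * ∑ₙ cov weighted * (n + k) ^ k + k ! * ∑ₙ cov bad * suc n ^ k
      ∑-bound []        = ring₀ n′ ((n + k) ^ k) (k !) (suc n ^ k)
        where
        ring₀ : ∀ a b c d → 0 ≡ a * 0 * b + c * 0 * d
        ring₀ = ℕ-Ring.solve-∀
      ∑-bound (σ ∷ cov) = trans (cong (ℕ._+_ (bound σ)) (∑-bound cov))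
        (ring₄ n′ (weighted σ) (∑ₙ cov weighted) ((n + k) ^ k) (k !) (bad σ) (∑ₙ cov bad) (suc n ^ k))
        where
        ring₄ : ∀ n w w′ p f b b′ r → (n * w * p + f * b * r) + (n * w′ * p + f * b′ * r) ≡ n * (w + w′) * p + f * (b + b′) * r
        ring₄ = ℕ-Ring.solve-∀

  volume-bound : Q s t s′ t′ * k ! ≤ 2 ^ t′ * A
  volume-bound = leading-coefficient (Q s t s′ t′ * k !) (2 ^ t′ * A) (2 ^ t′ * (k ! * B)) κ k growth

  weighted≤F : ∀ {σ} → σ ∈ cov → weighted σ ≤ classOf σ * F s t (classOf σ) s′ t′ (classOf σ)
  weighted≤F {σ} σ∈ = ℕ.≤-trans (ℕ.≤-reflexive (ℕ.*-comm _ (classOf σ))) (ℕ.*-monoʳ-≤ (classOf σ)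
    (≤-maximum (∈.∈-map⁺ (extCount s t s′ t′ (classOf σ)) (∈.∈-filter⁺ (λ α → classOf α ℕ.≟ classOf σ) α∈choose (trans classOf-α D≡class)))))
    where open Canonical σ (full σ∈)

theorem6 : (s t : ℕ) (cov : List (List (Vertex (dims s t)))) → IsCover cov →
    (v : ℕ) → IsV s t v →
    (t' s' : ℕ) → t' ≤ t → s' ≤ s + t ∸ t' →
    _/_ (+ Q s t s' t') (2 ^ t') {{m^n≢0 2 t'}}
      ≤ℚ sumℚ (map (λ c → _/_ (+ (c * xcount cov c * F s t c s' t' c)) ((s' + 2 * t') !) {{(s' + 2 * t') !≢0}})
                   (map suc (upTo v)))
theorem6 s t cov cover v isV t' s' _ _ =
  subst ((+ Q s t s' t') / (2 ^ t') ≤ℚ_) (sym (sumℚ-/ (k !) classes term))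
    (/-mono-≤ (Q s t s' t') (2 ^ t') (∑ₙ classes term) (k !) (begin
      Q s t s' t' * k !                    ≤⟨ volume-bound ⟩
      2 ^ t' * A                           ≤⟨ ℕ.*-monoʳ-≤ (2 ^ t') (∑ₙ-mono cov weighted≤F) ⟩
      2 ^ t' * ∑ₙ cov (g ∘ classOf)        ≤⟨ ℕ.*-monoʳ-≤ (2 ^ t') (sum-by-class classOf g cov classes class∈) ⟩
      2 ^ t' * ∑ₙ classes (λ c → xcount cov c * g c)
        ≡⟨ cong (2 ^ t' *_) (∑ₙ-cong classes (λ {c} _ → ring (xcount cov c) c (F s t c s' t' c))) ⟩
      2 ^ t' * ∑ₙ classes term             ≡⟨ ℕ.*-comm (2 ^ t') (∑ₙ classes term) ⟩
      ∑ₙ classes term * 2 ^ t'             ∎))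
  where
  open ℕ.≤-Reasoning
  open Bound s t s' t' cov cover
  instance
    2^t'≢0 : NonZero (2 ^ t')
    2^t'≢0 = m^n≢0 2 t'
    k!≢0 : NonZero (k !)
    k!≢0 = k !≢0
  classes : List ℕ
  classes = map suc (upTo v)
  term g : ℕ → ℕ
  term c = c * xcount cov c * F s t c s' t' c
  g c = c * F s t c s' t' c
  ring : ∀ x c f → x * (c * f) ≡ c * x * f
  ring = ℕ-Ring.solve-∀
  class∈ : ∀ {σ} → σ ∈ cov → classOf σ ∈ classes
  -- The class is positive because σ is a simplex, which fits the shift by `suc` in `classes`, and
  -- `IsV` bounds it by v.
  class∈ {σ} σ∈ with classOf σ | proj₂ (proj₂ (full σ∈)) | All.lookup (proj₂ isV cov cover) σ∈
  ... | zero  | ≢0 | _  = contradiction refl ≢0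
  ... | suc c | _  | le = ∈.∈-map⁺ suc (∈.∈-upTo⁺ le)
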